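{- Let $p$ be an odd prime and let $G$ be a finite abelian $p$-group. If $|G|\geq p^3$ and $G$ is not cyclic, then there exists a proper Cayley digraph $\Gamma$ on $G$ with Cayley index $p$ such that $\mathrm{Aut}(\Gamma)$ contains a nonabelian regular subgroup.
   Context: All digraphs and groups are finite. A digraph $\Gamma$ has a vertex set $\mathrm{V}(\Gamma)$ and an arc set $\mathrm{A}(\Gamma)$ consisting of ordered pairs of distinct vertices (no loops). $\Gamma$ is a graph if $(v,u)$ is an arc whenever $(u,v)$ is; otherwise $\Gamma$ is a proper digraph. $\mathrm{Aut}(\Gamma)$ is the group of permutations of $\mathrm{V}(\Gamma)$ preserving $\mathrm{A}(\Gamma)$. For a group $G$ and $S\subseteq G$ not containing the identity, the Cayley digraph $\mathrm{Cay}(G,S)$ has vertex set $G$ and arcs $(u,v)$ whenever $vu^{ -1}\in S$. The group $G$ embeds in $\mathrm{Aut}(\mathrm{Cay}(G,S))$ via its right regular representation (right multiplication), and the Cayley index of $\mathrm{Cay}(G,S)$ is the index $|\mathrm{Aut}(\mathrm{Cay}(G,S)):G|$. A subgroup of $\mathrm{Aut}(\Gamma)$ is regular if it acts regularly on $\mathrm{V}(\Gamma)$. -}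

module Defs where

open import Data.Nat using (ℕ; zero; suc; _*_)
open import Data.Fin using (Fin)
open import Data.Fin.Subset using (Subset; _∈_; _∉_)
open import Data.Product using (Σ; ∃; ∃-syntax; _×_; _,_)
open import Relation.Binary.PropositionalEquality using (_≡_)
open import Relation.Nullary using (¬_)
open import Function using (_∘_; id)
open import Function.Bundles using (_⇔_)

record FinGroup : Set where
  field
    order  : ℕ
    _·_    : Fin order → Fin order → Fin order
    e      : Fin order
    inv    : Fin order → Fin order
    assoc  : ∀ x y z → (x · y) · z ≡ x · (y · z)
    idˡ    : ∀ x → e · x ≡ x
    idʳ    : ∀ x → x · e ≡ x
    invˡ   : ∀ x → inv x · x ≡ e
    invʳ   : ∀ x → x · inv x ≡ e

module _ (G : FinGroup) where
  open FinGroup G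

  IsAbelian : Set
  IsAbelian = ∀ x y → x · y ≡ y · x

  pow : Fin order → ℕ → Fin order
  pow g zero    = e
  pow g (suc k) = g · pow g k

  IsCyclic : Set
  IsCyclic = ∃[ g ] (∀ x → ∃[ k ] pow g k ≡ x)

  CayArc : Subset order → Fin order → Fin order → Set
  CayArc S u v = (v · inv u) ∈ S

Digraph : ℕ → Set₁
Digraph n = Fin n → Fin n → Set

_≗_ : ∀ {n} → (Fin n → Fin n) → (Fin n → Fin n) → Set
f ≗ g = ∀ x → f x ≡ g x

IsPerm : ∀ {n} → (Fin n → Fin n) → Set
IsPerm {n} σ = ∃[ τ ] ((σ ∘ τ) ≗ id × (τ ∘ σ) ≗ id)

IsProper : ∀ {n} → Digraph n → Set
IsProper Γ = ∃[ u ] ∃[ v ] (Γ u v × ¬ Γ v u)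

IsAut : ∀ {n} → Digraph n → (Fin n → Fin n) → Set
IsAut Γ σ = IsPerm σ × (∀ u v → Γ u v ⇔ Γ (σ u) (σ v))

AutOrder : ∀ {n} → Digraph n → ℕ → Set
AutOrder {n} Γ m =
  Σ (Fin m → (Fin n → Fin n)) λ a →
    (∀ i → IsAut Γ (a i)) ×
    (∀ i j → a i ≗ a j → i ≡ j) ×
    (∀ σ → IsAut Γ σ → ∃[ i ] (a i ≗ σ))

record AutSubgroup {n} (Γ : Digraph n) (m : ℕ) : Set where
  field
    elt       : Fin m → (Fin n → Fin n)
    isAut     : ∀ i → IsAut Γ (elt i)
    distinct  : ∀ i j → elt i ≗ elt j → i ≡ j
    hasId     : ∃[ i ] (elt i ≗ id)
    closedMul : ∀ i j → ∃[ k ] (elt k ≗ (elt i ∘ elt j))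
    closedInv : ∀ i → ∃[ j ] ((elt j ∘ elt i) ≗ id)

module _ {n} {Γ : Digraph n} {m} (H : AutSubgroup Γ m) where
  open AutSubgroup H

  IsRegular : Set
  IsRegular = ∀ u v → ∃[ i ] (elt i u ≡ v × ∀ j → elt j u ≡ v → j ≡ i)

  IsNonabelian : Set
  IsNonabelian = ∃[ i ] ∃[ j ] ¬ ((elt i ∘ elt j) ≗ (elt j ∘ elt i))

HasNonabelianRegularSubgroup : ∀ {n} → Digraph n → Set
HasNonabelianRegularSubgroup {n} Γ =
  ∃[ m ] Σ (AutSubgroup Γ m) λ H → IsRegular H × IsNonabelian H

{-# OPTIONS --safe #-}
module Submission where

-- Write G additively.  Choose K ≤ G containing p G with G / K elementary abelian of order p² on
-- e₁, e₂, and independent elements z₁, z₂ of order p with z₂ ∈ K.  With f₁, f₂ the coordinates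
-- modulo K, the map σ x = x + f₁ x • z₁ + f₂ x • z₂ is an automorphism of order p, and the maps
-- x ↦ σ^(f₁ g) x + g form a regular subgroup of G ⋊ ⟨ σ ⟩, nonabelian because σ moves e₂ while
-- f₁ e₂ = 0.  It remains to find a σ-invariant connection set S such that automorphisms of
-- Cay(G, S) fixing 0 are powers of σ.
--
-- The subsets P of G such that v - u ∈ P is preserved by every automorphism of Cay(G, S) form a
-- Schur ring.  S ∩ K is a symmetric set generating K that encodes a chain of subgroups, while
-- the rest of S is antisymmetric; so K and the chain belong to the ring.  The rest of S consists
-- of σ-orbits that make it possible to separate the cosets of K and to recognise one generator
-- for each step of the chain.  If K contains z₁, the orbit of e₁ is e₁ + ⟨ z₁ ⟩, that of e₂ is
-- e₂ + ⟨ z₂ ⟩, and an automorphism fixing 0 and e₁ is propagated along squares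
-- x, x + e₁, x + e₂, x + e₁ + e₂ because lines in different directions of ⟨ z₁ , z₂ ⟩ meet only
-- in 0.  Otherwise one may take z₁ = e₂; then the orbit of e₁ is a parabola, hence a Sidon set,
-- which again forces an automorphism fixing 0 and e₁ to be trivial.

open import Defs
open import Algebra.Bundles using (CommutativeMonoid)
import Algebra.Properties.CommutativeMonoid.Sum as Sum
open import Data.Empty using (⊥; ⊥-elim)
open import Data.Fin using (Fin; toℕ; fromℕ<; combine; remQuot)
import Data.Fin.Permutation as Perm
open import Data.Fin.Properties using (nonZeroIndex; _≟_; any?; toℕ-fromℕ<; toℕ<n; toℕ-injective; injective⇒≤; remQuot-combine; combine-remQuot)
open import Data.Fin.Subset using (Subset; _∈_; _∉_)
open import Data.Integer using (ℤ; -[1+_]; 0ℤ; 1ℤ; -1ℤ) renaming (+_ to pos)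
import Data.Integer as ℤ
import Data.Integer.DivMod as ℤ
import Data.Integer.Properties as ℤ
open import Data.Integer.Divisibility.Signed using (divides; ∣⇒∣ᵤ; ∣m∣n⇒∣m+n; ∣m∣n⇒∣m-n; ∣m⇒∣-m; ∣n⇒∣m*n; ∣m⇒∣m*n) renaming (_∣_ to _∣ℤ_; _∣?_ to _∣ℤ?_)
open import Data.Integer.Tactic.RingSolver using (solve-∀)
open import Data.List using (List; []; _∷_; allFin)
open import Data.List.Membership.Propositional.Properties using (∈-allFin)
open import Data.List.Relation.Unary.All as All using (All; []; _∷_)
open import Data.Nat using (ℕ; zero; suc; _≤_; _<_; s≤s; z≤n; _*_; _^_)
import Data.Nat as ℕ
import Data.Nat.Properties as ℕ
open import Data.Nat.Coprimality using (prime⇒coprime; coprime-Bézout)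
open import Data.Nat.Divisibility using (_∣_)
open import Data.Nat.GCD using (module Bézout)
open import Data.Nat.Primality using (Prime; prime⇒nonZero; prime⇒nonTrivial)
open import Data.Product using (Σ; Σ-syntax; ∃-syntax; _×_; _,_; proj₁; proj₂)
open import Data.Sum using (_⊎_; inj₁; inj₂; [_,_]′)
open import Data.Vec using (Vec; []; _∷_; lookup; tabulate; replicate; zipWith; map)
open import Data.Vec.Properties using (lookup∘tabulate; lookup⇒[]=; []=⇒lookup)
open import Function using (_∘_; id; case_of_)
open import Function.Bundles using (mk⇔; Equivalence)
open import Relation.Binary.PropositionalEquality hiding (_≗_; [_])
open import Relation.Binary.PropositionalEquality.Properties using (isEquivalence)
import Relation.Binary.Reflection as Reflection
open import Relation.Nullary using (¬_; Dec; yes; no; does; ¬?; contradiction; _×-dec_; _⊎-dec_; map′; decidable-stable)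
open import Relation.Nullary.Decidable using (dec-true)
import Data.Nat.Divisibility as Nat
import Data.Nat.DivMod as Nat

-- Two cases are needed because `K` has to be small. In the product of cyclic groups of orders p²
-- and p, a subgroup of index p² containing p G has order p, so it cannot hold both z₁ and z₂. When
-- z₁ lies outside p G + ⟨ z₂ ⟩ it is made a basis vector of G / K instead, and σ becomes a Jordan
-- block e₁ ↦ e₁ + e₂, e₂ ↦ e₂ + z₂ with (σ - 1)² ≠ 0; in the other case (σ - 1)² = 0.
--
-- The second obstacle is that `K` may need any number of generators, all of which must be told
-- apart by one set S. A chain solves this: each generator is recognised by the step at which it
-- enters.
--
-- Rigidity is always shown by propagation. A small pattern of fixed points around x is shown to
-- reappear around x + g for every g in a generating set; as G is finite, closure under g gives
-- closure under - g, so the pattern spreads from 0 over all of G.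
--
-- That p is odd is used three times: opposite cosets of `K` differ, so S can be antisymmetric
-- outside `K`; the directions z₁ + z₂ and z₁ - z₂ are independent; and 2 is invertible in the
-- formula for the powers of a Jordan block.

-- Integer multiples in a finite abelian group and a solver for linear identities.

module Abelian (G : FinGroup) (comm : IsAbelian G) where
  open FinGroup G public using () renaming (order to n; _·_ to infixl 6 _+_; e to 0#; inv to infix 8 -_)
  open FinGroup G using (assoc; idˡ; idʳ; invˡ; invʳ)

  A : Set
  A = Fin n

  infixl 6 _-_
  infixr 7 _•_

  _-_ : A → A → A
  x - y = x + - y

  _•_ : ℤ → A → A
  (pos k)    • x = pow G x k
  -[1+ k ] • x = - pow G x (suc k)

  +-commutativeMonoid : CommutativeMonoid _ _
  +-commutativeMonoid = record
    { Carrier = A ; _≈_ = _≡_ ; _∙_ = _+_ ; ε = 0#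
    ; isCommutativeMonoid = record
      { isMonoid = record
        { isSemigroup = record
          { isMagma = record { isEquivalence = isEquivalence ; ∙-cong = cong₂ _+_ }
          ; assoc = assoc }
        ; identity = idˡ , idʳ }
      ; comm = comm } }

  open ≡-Reasoning

  interchange : ∀ a b c d → (a + b) + (c + d) ≡ (a + c) + (b + d)
  interchange a b c d = begin
    (a + b) + (c + d) ≡⟨ assoc a b (c + d) ⟩
    a + (b + (c + d)) ≡⟨ cong (a +_) (sym (assoc b c d)) ⟩
    a + ((b + c) + d) ≡⟨ cong (λ w → a + (w + d)) (comm b c) ⟩
    a + ((c + b) + d) ≡⟨ cong (a +_) (assoc c b d) ⟩
    a + (c + (b + d)) ≡⟨ sym (assoc a c (b + d)) ⟩
    (a + c) + (b + d) ∎

  neg-unique : ∀ a b → a + b ≡ 0# → b ≡ - a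
  neg-unique a b a+b≡0 = begin
    b               ≡⟨ sym (idˡ b) ⟩
    0# + b          ≡⟨ cong (_+ b) (sym (invˡ a)) ⟩
    (- a + a) + b   ≡⟨ assoc (- a) a b ⟩
    - a + (a + b)   ≡⟨ cong (- a +_) a+b≡0 ⟩
    - a + 0#        ≡⟨ idʳ (- a) ⟩
    - a             ∎

  neg-involutive : ∀ a → - (- a) ≡ a
  neg-involutive a = sym (neg-unique (- a) a (invˡ a))

  neg-+ : ∀ a b → - (a + b) ≡ - a + - b
  neg-+ a b = sym (neg-unique (a + b) (- a + - b)
    (trans (interchange a b (- a) (- b)) (trans (cong₂ _+_ (invʳ a) (invʳ b)) (idˡ 0#))))

  neg-0 : - 0# ≡ 0#
  neg-0 = sym (neg-unique 0# 0# (idˡ 0#))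

  pow-+ : ∀ x j k → pow G x (j ℕ.+ k) ≡ pow G x j + pow G x k
  pow-+ x zero    k = sym (idˡ _)
  pow-+ x (suc j) k = trans (cong (x +_) (pow-+ x j k)) (sym (assoc x _ _))

  pow-distrib : ∀ x y k → pow G (x + y) k ≡ pow G x k + pow G y k
  pow-distrib x y zero    = sym (idˡ 0#)
  pow-distrib x y (suc k) =
    trans (cong ((x + y) +_) (pow-distrib x y k)) (interchange x y _ _)

  ⊖-• : ∀ j k x → (j ℤ.⊖ k) • x ≡ pow G x j - pow G x k
  ⊖-• zero    zero    x = sym (trans (idˡ _) neg-0)
  ⊖-• zero    (suc k) x = sym (idˡ _)
  ⊖-• (suc j) zero    x = sym (trans (cong (pow G x (suc j) +_) neg-0) (idʳ _))
  ⊖-• (suc j) (suc k) x = begin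
    (suc j ℤ.⊖ suc k) • x                           ≡⟨ cong (_• x) (ℤ.[1+m]⊖[1+n]≡m⊖n j k) ⟩
    (j ℤ.⊖ k) • x                                   ≡⟨ ⊖-• j k x ⟩
    pow G x j - pow G x k                           ≡⟨ sym (idˡ _) ⟩
    0# + (pow G x j - pow G x k)                    ≡⟨ cong (_+ (pow G x j - pow G x k)) (sym (invʳ x)) ⟩
    (x + - x) + (pow G x j - pow G x k)             ≡⟨ interchange x (- x) _ _ ⟩
    (x + pow G x j) + (- x + - pow G x k)           ≡⟨ cong (pow G x (suc j) +_) (sym (neg-+ x _)) ⟩
    pow G x (suc j) - pow G x (suc k)               ∎

  •-+ : ∀ i j x → (i ℤ.+ j) • x ≡ i • x + j • x
  •-+ (pos i)    (pos j)    x = pow-+ x i j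
  •-+ (pos i)    -[1+ j ] x = ⊖-• i (suc j) x
  •-+ -[1+ i ] (pos j)    x = trans (⊖-• j (suc i) x) (comm _ _)
  •-+ -[1+ i ] -[1+ j ] x = begin
    - pow G x (suc (suc (i ℕ.+ j)))           ≡⟨ cong (λ k → - pow G x k) (sym (ℕ.+-suc (suc i) j)) ⟩
    - pow G x (suc i ℕ.+ suc j)               ≡⟨ cong -_ (pow-+ x (suc i) (suc j)) ⟩
    - (pow G x (suc i) + pow G x (suc j))     ≡⟨ neg-+ _ _ ⟩
    - pow G x (suc i) + - pow G x (suc j)     ∎

  •-distrib : ∀ i x y → i • (x + y) ≡ i • x + i • y
  •-distrib (pos k)    x y = pow-distrib x y k
  •-distrib -[1+ k ] x y = trans (cong -_ (pow-distrib x y (suc k))) (neg-+ _ _)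

  •-neg : ∀ i x → (ℤ.- i) • x ≡ - (i • x)
  •-neg (pos zero)  x = sym neg-0
  •-neg (pos (suc k)) x = refl
  •-neg -[1+ k ]  x = sym (neg-involutive _)

  1-• : ∀ x → 1ℤ • x ≡ x
  1-• = idʳ

  •-0# : ∀ i → i • 0# ≡ 0#
  •-0# i = begin
    i • 0#                          ≡⟨ sym (idʳ _) ⟩
    i • 0# + 0#                     ≡⟨ cong (i • 0# +_) (sym (invʳ (i • 0#))) ⟩
    i • 0# + (i • 0# - i • 0#)      ≡⟨ sym (assoc _ _ _) ⟩
    (i • 0# + i • 0#) - i • 0#      ≡⟨ cong (_- i • 0#) (sym (•-distrib i 0# 0#)) ⟩
    i • (0# + 0#) - i • 0#          ≡⟨ cong (λ w → i • w - i • 0#) (idˡ 0#) ⟩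
    i • 0# - i • 0#                 ≡⟨ invʳ _ ⟩
    0#                              ∎

  •-•⁺ : ∀ k j x → (pos k ℤ.* j) • x ≡ (pos k) • (j • x)
  •-•⁺ zero    j x = refl
  •-•⁺ (suc k) j x = begin
    (pos (suc k) ℤ.* j) • x              ≡⟨ cong (_• x) (ℤ.suc-* (pos k) j) ⟩
    (j ℤ.+ pos k ℤ.* j) • x            ≡⟨ •-+ j _ x ⟩
    j • x + (pos k ℤ.* j) • x          ≡⟨ cong (j • x +_) (•-•⁺ k j x) ⟩
    (pos (suc k)) • (j • x)              ∎

  •-• : ∀ i j x → (i ℤ.* j) • x ≡ i • (j • x)
  •-• (pos k)    j x = •-•⁺ k j x
  •-• -[1+ k ] j x = begin
    (ℤ.- (pos (suc k)) ℤ.* j) • x       ≡⟨ cong (_• x) (sym (ℤ.neg-distribˡ-* (pos (suc k)) j)) ⟩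
    (ℤ.- (pos (suc k) ℤ.* j)) • x       ≡⟨ •-neg (pos (suc k) ℤ.* j) x ⟩
    - ((pos (suc k) ℤ.* j) • x)         ≡⟨ cong -_ (•-•⁺ (suc k) j x) ⟩
    -[1+ k ] • (j • x)              ∎

  infixl 6 _:+_ _:-_
  infix  8 :-_
  infixr 7 _:•_

  data Expr (m : ℕ) : Set where
    var  : Fin m → Expr m
    :0   : Expr m
    _:+_ : Expr m → Expr m → Expr m
    :-_  : Expr m → Expr m
    _:•_ : ℤ → Expr m → Expr m

  _:-_ : ∀ {m} → Expr m → Expr m → Expr m
  a :- b = a :+ :- b

  ⟦_⟧ : ∀ {m} → Expr m → Vec A m → A
  ⟦ var i ⟧  ρ = lookup ρ i
  ⟦ :0 ⟧     ρ = 0#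
  ⟦ a :+ b ⟧ ρ = ⟦ a ⟧ ρ + ⟦ b ⟧ ρ
  ⟦ :- a ⟧   ρ = - ⟦ a ⟧ ρ
  ⟦ i :• a ⟧ ρ = i • ⟦ a ⟧ ρ

  combination : ∀ {m} → Vec ℤ m → Vec A m → A
  combination []       []      = 0#
  combination (c ∷ cs) (x ∷ ρ) = c • x + combination cs ρ

  unit : ∀ {m} → Fin m → Vec ℤ m
  unit Fin.zero    = 1ℤ ∷ replicate _ 0ℤ
  unit (Fin.suc i) = 0ℤ ∷ unit i

  -- Terms are linear in their variables, so the vector of integer coefficients is a normal form,
  -- and an identity is proved once both sides compute to the same vector.
  normalise : ∀ {m} → Expr m → Vec ℤ m
  normalise (var i)  = unit i
  normalise :0       = replicate _ 0ℤ
  normalise (a :+ b) = zipWith ℤ._+_ (normalise a) (normalise b)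
  normalise (:- a)   = map (ℤ._*_ -1ℤ) (normalise a)
  normalise (i :• a) = map (ℤ._*_ i) (normalise a)

  ⟦_⇓⟧ : ∀ {m} → Expr m → Vec A m → A
  ⟦ a ⇓⟧ = combination (normalise a)

  combination-0 : ∀ {m} (ρ : Vec A m) → combination (replicate m 0ℤ) ρ ≡ 0#
  combination-0 []      = refl
  combination-0 (x ∷ ρ) = trans (idˡ _) (combination-0 ρ)

  combination-unit : ∀ {m} (i : Fin m) ρ → combination (unit i) ρ ≡ lookup ρ i
  combination-unit Fin.zero    (x ∷ ρ) =
    trans (cong₂ _+_ (1-• x) (combination-0 ρ)) (idʳ x)
  combination-unit (Fin.suc i) (x ∷ ρ) = trans (idˡ _) (combination-unit i ρ)

  combination-+ : ∀ {m} (cs ds : Vec ℤ m) ρ →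
    combination (zipWith ℤ._+_ cs ds) ρ ≡ combination cs ρ + combination ds ρ
  combination-+ []       []       []      = sym (idˡ 0#)
  combination-+ (c ∷ cs) (d ∷ ds) (x ∷ ρ) =
    trans (cong₂ _+_ (•-+ c d x) (combination-+ cs ds ρ)) (interchange _ _ _ _)

  combination-• : ∀ {m} i (cs : Vec ℤ m) ρ →
    combination (map (ℤ._*_ i) cs) ρ ≡ i • combination cs ρ
  combination-• i []       []      = sym (•-0# i)
  combination-• i (c ∷ cs) (x ∷ ρ) =
    trans (cong₂ _+_ (•-• i c x) (combination-• i cs ρ)) (sym (•-distrib i _ _))

  normalise-correct : ∀ {m} (a : Expr m) ρ → ⟦ a ⇓⟧ ρ ≡ ⟦ a ⟧ ρ
  normalise-correct (var i)  ρ = combination-unit i ρ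
  normalise-correct :0       ρ = combination-0 ρ
  normalise-correct (a :+ b) ρ = trans (combination-+ (normalise a) (normalise b) ρ)
    (cong₂ _+_ (normalise-correct a ρ) (normalise-correct b ρ))
  normalise-correct (:- a)   ρ = begin
    combination (map (ℤ._*_ -1ℤ) (normalise a)) ρ ≡⟨ combination-• -1ℤ (normalise a) ρ ⟩
    -1ℤ • ⟦ a ⇓⟧ ρ                                ≡⟨ cong -_ (1-• _) ⟩
    - ⟦ a ⇓⟧ ρ                                    ≡⟨ cong -_ (normalise-correct a ρ) ⟩
    - ⟦ a ⟧ ρ                                     ∎
  normalise-correct (i :• a) ρ =
    trans (combination-• i (normalise a) ρ) (cong (i •_) (normalise-correct a ρ))

  open Reflection (setoid A) var ⟦_⟧ ⟦_⇓⟧ normalise-correct public using (solve; _⊜_)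

  nat-• : ∀ k x → Sum.sum +-commutativeMonoid {k} (λ _ → x) ≡ (pos k) • x
  nat-• zero    x = refl
  nat-• (suc k) x = cong (x +_) (nat-• k x)

  -- Translation by x permutes the group, so the sum of all elements equals itself plus n • x.
  order-• : ∀ x → (pos n) • x ≡ 0#
  order-• x = begin
    (pos n) • x                  ≡⟨ solve 2 (λ a b → a ⊜ (a :+ b) :- b) refl ((pos n) • x) (sum id) ⟩
    ((pos n) • x + sum id) - sum id  ≡⟨ cong (λ w → (w + sum id) - sum id) (sym (nat-• n x)) ⟩
    (sum (λ _ → x) + sum id) - sum id ≡⟨ cong (_- sum id) (sym (∑-distrib-+ {n} (λ _ → x) id)) ⟩
    sum (x +_) - sum id        ≡⟨ cong (_- sum id) (sym (sum-permute {n} id translate)) ⟩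
    sum id - sum id            ≡⟨ invʳ _ ⟩
    0#                         ∎
    where
    open Sum +-commutativeMonoid using (sum-permute; ∑-distrib-+)
    sum = Sum.sum +-commutativeMonoid {n}
    translate : Perm.Permutation n n
    translate = Perm.permutation (x +_) (λ y → y - x)
      (λ y → solve 2 (λ x y → x :+ (y :- x) ⊜ y) refl x y)
      (λ y → solve 2 (λ x y → (x :+ y) :- x ⊜ y) refl x y)

-- Congruences modulo an odd prime.

module OddPrime (p : ℕ) (isPrime : Prime p) (odd : ¬ (2 ∣ p)) where

  p∣_ : ℤ → Set
  p∣ i = pos p ∣ℤ i

  infix 4 p∣_ _≈_

  -- A record rather than an abbreviation, so that i and j can be inferred from the type; the
  -- difference i - j alone does not determine them.
  record _≈_ (i j : ℤ) : Set where
    constructor congruent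
    field difference : p∣ (i ℤ.- j)

  open _≈_

  ≈-refl : ∀ {i} → i ≈ i
  ≈-refl {i} = congruent (divides 0ℤ (ℤ.+-inverseʳ i))

  ≈-reflexive : ∀ {i j} → i ≡ j → i ≈ j
  ≈-reflexive refl = ≈-refl

  ≈-sym : ∀ {i j} → i ≈ j → j ≈ i
  ≈-sym {i} {j} (congruent i≈j) = congruent (subst p∣_ (flip i j) (∣m⇒∣-m i≈j))
    where
    flip : ∀ i j → ℤ.- (i ℤ.- j) ≡ j ℤ.- i
    flip = solve-∀

  ≈-trans : ∀ {i j k} → i ≈ j → j ≈ k → i ≈ k
  ≈-trans {i} {j} {k} (congruent i≈j) (congruent j≈k) =
    congruent (subst p∣_ (telescope i j k) (∣m∣n⇒∣m+n i≈j j≈k))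
    where
    telescope : ∀ i j k → (i ℤ.- j) ℤ.+ (j ℤ.- k) ≡ i ℤ.- k
    telescope = solve-∀

  ≈-+ : ∀ {i j k l} → i ≈ j → k ≈ l → i ℤ.+ k ≈ j ℤ.+ l
  ≈-+ {i} {j} {k} {l} (congruent i≈j) (congruent k≈l) =
    congruent (subst p∣_ (regroup i j k l) (∣m∣n⇒∣m+n i≈j k≈l))
    where
    regroup : ∀ i j k l → (i ℤ.- j) ℤ.+ (k ℤ.- l) ≡ (i ℤ.+ k) ℤ.- (j ℤ.+ l)
    regroup = solve-∀

  ≈-* : ∀ {i j} k → i ≈ j → k ℤ.* i ≈ k ℤ.* j
  ≈-* {i} {j} k (congruent i≈j) = congruent (subst p∣_ (expand i j k) (∣n⇒∣m*n k i≈j))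
    where
    expand : ∀ i j k → k ℤ.* (i ℤ.- j) ≡ k ℤ.* i ℤ.- k ℤ.* j
    expand = solve-∀

  ≈-neg : ∀ {i j} → i ≈ j → ℤ.- i ≈ ℤ.- j
  ≈-neg {i} {j} (congruent i≈j) = congruent (subst p∣_ (expand i j) (∣m⇒∣-m i≈j))
    where
    expand : ∀ i j → ℤ.- (i ℤ.- j) ≡ ℤ.- i ℤ.- ℤ.- j
    expand = solve-∀

  p∣⇒≈0 : ∀ {i} → p∣ i → i ≈ 0ℤ
  p∣⇒≈0 {i} p∣i = congruent (subst p∣_ (sym (ℤ.+-identityʳ i)) p∣i)

  ≈0⇒p∣ : ∀ {i} → i ≈ 0ℤ → p∣ i
  ≈0⇒p∣ {i} (congruent i≈0) = subst p∣_ (ℤ.+-identityʳ i) i≈0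

  p∣0 : p∣ 0ℤ
  p∣0 = divides 0ℤ refl

  instance
    p-nonZero : ℕ.NonZero p
    p-nonZero = prime⇒nonZero isPrime

  2<p : 2 < p
  2<p = ℕ.≤∧≢⇒< (ℕ.nonTrivial⇒n>1 p {{prime⇒nonTrivial isPrime}})
    (λ 2≡p → odd (subst (2 ∣_) 2≡p (Nat.∣-refl)))

  -- The coset differences, determinants of pairs of lines and multiples of z₂ that have to be
  -- nonzero modulo p below are all ±1 or ±2.
  p∤-small : ∀ d {d≢0 : ℕ.NonZero ℤ.∣ d ∣} → ℤ.∣ d ∣ ≤ 2 → ¬ p∣ d
  p∤-small d {d≢0} d≤2 p∣d =
    ℕ.<⇒≱ 2<p (ℕ.≤-trans (Nat.∣⇒≤ {{d≢0}} (∣⇒∣ᵤ p∣d)) d≤2)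

  p∤1 : ¬ p∣ 1ℤ
  p∤1 = p∤-small 1ℤ (s≤s z≤n)

  p∤2 : ¬ p∣ pos 2
  p∤2 = p∤-small (pos 2) ℕ.≤-refl

  p∤-1 : ¬ p∣ -1ℤ
  p∤-1 = p∤-small -1ℤ (s≤s z≤n)

  p∤-2 : ¬ p∣ -[1+ 1 ]
  p∤-2 = p∤-small -[1+ 1 ] ℕ.≤-refl

  residue : ℤ → Fin p
  residue i = fromℕ< (ℤ.n%ℕd<d i p)

  residue-≈ : ∀ i → pos (toℕ (residue i)) ≈ i
  residue-≈ i = ≈-sym (congruent (divides (i ℤ./ℕ p) (begin
    i ℤ.- pos (toℕ (residue i))                 ≡⟨ cong (λ r → i ℤ.- pos r) (toℕ-fromℕ< _) ⟩
    i ℤ.- pos r                                 ≡⟨ cong (ℤ._- pos r) (ℤ.a≡a%ℕn+[a/ℕn]*n i p) ⟩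
    (pos r ℤ.+ q ℤ.* pos p) ℤ.- pos r           ≡⟨ cancel (pos r) (q ℤ.* pos p) ⟩
    q ℤ.* pos p                                 ∎)))
    where
    open ≡-Reasoning
    r = i ℤ.%ℕ p
    q = i ℤ./ℕ p
    cancel : ∀ a b → (a ℤ.+ b) ℤ.- a ≡ b
    cancel = solve-∀

  residue-unique : ∀ (r s : Fin p) → pos (toℕ r) ≈ pos (toℕ s) → r ≡ s
  residue-unique r s r≈s = toℕ-injective (ℤ.+-injective
    (ℤ.≤-antisym (below r s r≈s) (below s r (≈-sym r≈s))))
    where
    below : ∀ (r s : Fin p) → pos (toℕ r) ≈ pos (toℕ s) → pos (toℕ r) ℤ.≤ pos (toℕ s)
    below r s r≈s with ℕ.≤-total (toℕ r) (toℕ s)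
    ... | inj₁ r≤s = ℤ.+≤+ r≤s
    ... | inj₂ s≤r = ℤ.+≤+ (ℕ.m∸n≡0⇒m≤n (multiple-small (toℕ r ℕ.∸ toℕ s)
            (subst (p ∣_) (cong ℤ.∣_∣ (trans (ℤ.m-n≡m⊖n (toℕ r) (toℕ s)) (ℤ.⊖-≥ s≤r))) (∣⇒∣ᵤ (difference r≈s)))
            (ℕ.≤-<-trans (ℕ.m∸n≤m (toℕ r) (toℕ s)) (toℕ<n r))))
      where
      multiple-small : ∀ k → p ∣ k → k < p → k ≡ 0
      multiple-small zero    _   _   = refl
      multiple-small (suc k) p∣k k<p = contradiction (Nat.∣⇒≤ p∣k) (ℕ.<⇒≱ k<p)

  -- The inverse of j is given by an equation in ℤ, not by a congruence, because it also acts on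
  -- elements x for which p x is only known to lie in a subgroup.
  bezout : ∀ j → ¬ p∣ j → ∃[ a ] ∃[ b ] a ℤ.* j ≡ 1ℤ ℤ.+ b ℤ.* pos p
  bezout j p∤j with j ℤ.%ℕ p in eq | ℤ.a≡a%ℕn+[a/ℕn]*n j p | ℤ.n%ℕd<d j p
  ... | zero  | j≡ | _ = contradiction (divides (j ℤ./ℕ p) (trans j≡ (ℤ.+-identityˡ _))) p∤j
  ... | suc r | j≡ | r<p with coprime-Bézout (prime⇒coprime isPrime r<p)
  ...   | Bézout.-+ x y 1+xp≡yr = pos y , pos x ℤ.+ pos y ℤ.* q , (begin
    pos y ℤ.* j                                                  ≡⟨ cong (pos y ℤ.*_) j≡ ⟩
    pos y ℤ.* (pos (suc r) ℤ.+ q ℤ.* pos p)                      ≡⟨ expand (pos y) (pos (suc r)) q (pos p) ⟩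
    pos y ℤ.* pos (suc r) ℤ.+ pos y ℤ.* q ℤ.* pos p              ≡⟨ cong (λ w → w ℤ.+ pos y ℤ.* q ℤ.* pos p) (sym (ℤ.pos-* y (suc r))) ⟩
    pos (y ℕ.* suc r) ℤ.+ pos y ℤ.* q ℤ.* pos p                  ≡⟨ cong (λ w → pos w ℤ.+ pos y ℤ.* q ℤ.* pos p) (sym 1+xp≡yr) ⟩
    pos (1 ℕ.+ x ℕ.* p) ℤ.+ pos y ℤ.* q ℤ.* pos p                ≡⟨ cong (ℤ._+ pos y ℤ.* q ℤ.* pos p) (trans (ℤ.pos-+ 1 (x ℕ.* p)) (cong (λ w → 1ℤ ℤ.+ w) (ℤ.pos-* x p))) ⟩
    1ℤ ℤ.+ pos x ℤ.* pos p ℤ.+ pos y ℤ.* q ℤ.* pos p             ≡⟨ collect (pos x) (pos y ℤ.* q) (pos p) ⟩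
    1ℤ ℤ.+ (pos x ℤ.+ pos y ℤ.* q) ℤ.* pos p                     ∎)
    where
    open ≡-Reasoning
    q = j ℤ./ℕ p
    expand : ∀ y r q p → y ℤ.* (r ℤ.+ q ℤ.* p) ≡ y ℤ.* r ℤ.+ y ℤ.* q ℤ.* p
    expand = solve-∀
    collect : ∀ x w p → 1ℤ ℤ.+ x ℤ.* p ℤ.+ w ℤ.* p ≡ 1ℤ ℤ.+ (x ℤ.+ w) ℤ.* p
    collect = solve-∀
  ...   | Bézout.+- x y 1+yr≡xp = ℤ.- pos y , ℤ.- (pos x ℤ.+ pos y ℤ.* q) , (begin
    ℤ.- pos y ℤ.* j                                                   ≡⟨ cong (ℤ.- pos y ℤ.*_) j≡ ⟩
    ℤ.- pos y ℤ.* (pos (suc r) ℤ.+ q ℤ.* pos p)                       ≡⟨ expand (pos y) (pos (suc r)) q (pos p) ⟩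
    1ℤ ℤ.- (1ℤ ℤ.+ pos y ℤ.* pos (suc r)) ℤ.- pos y ℤ.* q ℤ.* pos p   ≡⟨ cong (λ w → 1ℤ ℤ.- w ℤ.- pos y ℤ.* q ℤ.* pos p) lifted ⟩
    1ℤ ℤ.- pos x ℤ.* pos p ℤ.- pos y ℤ.* q ℤ.* pos p                  ≡⟨ collect (pos x) (pos y ℤ.* q) (pos p) ⟩
    1ℤ ℤ.+ ℤ.- (pos x ℤ.+ pos y ℤ.* q) ℤ.* pos p                      ∎)
    where
    open ≡-Reasoning
    q = j ℤ./ℕ p
    lifted : 1ℤ ℤ.+ pos y ℤ.* pos (suc r) ≡ pos x ℤ.* pos p
    lifted = begin
      1ℤ ℤ.+ pos y ℤ.* pos (suc r)   ≡⟨ cong (λ w → 1ℤ ℤ.+ w) (sym (ℤ.pos-* y (suc r))) ⟩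
      1ℤ ℤ.+ pos (y ℕ.* suc r)       ≡⟨ sym (ℤ.pos-+ 1 (y ℕ.* suc r)) ⟩
      pos (1 ℕ.+ y ℕ.* suc r)        ≡⟨ cong pos 1+yr≡xp ⟩
      pos (x ℕ.* p)                  ≡⟨ ℤ.pos-* x p ⟩
      pos x ℤ.* pos p                ∎
    expand : ∀ y r q p → ℤ.- y ℤ.* (r ℤ.+ q ℤ.* p) ≡ 1ℤ ℤ.- (1ℤ ℤ.+ y ℤ.* r) ℤ.- y ℤ.* q ℤ.* p
    expand = solve-∀
    collect : ∀ x w p → 1ℤ ℤ.- x ℤ.* p ℤ.- w ℤ.* p ≡ 1ℤ ℤ.+ ℤ.- (x ℤ.+ w) ℤ.* p
    collect = solve-∀

  -- The witness is (p + 1) / 2. The exact value 1 + p exhibits the multiple of p by which the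
  -- composition law of σ fails over ℤ.
  halving : ∃[ h ] h ℤ.+ h ≡ 1ℤ ℤ.+ pos p
  halving = pos (suc k) , (begin
    pos (suc k) ℤ.+ pos (suc k)  ≡⟨ sym (ℤ.pos-+ (suc k) (suc k)) ⟩
    pos (suc k ℕ.+ suc k)        ≡⟨ cong pos (cong suc (trans (ℕ.+-suc k k) (cong suc k+k≡k*2))) ⟩
    pos (suc (suc (k ℕ.* 2)))    ≡⟨ cong (pos ∘ suc) (sym p≡1+2k) ⟩
    pos (1 ℕ.+ p)                ≡⟨ ℤ.pos-+ 1 p ⟩
    1ℤ ℤ.+ pos p                 ∎)
    where
    open ≡-Reasoning
    k = p ℕ./ 2
    k+k≡k*2 : k ℕ.+ k ≡ k ℕ.* 2
    k+k≡k*2 = trans (cong (k ℕ.+_) (sym (ℕ.+-identityʳ k))) (ℕ.*-comm 2 k)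
    p%2≡1 : p ℕ.% 2 ≡ 1
    p%2≡1 with p ℕ.% 2 in eq | Nat.m%n<n p 2
    ... | zero        | _ = contradiction (Nat.m%n≡0⇒n∣m p 2 eq) odd
    ... | suc zero    | _ = refl
    ... | suc (suc _) | s≤s (s≤s ())
    p≡1+2k : p ≡ suc (k ℕ.* 2)
    p≡1+2k = trans (Nat.m≡m%n+[m/n]*n p 2) (cong (ℕ._+ k ℕ.* 2) p%2≡1)

  half : ℤ
  half = proj₁ halving

  ≈-*₂ : ∀ {i j k l} → i ≈ j → k ≈ l → i ℤ.* k ≈ j ℤ.* l
  ≈-*₂ {i} {j} {k} {l} i≈j k≈l = ≈-trans (≈-* i k≈l)
    (subst₂ _≈_ (ℤ.*-comm l i) (ℤ.*-comm l j) (≈-* l i≈j))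

  p∣-cancel : ∀ {i d} → ¬ p∣ d → p∣ (i ℤ.* d) → p∣ i
  p∣-cancel {i} {d} p∤d p∣id = let (a , b , ad≡1+bp) = bezout d p∤d in subst p∣_
    (trans (cong (λ w → w ℤ.- (i ℤ.* b) ℤ.* pos p) (regroup i d a))
      (trans (cong (λ w → i ℤ.* w ℤ.- (i ℤ.* b) ℤ.* pos p) ad≡1+bp) (collapse i b (pos p))))
    (∣m∣n⇒∣m-n (∣n⇒∣m*n a p∣id) (divides (i ℤ.* b) refl))
    where
    regroup : ∀ i d a → a ℤ.* (i ℤ.* d) ≡ i ℤ.* (a ℤ.* d)
    regroup = solve-∀
    collapse : ∀ i b p → i ℤ.* (1ℤ ℤ.+ b ℤ.* p) ℤ.- (i ℤ.* b) ℤ.* p ≡ i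
    collapse = solve-∀

-- Decidable subgroups and generation.

module Subgroups (G : FinGroup) (comm : IsAbelian G) where
  open Abelian G comm public

  -- Membership carries a decision procedure because the connection set must finally become a
  -- Boolean vector, and because complements and searches for elements outside a subgroup have to be
  -- constructive.
  record Subgroup : Set₁ where
    field
      mem    : A → Set
      mem?   : ∀ x → Dec (mem x)
      0-mem  : mem 0#
      +-mem  : ∀ {x y} → mem x → mem y → mem (x + y)
      neg-mem : ∀ {x} → mem x → mem (- x)

    minus-mem : ∀ {x y} → mem x → mem y → mem (x - y)
    minus-mem hx hy = +-mem hx (neg-mem hy)

    pow-mem : ∀ {x} k → mem x → mem (pow G x k)
    pow-mem zero    hx = 0-mem
    pow-mem (suc k) hx = +-mem hx (pow-mem k hx)

    •-mem : ∀ {x} i → mem x → mem (i • x)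
    •-mem (pos k)  hx = pow-mem k hx
    •-mem -[1+ k ] hx = neg-mem (pow-mem (suc k) hx)

    cancelʳ : ∀ {x y} → mem y → mem (x + y) → mem x
    cancelʳ {x} {y} hy hxy =
      subst mem (solve 2 (λ x y → (x :+ y) :- y ⊜ x) refl x y) (minus-mem hxy hy)

  open Subgroup public using () renaming (mem to infix 4 _∋_)

  infix 4 _⊆_

  _⊆_ : (P Q : A → Set) → Set
  P ⊆ Q = ∀ {x} → P x → Q x

  instance
    n-nonZero : ℕ.NonZero n
    n-nonZero = nonZeroIndex 0#

  +-identityʳ : ∀ x → x + 0# ≡ x
  +-identityʳ = solve 1 (λ x → x :+ :0 ⊜ x) refl

  sub-0 : ∀ x → x - 0# ≡ x
  sub-0 = solve 1 (λ x → x :- :0 ⊜ x) refl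

  sub-self : ∀ x → x - x ≡ 0#
  sub-self = solve 1 (λ x → x :- x ⊜ :0) refl

  sub≡0 : ∀ {x y} → x - y ≡ 0# → x ≡ y
  sub≡0 {x} {y} eq = trans (solve 2 (λ x y → x ⊜ (x :- y) :+ y) refl x y)
    (trans (cong (_+ y) eq) (solve 1 (λ y → :0 :+ y ⊜ y) refl y))

  -- Since n annihilates G, coefficients can be reduced modulo n. This bounds the search that
  -- decides membership in `H ⊕⟨ g ⟩` and turns negative multiples into repeated sums.
  multiple-residue : ∀ i x → ∃[ r ] i • x ≡ pos (toℕ {n} r) • x
  multiple-residue i x = fromℕ< (ℤ.n%ℕd<d i n) , (begin
    i • x                                        ≡⟨ cong (_• x) (ℤ.a≡a%ℕn+[a/ℕn]*n i n) ⟩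
    (pos r ℤ.+ q ℤ.* pos n) • x                  ≡⟨ •-+ (pos r) (q ℤ.* pos n) x ⟩
    pos r • x + (q ℤ.* pos n) • x                ≡⟨ cong (pos r • x +_) (•-• q (pos n) x) ⟩
    pos r • x + q • (pos n • x)                  ≡⟨ cong (λ w → pos r • x + q • w) (order-• x) ⟩
    pos r • x + q • 0#                           ≡⟨ cong (pos r • x +_) (•-0# q) ⟩
    pos r • x + 0#                               ≡⟨ +-identityʳ _ ⟩
    pos r • x                                    ≡⟨ cong (λ k → pos k • x) (sym (toℕ-fromℕ< (ℤ.n%ℕd<d i n))) ⟩
    pos (toℕ (fromℕ< (ℤ.n%ℕd<d i n))) • x        ∎)
    where
    open ≡-Reasoning
    r = i ℤ.%ℕ n
    q = i ℤ./ℕ n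

  any-multiple? : ∀ {P : A → Set} → (∀ x → Dec (P x)) → ∀ x → Dec (∃[ i ] P (i • x))
  any-multiple? {P} P? x = map′
    (λ (r , h) → pos (toℕ r) , h)
    (λ (i , h) → let (r , eq) = multiple-residue i x in r , subst P eq h)
    (any? {n} (λ r → P? (pos (toℕ r) • x)))

  trivial : Subgroup
  trivial = record
    { mem = _≡ 0# ; mem? = _≟ 0# ; 0-mem = refl
    ; +-mem = λ { refl refl → +-identityʳ 0# }
    ; neg-mem = λ { refl → neg-0 } }

  infixl 6 _⊕⟨_⟩

  _⊕⟨_⟩ : Subgroup → A → Subgroup
  H ⊕⟨ g ⟩ = record
    { mem = λ x → ∃[ i ] H ∋ x - i • g
    ; mem? = λ x → any-multiple? (λ w → H.mem? (x - w)) g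
    ; 0-mem = 0ℤ , subst H.mem (sym (sub-self 0#)) H.0-mem
    ; +-mem = λ {x} {y} → λ (i , hx) (j , hy) → i ℤ.+ j ,
        subst H.mem (trans (solve 4 (λ x y a b → (x :- a) :+ (y :- b) ⊜ (x :+ y) :- (a :+ b)) refl x y (i • g) (j • g))
          (cong (λ w → (x + y) - w) (sym (•-+ i j g)))) (H.+-mem hx hy)
    ; neg-mem = λ {x} → λ (i , hx) → ℤ.- i ,
        subst H.mem (trans (solve 2 (λ x a → :- (x :- a) ⊜ (:- x) :- (:- a)) refl x (i • g))
          (cong (λ w → - x - w) (sym (•-neg i g)))) (H.neg-mem hx) }
    where module H = Subgroup H

  ⊕-base : ∀ (H : Subgroup) {g} → (H ∋_) ⊆ (H ⊕⟨ g ⟩ ∋_)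
  ⊕-base H hx = 0ℤ , subst (H ∋_) (sym (sub-0 _)) hx

  ⊕-gen : ∀ (H : Subgroup) {g} → H ⊕⟨ g ⟩ ∋ g
  ⊕-gen H {g} = 1ℤ , subst (H ∋_) (sym (trans (cong (λ w → g - w) (1-• g)) (sub-self g))) (Subgroup.0-mem H)

  ⊕-least : ∀ (H L : Subgroup) {g} → (H ∋_) ⊆ (L ∋_) → L ∋ g → (H ⊕⟨ g ⟩ ∋_) ⊆ (L ∋_)
  ⊕-least H L {g} H⊆L hg {x} (i , h) = subst (L ∋_)
    (solve 2 (λ x a → (x :- a) :+ a ⊜ x) refl x (i • g))
    (Subgroup.+-mem L (H⊆L h) (Subgroup.•-mem L i hg))

  ⟨_⟩ : A → Subgroup
  ⟨ g ⟩ = trivial ⊕⟨ g ⟩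

  multiples : ∀ i g → ⟨ g ⟩ ∋ i • g
  multiples i g = Subgroup.•-mem ⟨ g ⟩ i (⊕-gen trivial)

  as-multiple : ∀ {g x} → ⟨ g ⟩ ∋ x → ∃[ i ] x ≡ i • g
  as-multiple (i , eq) = i , sub≡0 eq

  image : ℤ → Subgroup
  image k = record
    { mem = λ x → ∃[ w ] x ≡ k • w
    ; mem? = λ x → any? (λ w → x ≟ k • w)
    ; 0-mem = 0# , sym (•-0# k)
    ; +-mem = λ { (v , refl) (w , refl) → v + w , sym (•-distrib k v w) }
    ; neg-mem = λ { (v , refl) → - v , neg-• v } }
    where
    neg-• : ∀ v → - (k • v) ≡ k • (- v)
    neg-• v = sym (neg-unique (k • v) (k • (- v))
      (trans (sym (•-distrib k v (- v))) (trans (cong (k •_) (sub-self v)) (•-0# k))))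

  -- Only sums are allowed: in a finite group they already include the negatives, and a sum of
  -- elements of P is a directed walk, which an automorphism can be followed along.
  data Gen (P : A → Set) : A → Set where
    gen-0 : Gen P 0#
    gen-+ : ∀ {x y} → P x → Gen P y → Gen P (x + y)

  gen : ∀ {P} → P ⊆ Gen P
  gen {P} {x} hx = subst (Gen P) (+-identityʳ x) (gen-+ hx gen-0)

  gen-++ : ∀ {P x y} → Gen P x → Gen P y → Gen P (x + y)
  gen-++ {P} {y = y} gen-0 hy = subst (Gen P) (solve 1 (λ y → y ⊜ :0 :+ y) refl y) hy
  gen-++ {P} {y = y} (gen-+ {a} {b} ha hb) hy =
    subst (Gen P) (solve 3 (λ a b y → a :+ (b :+ y) ⊜ (a :+ b) :+ y) refl a b y) (gen-+ ha (gen-++ hb hy))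

  gen-• : ∀ {P x} i → Gen P x → Gen P (i • x)
  gen-• {P} {x} i hx = let (r , eq) = multiple-residue i x in subst (Gen P) (sym eq) (powers (toℕ r))
    where
    powers : ∀ k → Gen P (pow G x k)
    powers zero    = gen-0
    powers (suc k) = gen-++ hx (powers k)

  gen-mono : ∀ {P Q} → P ⊆ Q → Gen P ⊆ Gen Q
  gen-mono P⊆Q gen-0         = gen-0
  gen-mono P⊆Q (gen-+ hx hy) = gen-+ (P⊆Q hx) (gen-mono P⊆Q hy)

  gen-least : ∀ {P} (H : Subgroup) → P ⊆ (H ∋_) → Gen P ⊆ (H ∋_)
  gen-least H P⊆H gen-0         = Subgroup.0-mem H
  gen-least H P⊆H (gen-+ hx hy) = Subgroup.+-mem H (P⊆H hx) (gen-least H P⊆H hy)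

  gen-⊕ : ∀ {P} (H : Subgroup) {g} → (H ∋_) ⊆ Gen P → Gen P g → (H ⊕⟨ g ⟩ ∋_) ⊆ Gen P
  gen-⊕ {P} H {g} H⊆P hg {x} (i , h) = subst (Gen P)
    (solve 2 (λ x a → (x :- a) :+ a ⊜ x) refl x (i • g)) (gen-++ (H⊆P h) (gen-• i hg))

  -- An element x of H' ∩ Q is the sum of g + x and - g, neither of which lies in Q.
  gen-complement : ∀ (H H' : Subgroup) {g} → (H ∋_) ⊆ (H' ∋_) → H' ∋ g → ¬ H ∋ g →
    ∀ {Q} → (∀ x → Dec (Q x)) → Q ⊆ (H ∋_) → (H' ∋_) ⊆ Gen (λ x → H' ∋ x × ¬ Q x)
  gen-complement H H' {g} H⊆H' g∈H' g∉H Q? Q⊆H {x} x∈H' with Q? x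
  ... | no x∉Q = gen (x∈H' , x∉Q)
  ... | yes x∈Q = subst (Gen _) (solve 2 (λ x g → (x :+ g) :+ (:- g) ⊜ x) refl x g)
    (gen-++
      (gen (Subgroup.+-mem H' x∈H' g∈H' , λ h → g∉H
        (subst (H ∋_) (solve 2 (λ x g → (x :+ g) :- x ⊜ g) refl x g) (Subgroup.minus-mem H (Q⊆H h) (Q⊆H x∈Q)))))
      (gen (Subgroup.neg-mem H' g∈H' , λ h → g∉H
        (subst (H ∋_) (neg-involutive g) (Subgroup.neg-mem H (Q⊆H h))))))

-- Invariant connection sets and recoverable chains of subgroups.

module Invariants (G : FinGroup) (comm : IsAbelian G) where
  open Subgroups G comm public

  record Automorphism (S : A → Set) : Set where
    field
      to       : A → A
      from     : A → A
      to-from  : ∀ x → to (from x) ≡ x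
      from-to  : ∀ x → from (to x) ≡ x
      to-arc   : ∀ x y → S (y - x) → S (to y - to x)
      from-arc : ∀ x y → S (y - x) → S (from y - from x)

  inverse : ∀ {S} → Automorphism S → Automorphism S
  inverse α = record
    { to = from ; from = to ; to-from = from-to ; from-to = to-from
    ; to-arc = from-arc ; from-arc = to-arc }
    where open Automorphism α

  coset : (A → Set) → A → A → Set
  coset C a d = C (d - a)

  module Invariance (S : A → Set) where
    open Automorphism

    -- The invariant connection sets form a Schur ring: they are closed under Boolean
    -- operations, negation, sumsets and generation.
    record Inv (P : A → Set) : Set where
      constructor invariant
      field preserve : ∀ (α : Automorphism S) x y → P (y - x) → P (to α y - to α x)

    open Inv public

    inv-S : Inv S
    inv-S = invariant to-arc

    inv-resp : ∀ {P Q} → P ⊆ Q → Q ⊆ P → Inv P → Inv Q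
    inv-resp P⊆Q Q⊆P invP = invariant λ α x y h → P⊆Q (preserve invP α x y (Q⊆P h))

    inv-∩ : ∀ {P Q} → Inv P → Inv Q → Inv (λ d → P d × Q d)
    inv-∩ invP invQ = invariant λ α x y (hp , hq) → preserve invP α x y hp , preserve invQ α x y hq

    -- If the image of a non-arc were an arc of P, the inverse automorphism would carry it back to
    -- one.
    inv-¬ : ∀ {P} → Inv P → Inv (λ d → ¬ P d)
    inv-¬ {P} invP = invariant λ α x y ¬h h →
      ¬h (subst₂ (λ u v → P (v - u)) (from-to α x) (from-to α y)
        (preserve invP (inverse α) (to α x) (to α y) h))

    inv-neg : ∀ {P} → Inv P → Inv (λ d → P (- d))
    inv-neg {P} invP = invariant λ α x y h → subst P (flip (to α y) (to α x)) (preserve invP α y x (subst P (sym (flip y x)) h))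
      where
      flip : ∀ y x → x - y ≡ - (y - x)
      flip = solve 2 (λ y x → x :- y ⊜ :- (y :- x)) refl

    infixl 6 _⊹_

    _⊹_ : (P Q : A → Set) → A → Set
    (P ⊹ Q) d = ∃[ a ] P a × Q (d - a)

    -- Writing y - x as a sum amounts to choosing a midpoint x + a, and α sends midpoints to
    -- midpoints.
    inv-⊹ : ∀ {P Q} → Inv P → Inv Q → Inv (P ⊹ Q)
    inv-⊹ {P} {Q} invP invQ = invariant λ α x y (a , ha , hd) →
      to α (x + a) - to α x
      , preserve invP α x (x + a) (subst P (solve 2 (λ x a → a ⊜ (x :+ a) :- x) refl x a) ha)
      , subst Q (solve 3 (λ u v w → u :- v ⊜ (u :- w) :- (v :- w)) refl (to α y) (to α (x + a)) (to α x))
          (preserve invQ α (x + a) y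
            (subst Q (solve 3 (λ x y a → (y :- x) :- a ⊜ y :- (x :+ a)) refl x y a) hd))

    inv-0 : Inv (_≡ 0#)
    inv-0 = invariant λ α x y h → trans (cong (λ w → to α w - to α x) (sub≡0 h)) (sub-self (to α x))

    inv-gen : ∀ {P} → Inv P → Inv (Gen P)
    inv-gen {P} invP = invariant λ α x y h → subst (λ w → Gen P (to α w - to α x))
      (solve 2 (λ x y → x :+ (y :- x) ⊜ y) refl x y) (walk α h x)
      where
      walk : ∀ α {d} → Gen P d → ∀ x → Gen P (to α (x + d) - to α x)
      walk α gen-0 x = subst (Gen P)
        (sym (trans (cong (λ w → to α w - to α x) (+-identityʳ x)) (sub-self _))) gen-0
      walk α (gen-+ {a} {b} ha hb) x = subst (Gen P)
        (trans (solve 3 (λ u v w → (v :- w) :+ (u :- v) ⊜ u :- w) refl (to α ((x + a) + b)) (to α (x + a)) (to α x))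
          (cong (λ w → to α w - to α x) (solve 3 (λ x a b → (x :+ a) :+ b ⊜ x :+ (a :+ b)) refl x a b)))
        (gen-+ (preserve invP α x (x + a) (subst P (solve 2 (λ x a → a ⊜ (x :+ a) :- x) refl x a) ha)) (walk α hb (x + a)))

    -- The connection set never contains 0, whereas `T₁` gains and loses it alternately along the
    -- chain; this bridges the two.
    inv-insert-0 : ∀ {P} → Inv (λ d → P d × d ≢ 0#) → Inv P
    inv-insert-0 {P} invP = invariant move
      where
      move : ∀ α x y → P (y - x) → P (to α y - to α x)
      move α x y h with y - x ≟ 0#
      ... | yes y-x≡0 = subst P (trans y-x≡0 (sym (preserve inv-0 α x y y-x≡0))) h
      ... | no y-x≢0  = proj₁ (preserve invP α x y (h , y-x≢0))

    inv-subgroup : ∀ {P} (H : Subgroup) → P ⊆ (H ∋_) → (H ∋_) ⊆ Gen P → Inv P → Inv (H ∋_)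
    inv-subgroup H P⊆H H⊆P invP = inv-resp (gen-least H P⊆H) H⊆P (inv-gen invP)

    -- Q is recovered from H' \ Q because the latter generates H'.
    inv-complement : ∀ (H' : Subgroup) {Q} → (∀ x → Dec (Q x)) → Q ⊆ (H' ∋_) →
      (H' ∋_) ⊆ Gen (λ x → H' ∋ x × ¬ Q x) →
      Inv (λ x → H' ∋ x × ¬ Q x) → Inv (H' ∋_) × Inv Q
    inv-complement H' {Q} Q? Q⊆H' generates inv' = invH' ,
      inv-resp (λ {d} (h , ¬h¬q) → decidable-stable (Q? d) (λ ¬q → ¬h¬q (h , ¬q)))
        (λ q → Q⊆H' q , λ (_ , ¬q) → ¬q q)
        (inv-∩ invH' (inv-¬ inv'))
      where
      invH' : Inv (H' ∋_)
      invH' = inv-subgroup H' proj₁ generates inv'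

    inv-coset-neg : ∀ (C : Subgroup) {a} → Inv (coset (C ∋_) a) → Inv (coset (C ∋_) (- a))
    inv-coset-neg C {a} inv = inv-resp
      (λ {d} h → subst (C ∋_) (negate d a) (Subgroup.neg-mem C h))
      (λ {d} h → subst (C ∋_) (solve 2 (λ d a → :- (d :- (:- a)) ⊜ (:- d) :- a) refl d a) (Subgroup.neg-mem C h))
      (inv-neg inv)
      where
      negate : ∀ d a → - (- d - a) ≡ d - - a
      negate = solve 2 (λ d a → :- ((:- d) :- a) ⊜ d :- (:- a)) refl

    inv-coset-self : ∀ (C : Subgroup) {a} → C ∋ a → Inv (C ∋_) → Inv (coset (C ∋_) a)
    inv-coset-self C {a} ha = inv-resp
      (λ h → Subgroup.minus-mem C h ha)
      (λ {d} h → subst (C ∋_) (solve 2 (λ d a → (d :- a) :+ a ⊜ d) refl d a) (Subgroup.+-mem C h ha))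

    -- The basic tool of the rigidity arguments: seen from the fixed point x₁, the image of y stays
    -- in y + C; seen from x₂, it stays in y + D.
    pin : ∀ (α : Automorphism S) (C D : Subgroup) {a b x₁ x₂ y} →
      Inv (coset (C ∋_) a) → Inv (coset (D ∋_) b) → (∀ {ε} → C ∋ ε → D ∋ ε → ε ≡ 0#) →
      to α x₁ ≡ x₁ → to α x₂ ≡ x₂ → x₁ + a ≡ y → x₂ + b ≡ y → to α y ≡ y
    pin α C D {y = y} invC invD C∩D≡0 fix₁ fix₂ x₁+a≡y x₂+b≡y =
      sub≡0 (C∩D≡0 (confine C x₁+a≡y fix₁ invC) (confine D x₂+b≡y fix₂ invD))
      where
      confine : ∀ (C : Subgroup) {a x} → x + a ≡ y → to α x ≡ x → Inv (coset (C ∋_) a) → C ∋ to α y - y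
      confine C {a} {x} refl fix inv = subst (C ∋_)
        (trans (cong (λ w → (to α (x + a) - w) - a) fix)
          (solve 3 (λ u x a → (u :- x) :- a ⊜ u :- (x :+ a)) refl (to α (x + a)) x a))
        (preserve inv α x (x + a)
          (subst (C ∋_) (solve 2 (λ x a → :0 ⊜ ((x :+ a) :- x) :- a) refl x a) (Subgroup.0-mem C)))

    Closed : (A → Set) → A → Set
    Closed P g = ∀ {x} → P x → P (x + g)

    closed-gen : ∀ {P Q} → Q ⊆ Closed P → Gen Q ⊆ Closed P
    closed-gen {P} Q⊆ gen-0 {x} h = subst P (sym (+-identityʳ x)) h
    closed-gen {P} Q⊆ (gen-+ {a} {b} ha hb) {x} h = subst P
      (solve 3 (λ x a b → (x :+ a) :+ b ⊜ x :+ (a :+ b)) refl x a b)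
      (closed-gen Q⊆ hb (Q⊆ ha h))

    closed-+ : ∀ {P a b} → Closed P a → Closed P b → Closed P (a + b)
    closed-+ {P} {a} {b} ha hb {x} h = subst P
      (solve 3 (λ x a b → (x :+ a) :+ b ⊜ x :+ (a :+ b)) refl x a b) (hb (ha h))

    -- Negative i are covered because a has finite order, so - a is itself a repeated sum of a.
    closed-• : ∀ {P a} i → Closed P a → Closed P (i • a)
    closed-• {P} {a} i ha = closed-gen {P} {_≡ a} (λ { refl → ha }) (gen-• i (gen refl))

  -- A chain of subgroups from B to H, each obtained by adjoining one element g of T₂ to its
  -- predecessor.  Complementing T₁ at each step makes the whole chain recoverable from T₁.
  record Chain (K B : Subgroup) (T : A → Set) : Set₁ where
    open Invariance
    field
      H       : Subgroup
      B⊆H     : (B ∋_) ⊆ (H ∋_)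
      H⊆K     : (H ∋_) ⊆ (K ∋_)
      T₁      : A → Set
      T₁?     : ∀ x → Dec (T₁ x)
      T₁⊆H    : T₁ ⊆ (H ∋_)
      T₁-neg  : ∀ {x} → T₁ x → T₁ (- x)
      T₁-gen  : (H ∋_) ⊆ Gen T₁
      T₂      : A → Set
      T₂?     : ∀ x → Dec (T₂ x)
      T₂⊆H    : T₂ ⊆ (H ∋_)
      T₂∩B    : ∀ {t} → T₂ t → ¬ B ∋ t
      T₂-sep  : ∀ {s t} → T₂ s → T₂ t → B ∋ s - t → s ≡ t
      T₂-gen  : (H ∋_) ⊆ Gen (λ x → B ∋ x ⊎ T₂ x)
      rigid₁  : ∀ S → Inv S T₁ → Inv S T
      -- The connection set shows `T₂` only up to a subgroup W: all of B when K contains z₁, and 0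
      -- in the other case.
      rigid₂  : ∀ S (W : Subgroup) → (W ∋_) ⊆ (B ∋_) → Inv S T₁ → Inv S (λ d → ∃[ t ] T₂ t × W ∋ d - t) →
                ∀ {t} → T₂ t → Inv S (coset (W ∋_) t)

  base-chain : ∀ (K B : Subgroup) {T} → (B ∋_) ⊆ (K ∋_) → (∀ x → Dec (T x)) → T ⊆ (B ∋_) →
    (∀ {x} → T x → T (- x)) → (B ∋_) ⊆ Gen T → Chain K B T
  base-chain K B {T} B⊆K T? T⊆B T-neg T-gen = record
    { H = B ; B⊆H = id ; H⊆K = B⊆K ; T₁ = T ; T₁? = T? ; T₁⊆H = T⊆B ; T₁-neg = T-neg ; T₁-gen = T-gen
    ; T₂ = λ _ → ⊥ ; T₂? = λ _ → no id ; T₂⊆H = ⊥-elim ; T₂∩B = ⊥-elim ; T₂-sep = ⊥-elim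
    ; T₂-gen = gen ∘ inj₁ ; rigid₁ = λ _ → id ; rigid₂ = λ _ _ _ _ _ → ⊥-elim }

  extend : ∀ {K B T} (C : Chain K B T) {g} → K ∋ g → ¬ Chain.H C ∋ g → Chain K B T
  extend {K} {B} {T} C {g} g∈K g∉H = record
    { H = H' ; B⊆H = H⊆H' ∘ B⊆H ; H⊆K = ⊕-least H K H⊆K g∈K
    ; T₁ = λ x → H' ∋ x × ¬ T₁ x
    ; T₁? = λ x → Subgroup.mem? H' x ×-dec ¬? (T₁? x)
    ; T₁⊆H = proj₁
    ; T₁-neg = λ {x} (h , ¬t) → Subgroup.neg-mem H' h , λ t → ¬t (subst T₁ (neg-involutive x) (T₁-neg t))
    ; T₁-gen = generates
    ; T₂ = λ x → T₂ x ⊎ x ≡ g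
    ; T₂? = λ x → T₂? x ⊎-dec (x ≟ g)
    ; T₂⊆H = λ { (inj₁ t) → H⊆H' (T₂⊆H t) ; (inj₂ refl) → g∈H' }
    ; T₂∩B = λ { (inj₁ t) → T₂∩B t ; (inj₂ refl) → g∉H ∘ B⊆H }
    ; T₂-sep = λ
        { (inj₁ s) (inj₁ t) h → T₂-sep s t h
        ; {s} (inj₁ s∈) (inj₂ refl) h → contradiction
            (subst (H ∋_) (solve 2 (λ s g → s :- (s :- g) ⊜ g) refl s g) (Subgroup.minus-mem H (T₂⊆H s∈) (B⊆H h))) g∉H
        ; {_} {t} (inj₂ refl) (inj₁ t∈) h → contradiction
            (subst (H ∋_) (solve 2 (λ t g → (g :- t) :+ t ⊜ g) refl t g) (Subgroup.+-mem H (B⊆H h) (T₂⊆H t∈))) g∉H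
        ; (inj₂ refl) (inj₂ refl) h → refl }
    ; T₂-gen = gen-⊕ H (gen-mono (λ { (inj₁ b) → inj₁ b ; (inj₂ t) → inj₂ (inj₁ t) }) ∘ T₂-gen) (gen (inj₂ (inj₂ refl)))
    ; rigid₁ = λ S inv → rigid₁ S (proj₂ (recover S inv))
    ; rigid₂ = rigid₂' }
    where
    open Chain C
    open Invariance
    H' = H ⊕⟨ g ⟩
    H⊆H' : (H ∋_) ⊆ (H' ∋_)
    H⊆H' = ⊕-base H
    g∈H' : H' ∋ g
    g∈H' = ⊕-gen H
    generates : (H' ∋_) ⊆ Gen (λ x → H' ∋ x × ¬ T₁ x)
    generates = gen-complement H H' H⊆H' g∈H' g∉H T₁? T₁⊆H
    recover : ∀ S → Inv S (λ x → H' ∋ x × ¬ T₁ x) → Inv S (H' ∋_) × Inv S T₁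
    recover S = inv-complement S H' T₁? (H⊆H' ∘ T₁⊆H) generates
    -- Intersecting with H removes exactly g + W, since `T₂` and W lie in H while g does not. What
    -- is left is handled by the shorter chain, and what is removed is the coset of the new
    -- generator.
    rigid₂' : ∀ S (W : Subgroup) → (W ∋_) ⊆ (B ∋_) → Inv S (λ x → H' ∋ x × ¬ T₁ x) →
      Inv S (λ d → ∃[ t ] (T₂ t ⊎ t ≡ g) × W ∋ d - t) →
      ∀ {t} → T₂ t ⊎ t ≡ g → Inv S (coset (W ∋_) t)
    rigid₂' S W W⊆B inv₁ inv₂ = λ
      { (inj₁ t) → rigid₂ S W W⊆B invT₁
          (inv-resp S
            (λ { ((t , inj₁ t∈ , w) , h) → t , t∈ , w
               ; {d} ((t , inj₂ refl , w) , h) → contradiction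
                   (subst (H ∋_) (solve 2 (λ d g → d :- (d :- g) ⊜ g) refl d g) (Subgroup.minus-mem H h (B⊆H (W⊆B w)))) g∉H })
            (λ {d} (t , t∈ , w) → (t , inj₁ t∈ , w) ,
               subst (H ∋_) (solve 2 (λ d t → (d :- t) :+ t ⊜ d) refl d t) (Subgroup.+-mem H (B⊆H (W⊆B w)) (T₂⊆H t∈)))
            (inv-∩ S inv₂ invH)) t
      ; (inj₂ refl) → inv-resp S
          (λ { {d} ((t , inj₁ t∈ , w) , ¬h) → contradiction
                 (subst (H ∋_) (solve 2 (λ d t → (d :- t) :+ t ⊜ d) refl d t) (Subgroup.+-mem H (B⊆H (W⊆B w)) (T₂⊆H t∈))) ¬h
             ; ((t , inj₂ refl , w) , ¬h) → w })
          (λ {d} w → (g , inj₂ refl , w) , λ h → g∉H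
             (subst (H ∋_) (solve 2 (λ d g → d :- (d :- g) ⊜ g) refl d g) (Subgroup.minus-mem H h (B⊆H (W⊆B w)))))
          (inv-∩ S inv₂ (inv-¬ S invH)) }
      where
      invT₁ : Inv S T₁
      invT₁ = proj₂ (recover S inv₁)
      invH : Inv S (H ∋_)
      invH = inv-subgroup S H T₁⊆H T₁-gen invT₁

  full-chain : ∀ {K B T} → Chain K B T → Σ[ C ∈ Chain K B T ] (K ∋_) ⊆ (Chain.H C ∋_)
  full-chain {K} {B} {T} C₀ = let (C , covers) = absorb (allFin n) in C , λ {x} → All.lookup covers (∈-allFin x)
    where
    absorb : (xs : List A) → Σ[ C ∈ Chain K B T ] All (λ x → K ∋ x → Chain.H C ∋ x) xs
    absorb [] = C₀ , []
    absorb (x ∷ xs) with absorb xs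
    ... | C , covers with Subgroup.mem? K x | Subgroup.mem? (Chain.H C) x
    ...   | no x∉K  | _       = C , (λ x∈K → contradiction x∈K x∉K) ∷ covers
    ...   | yes _   | yes x∈H = C , (λ _ → x∈H) ∷ covers
    ...   | yes x∈K | no x∉H  = extend C x∈K x∉H ,
      (λ _ → ⊕-gen (Chain.H C)) ∷ All.map (λ h k → ⊕-base (Chain.H C) (h k)) covers

-- Coordinates modulo K and the automorphism σ.

module Frames (G : FinGroup) (comm : IsAbelian G)
              (p : ℕ) (isPrime : Prime p) (odd : ¬ (2 ∣ p)) where
  open Invariants G comm public
  open OddPrime p isPrime odd public

  p• : A → A
  p• x = pos p • x

  •-torsion : ∀ {z i} → p• z ≡ 0# → p∣ i → i • z ≡ 0#
  •-torsion {z} pz≡0 (divides q refl) = trans (•-• q (pos p) z) (trans (cong (q •_) pz≡0) (•-0# q))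

  •-sub : ∀ i j x → (i ℤ.- j) • x ≡ i • x - j • x
  •-sub i j x = trans (•-+ i (ℤ.- j) x) (cong (i • x +_) (•-neg j x))

  •-cong : ∀ {z i j} → p• z ≡ 0# → i ≈ j → i • z ≡ j • z
  •-cong {z} {i} {j} pz≡0 (congruent i≈j) = sub≡0 (trans (sym (•-sub i j z)) (•-torsion pz≡0 i≈j))

  -- With a j = 1 + b p, the element x is a (j x) - b (p x).
  invert : ∀ (H : Subgroup) {x j} → H ∋ p• x → ¬ p∣ j → H ∋ j • x → H ∋ x
  invert H {x} {j} px∈H p∤j jx∈H = let (a , b , aj≡1+bp) = bezout j p∤j in
    Subgroup.cancelʳ H (Subgroup.•-mem H b px∈H) (subst (H ∋_) (begin
      a • (j • x)                   ≡⟨ sym (•-• a j x) ⟩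
      (a ℤ.* j) • x                 ≡⟨ cong (_• x) aj≡1+bp ⟩
      (1ℤ ℤ.+ b ℤ.* pos p) • x      ≡⟨ •-+ 1ℤ (b ℤ.* pos p) x ⟩
      1ℤ • x + (b ℤ.* pos p) • x    ≡⟨ cong₂ _+_ (1-• x) (•-• b (pos p) x) ⟩
      x + b • p• x                  ∎) (Subgroup.•-mem H a jx∈H))
    where open ≡-Reasoning

  order-mod : ∀ (H : Subgroup) {x j} → H ∋ p• x → ¬ H ∋ x → H ∋ j • x → p∣ j
  order-mod H {x} {j} px∈H x∉H jx∈H with pos p ∣ℤ? j
  ... | yes p∣j = p∣j
  ... | no p∤j  = contradiction (invert H px∈H p∤j jx∈H) x∉H

  -- G / K is elementary abelian of order p² with basis e₁, e₂, and z₁ ≡ c e₂ modulo K.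
  -- The theorem uses c = 0 (both z₁ and z₂ lie in K) and c = 1 (with z₁ = e₂).
  record Frame : Set₁ where
    field
      K            : Subgroup
      e₁ e₂ z₁ z₂  : A
      c            : ℤ
      p•∈K         : ∀ x → K ∋ p• x
      pz₁≡0        : p• z₁ ≡ 0#
      pz₂≡0        : p• z₂ ≡ 0#
      z₂∈K         : K ∋ z₂
      z₂≢0         : z₂ ≢ 0#
      z₁∉⟨z₂⟩      : ¬ ⟨ z₂ ⟩ ∋ z₁
      z₁-mod-K     : K ∋ z₁ - c • e₂
      coordinates  : ∀ x → ∃[ u ] ∃[ v ] K ∋ x - (u • e₁ + v • e₂)
      independent  : ∀ u v → K ∋ u • e₁ + v • e₂ → p∣ u × p∣ v

  module FrameProperties (F : Frame) where
    open Frame F public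
    open ≡-Reasoning

    f₁ f₂ : A → ℤ
    f₁ x = proj₁ (coordinates x)
    f₂ x = proj₁ (proj₂ (coordinates x))

    combo : ℤ → ℤ → A
    combo u v = u • e₁ + v • e₂

    combo-sub : ∀ u v s t → combo u v - combo s t ≡ combo (u ℤ.- s) (v ℤ.- t)
    combo-sub u v s t = trans
      (solve 4 (λ a b c d → (a :+ b) :- (c :+ d) ⊜ (a :- c) :+ (b :- d)) refl (u • e₁) (v • e₂) (s • e₁) (t • e₂))
      (sym (cong₂ _+_ (•-sub u s e₁) (•-sub v t e₂)))

    combo-+ : ∀ u v s t → combo u v + combo s t ≡ combo (u ℤ.+ s) (v ℤ.+ t)
    combo-+ u v s t = trans (interchange (u • e₁) (v • e₂) (s • e₁) (t • e₂))
      (sym (cong₂ _+_ (•-+ u s e₁) (•-+ v t e₂)))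

    -- The coset of K through u e₁ + v e₂. In terms of congruences, two cosets are disjoint as soon
    -- as a coordinate difference is nonzero modulo p.
    Layer : ℤ → ℤ → A → Set
    Layer u v x = f₁ x ≈ u × f₂ x ≈ v

    layer : ∀ {u v x} → K ∋ x - combo u v → Layer u v x
    layer {u} {v} {x} h =
      let (p∣u , p∣v) = independent _ _ (subst (K ∋_)
            (trans (solve 3 (λ x a b → (x :- b) :- (x :- a) ⊜ a :- b) refl x (combo (f₁ x) (f₂ x)) (combo u v))
              (combo-sub (f₁ x) (f₂ x) u v))
            (Subgroup.minus-mem K h (proj₂ (proj₂ (coordinates x)))))
      in congruent p∣u , congruent p∣v

    same-layer : ∀ {u v x y} → Layer u v x → Layer u v y → K ∋ x - y
    same-layer {u} {v} {x} {y} (xu , xv) (yu , yv) = subst (K ∋_)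
      (solve 4 (λ x y a b → ((x :- a) :- (y :- b)) :+ (a :- b) ⊜ x :- y) refl x y (combo (f₁ x) (f₂ x)) (combo (f₁ y) (f₂ y)))
      (Subgroup.+-mem K
        (Subgroup.minus-mem K (proj₂ (proj₂ (coordinates x))) (proj₂ (proj₂ (coordinates y))))
        (subst (K ∋_) (sym (combo-sub (f₁ x) (f₂ x) (f₁ y) (f₂ y)))
          (Subgroup.+-mem K (small (≈-trans xu (≈-sym yu))) (small (≈-trans xv (≈-sym yv))))))
      where
      small : ∀ {i j w} → i ≈ j → K ∋ (i ℤ.- j) • w
      small {w = w} (congruent (divides q eq)) = subst (K ∋_)
        (trans (sym (•-• q (pos p) w)) (cong (_• w) (sym eq))) (Subgroup.•-mem K q (p•∈K w))

    clash₁ : ∀ {u v s t x} → ¬ p∣ (u ℤ.- s) → Layer u v x → ¬ Layer s t x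
    clash₁ u≉s (xu , _) (xs , _) = u≉s (_≈_.difference (≈-trans (≈-sym xu) xs))

    clash₂ : ∀ {u v s t x} → ¬ p∣ (v ℤ.- t) → Layer u v x → ¬ Layer s t x
    clash₂ v≉t (_ , xv) (_ , xt) = v≉t (_≈_.difference (≈-trans (≈-sym xv) xt))

    layer-resp : ∀ {u v s t x} → u ≈ s → v ≈ t → Layer u v x → Layer s t x
    layer-resp u≈s v≈t (xu , xv) = ≈-trans xu u≈s , ≈-trans xv v≈t

    private
      self : ∀ x → K ∋ x - combo (f₁ x) (f₂ x)
      self x = proj₂ (proj₂ (coordinates x))

    f-+ : ∀ x y → Layer (f₁ x ℤ.+ f₁ y) (f₂ x ℤ.+ f₂ y) (x + y)
    f-+ x y = layer (subst (K ∋_)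
      (trans (solve 4 (λ x y a b → (x :- a) :+ (y :- b) ⊜ (x :+ y) :- (a :+ b)) refl x y (combo (f₁ x) (f₂ x)) (combo (f₁ y) (f₂ y)))
        (cong (λ w → (x + y) - w) (combo-+ (f₁ x) (f₂ x) (f₁ y) (f₂ y))))
      (Subgroup.+-mem K (self x) (self y)))

    layer-+ : ∀ {u v s t x y} → Layer u v x → Layer s t y → Layer (u ℤ.+ s) (v ℤ.+ t) (x + y)
    layer-+ {x = x} {y} (xu , xv) (ys , yt) = layer-resp (≈-+ xu ys) (≈-+ xv yt) (f-+ x y)

    layer-K : ∀ {x} → K ∋ x → Layer 0ℤ 0ℤ x
    layer-K {x} h = layer (subst (K ∋_) (solve 1 (λ x → x ⊜ x :- (:0 :+ :0)) refl x) h)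

    layer-neg : ∀ {u v x} → Layer u v x → Layer (ℤ.- u) (ℤ.- v) (- x)
    layer-neg {u} {v} {x} (xu , xv) = layer-resp (≈-neg xu) (≈-neg xv) (layer (subst (K ∋_)
      (trans (solve 3 (λ x a b → :- (x :- (a :+ b)) ⊜ (:- x) :- (:- a :+ :- b)) refl x (f₁ x • e₁) (f₂ x • e₂))
        (cong (λ w → - x - w) (sym (cong₂ _+_ (•-neg (f₁ x) e₁) (•-neg (f₂ x) e₂)))))
      (Subgroup.neg-mem K (self x))))

    layer-sub : ∀ {u v s t x y} → Layer u v x → Layer s t y → Layer (u ℤ.- s) (v ℤ.- t) (x - y)
    layer-sub hx hy = layer-+ hx (layer-neg hy)

    layer-shift : ∀ {u v x a} → Layer u v a → K ∋ x - a → Layer u v x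
    layer-shift {u} {v} {x} {a} ha h = subst (Layer u v) (solve 2 (λ x a → a :+ (x :- a) ⊜ x) refl x a)
      (layer-resp (≈-reflexive (ℤ.+-identityʳ u)) (≈-reflexive (ℤ.+-identityʳ v)) (layer-+ ha (layer-K h)))

    layer-e₁ : Layer 1ℤ 0ℤ e₁
    layer-e₁ = layer (subst (K ∋_) (solve 1 (λ x → :0 ⊜ x :- ((x :+ :0) :+ :0)) refl e₁) (Subgroup.0-mem K))

    layer-e₂ : Layer 0ℤ 1ℤ e₂
    layer-e₂ = layer (subst (K ∋_) (solve 1 (λ x → :0 ⊜ x :- (:0 :+ (x :+ :0))) refl e₂) (Subgroup.0-mem K))

    layer-z₁ : Layer 0ℤ c z₁
    layer-z₁ = layer (subst (K ∋_) (solve 2 (λ x a → x :- a ⊜ x :- (:0 :+ a)) refl z₁ (c • e₂)) z₁-mod-K)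

    layer-• : ∀ {u v x} i → Layer u v x → Layer (i ℤ.* u) (i ℤ.* v) (i • x)
    layer-• {x = x} i (xu , xv) = layer-resp (≈-* i xu) (≈-* i xv) (layer (subst (K ∋_) (begin
      i • (x - combo (f₁ x) (f₂ x))                             ≡⟨ •-distrib i x _ ⟩
      i • x + i • (- combo (f₁ x) (f₂ x))                       ≡⟨ cong (i • x +_) (neg-unique _ _ (trans (sym (•-distrib i _ _)) (trans (cong (i •_) (sub-self _)) (•-0# i)))) ⟩
      i • x - i • combo (f₁ x) (f₂ x)                           ≡⟨ cong (λ w → i • x - w) (•-distrib i _ _) ⟩
      i • x - (i • (f₁ x • e₁) + i • (f₂ x • e₂))               ≡⟨ cong (λ w → i • x - w) (sym (cong₂ _+_ (•-• i (f₁ x) e₁) (•-• i (f₂ x) e₂))) ⟩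
      i • x - combo (i ℤ.* f₁ x) (i ℤ.* f₂ x)                   ∎)
      (Subgroup.•-mem K i (self x))))

    -- half is the inverse of 2 modulo p, so quad i = c i (i - 1) / 2 and σ i below is the
    -- i-th power of x ↦ x + f₁ x • z₁ + f₂ x • z₂.
    quad : ℤ → ℤ
    quad i = c ℤ.* (half ℤ.* (i ℤ.* (i ℤ.- 1ℤ)))

    displacement : ℤ → ℤ → ℤ → A
    displacement i u v = (i ℤ.* u) • z₁ + (i ℤ.* v ℤ.+ quad i ℤ.* u) • z₂

    σ : ℤ → A → A
    σ i x = x + displacement i (f₁ x) (f₂ x)

    quad-cong : ∀ {i j} → i ≈ j → quad i ≈ quad j
    quad-cong i≈j = ≈-* c (≈-* half (≈-*₂ i≈j (≈-+ i≈j ≈-refl)))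

    displacement-cong : ∀ {i j u v s t} → i ≈ j → u ≈ s → v ≈ t → displacement i u v ≡ displacement j s t
    displacement-cong i≈j u≈s v≈t = cong₂ _+_
      (•-cong pz₁≡0 (≈-*₂ i≈j u≈s))
      (•-cong pz₂≡0 (≈-+ (≈-*₂ i≈j v≈t) (≈-*₂ (quad-cong i≈j) u≈s)))

    displacement-+ : ∀ i u v s t →
      displacement i (u ℤ.+ s) (v ℤ.+ t) ≡ displacement i u v + displacement i s t
    displacement-+ i u v s t = trans
      (cong₂ _+_
        (trans (cong (_• z₁) (expand₁ i u s)) (•-+ (i ℤ.* u) (i ℤ.* s) z₁))
        (trans (cong (_• z₂) (expand₂ i u v s t (quad i))) (•-+ (i ℤ.* v ℤ.+ quad i ℤ.* u) _ z₂)))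
      (interchange _ _ _ _)
      where
      expand₁ : ∀ i u s → i ℤ.* (u ℤ.+ s) ≡ i ℤ.* u ℤ.+ i ℤ.* s
      expand₁ = solve-∀
      expand₂ : ∀ i u v s t q → i ℤ.* (v ℤ.+ t) ℤ.+ q ℤ.* (u ℤ.+ s)
        ≡ (i ℤ.* v ℤ.+ q ℤ.* u) ℤ.+ (i ℤ.* t ℤ.+ q ℤ.* s)
      expand₂ = solve-∀

    σ-layer : ∀ {u v} i {x} → Layer u v x → σ i x ≡ x + displacement i u v
    σ-layer i {x} (xu , xv) = cong (x +_) (displacement-cong (≈-refl {i}) xu xv)

    σ-cong : ∀ {i j} x → i ≈ j → σ i x ≡ σ j x
    σ-cong x i≈j = cong (x +_) (displacement-cong i≈j ≈-refl ≈-refl)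

    σ-+ : ∀ i x y → σ i (x + y) ≡ σ i x + σ i y
    σ-+ i x y = begin
      σ i (x + y)                                                            ≡⟨ σ-layer i (f-+ x y) ⟩
      (x + y) + displacement i (f₁ x ℤ.+ f₁ y) (f₂ x ℤ.+ f₂ y)               ≡⟨ cong (λ w → (x + y) + w) (displacement-+ i _ _ _ _) ⟩
      (x + y) + (displacement i (f₁ x) (f₂ x) + displacement i (f₁ y) (f₂ y)) ≡⟨ interchange x y _ _ ⟩
      σ i x + σ i y                                                          ∎

    σ-0 : ∀ x → σ 0ℤ x ≡ x
    σ-0 x = trans (cong (x +_) (cong₂ _+_ (•-torsion pz₁≡0 p∣0)
      (•-torsion pz₂≡0 (subst p∣_ (sym (vanish c half (f₁ x) (f₂ x))) p∣0))))
      (solve 1 (λ x → x :+ (:0 :+ :0) ⊜ x) refl x)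
      where
      vanish : ∀ c h u v → 0ℤ ℤ.* v ℤ.+ c ℤ.* (h ℤ.* (0ℤ ℤ.* (0ℤ ℤ.- 1ℤ))) ℤ.* u ≡ 0ℤ
      vanish = solve-∀

    layer-displacement : ∀ i u v → Layer 0ℤ (c ℤ.* (i ℤ.* u)) (displacement i u v)
    layer-displacement i u v = layer-resp (≈-reflexive (zero-coordinate (i ℤ.* u))) (≈-reflexive (second-coordinate (i ℤ.* u) c))
      (layer-+ (layer-• (i ℤ.* u) layer-z₁) (layer-K (Subgroup.•-mem K (i ℤ.* v ℤ.+ quad i ℤ.* u) z₂∈K)))
      where
      zero-coordinate : ∀ a → a ℤ.* 0ℤ ℤ.+ 0ℤ ≡ 0ℤ
      zero-coordinate = solve-∀
      second-coordinate : ∀ a c → a ℤ.* c ℤ.+ 0ℤ ≡ c ℤ.* a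
      second-coordinate = solve-∀

    layer-σ : ∀ {u v} i {x} → Layer u v x → Layer u (v ℤ.+ c ℤ.* (i ℤ.* u)) (σ i x)
    layer-σ {u} {v} i {x} h = subst (Layer _ _) (sym (σ-layer i h))
      (layer-resp (≈-reflexive (ℤ.+-identityʳ u)) ≈-refl (layer-+ h (layer-displacement i u v)))

    self-layer : ∀ x → Layer (f₁ x) (f₂ x) x
    self-layer x = ≈-refl , ≈-refl

    f₁-σ : ∀ i x → f₁ (σ i x) ≈ f₁ x
    f₁-σ i x = proj₁ (layer-σ i (self-layer x))

    -- Applying `σ j` first raises the second coordinate by c j u, which adds c i j u to the
    -- coefficient of z₂. On the other side, `quad (i + j)` exceeds `quad i + quad j` by 2 `half` c
    -- i j, and 2 `half` is 1 modulo p.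
    σ-σ : ∀ i j x → σ i (σ j x) ≡ σ (i ℤ.+ j) x
    σ-σ i j x = begin
      σ i (σ j x)                                                   ≡⟨ σ-layer i (layer-σ j (self-layer x)) ⟩
      (x + displacement j u v) + displacement i u (v ℤ.+ c ℤ.* (j ℤ.* u)) ≡⟨ solve 3 (λ x a b → (x :+ a) :+ b ⊜ x :+ (a :+ b)) refl x _ _ ⟩
      x + (displacement j u v + displacement i u (v ℤ.+ c ℤ.* (j ℤ.* u))) ≡⟨ cong (x +_) (interchange _ _ _ _) ⟩
      x + (((j ℤ.* u) • z₁ + (i ℤ.* u) • z₁) + (jz₂ • z₂ + iz₂ • z₂))  ≡⟨ cong (x +_) (sym (cong₂ _+_ (•-+ (j ℤ.* u) (i ℤ.* u) z₁) (•-+ jz₂ iz₂ z₂))) ⟩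
      x + ((j ℤ.* u ℤ.+ i ℤ.* u) • z₁ + (jz₂ ℤ.+ iz₂) • z₂)           ≡⟨ cong (x +_) (cong₂ _+_ (cong (_• z₁) (collect i j u)) (•-cong {i = jz₂ ℤ.+ iz₂} {j = (i ℤ.+ j) ℤ.* v ℤ.+ quad (i ℤ.+ j) ℤ.* u} pz₂≡0 (congruent (divides (ℤ.- (u ℤ.* (c ℤ.* (i ℤ.* j)))) difference≡)))) ⟩
      σ (i ℤ.+ j) x                                                 ∎
      where
      u = f₁ x
      v = f₂ x
      jz₂ = j ℤ.* v ℤ.+ quad j ℤ.* u
      iz₂ = i ℤ.* (v ℤ.+ c ℤ.* (j ℤ.* u)) ℤ.+ quad i ℤ.* u
      collect : ∀ i j u → j ℤ.* u ℤ.+ i ℤ.* u ≡ (i ℤ.+ j) ℤ.* u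
      collect = solve-∀
      expand : ∀ i j u v c h →
        ((j ℤ.* v ℤ.+ c ℤ.* (h ℤ.* (j ℤ.* (j ℤ.- 1ℤ))) ℤ.* u)
          ℤ.+ (i ℤ.* (v ℤ.+ c ℤ.* (j ℤ.* u)) ℤ.+ c ℤ.* (h ℤ.* (i ℤ.* (i ℤ.- 1ℤ))) ℤ.* u))
          ℤ.- ((i ℤ.+ j) ℤ.* v ℤ.+ c ℤ.* (h ℤ.* ((i ℤ.+ j) ℤ.* ((i ℤ.+ j) ℤ.- 1ℤ))) ℤ.* u)
        ≡ (1ℤ ℤ.- (h ℤ.+ h)) ℤ.* (u ℤ.* (c ℤ.* (i ℤ.* j)))
      expand = solve-∀
      reduce : ∀ p w → (1ℤ ℤ.- (1ℤ ℤ.+ p)) ℤ.* w ≡ ℤ.- w ℤ.* p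
      reduce = solve-∀
      difference≡ : (jz₂ ℤ.+ iz₂) ℤ.- ((i ℤ.+ j) ℤ.* v ℤ.+ quad (i ℤ.+ j) ℤ.* u)
        ≡ ℤ.- (u ℤ.* (c ℤ.* (i ℤ.* j))) ℤ.* pos p
      difference≡ = trans (expand i j u v c half)
        (trans (cong (λ w → (1ℤ ℤ.- w) ℤ.* (u ℤ.* (c ℤ.* (i ℤ.* j)))) (proj₂ halving)) (reduce (pos p) _))

    σ-inverseˡ : ∀ i x → σ (ℤ.- i) (σ i x) ≡ x
    σ-inverseˡ i x = trans (σ-σ (ℤ.- i) i x) (trans (cong (λ j → σ j x) (ℤ.+-inverseˡ i)) (σ-0 x))

    σ-inverseʳ : ∀ i x → σ i (σ (ℤ.- i) x) ≡ x
    σ-inverseʳ i x = trans (σ-σ i (ℤ.- i) x) (trans (cong (λ j → σ j x) (ℤ.+-inverseʳ i)) (σ-0 x))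

    σ-K : ∀ i {x} → K ∋ x → σ i x ≡ x
    σ-K i {x} h = trans (σ-layer i (layer-K h))
      (trans (cong (x +_) (cong₂ _+_ (cong (_• z₁) (vanish₁ i)) (cong (_• z₂) (vanish₂ i (quad i)))))
        (solve 1 (λ x → x :+ (:0 :+ :0) ⊜ x) refl x))
      where
      vanish₁ : ∀ i → i ℤ.* 0ℤ ≡ 0ℤ
      vanish₁ = solve-∀
      vanish₂ : ∀ i q → i ℤ.* 0ℤ ℤ.+ q ℤ.* 0ℤ ≡ 0ℤ
      vanish₂ = solve-∀

    σ-neg : ∀ i x → σ i (- x) ≡ - σ i x
    σ-neg i x = neg-unique (σ i x) (σ i (- x))
      (trans (sym (σ-+ i x (- x))) (trans (cong (σ i) (sub-self x)) (σ-K i (Subgroup.0-mem K))))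

    σ-sub : ∀ i x y → σ i (x - y) ≡ σ i x - σ i y
    σ-sub i x y = trans (σ-+ i x (- y)) (cong (σ i x +_) (σ-neg i y))

    σ-e₁ : ∀ i → σ i e₁ ≡ e₁ + (i • z₁ + quad i • z₂)
    σ-e₁ i = trans (σ-layer i layer-e₁)
      (cong (e₁ +_) (cong₂ _+_ (cong (_• z₁) (ℤ.*-identityʳ i)) (cong (_• z₂) (simplify i (quad i)))))
      where
      simplify : ∀ i q → i ℤ.* 0ℤ ℤ.+ q ℤ.* 1ℤ ≡ q
      simplify = solve-∀

    σ-e₂ : ∀ i → σ i e₂ ≡ e₂ + i • z₂
    σ-e₂ i = trans (σ-layer i layer-e₂)
      (cong (e₂ +_) (trans (cong₂ _+_ (cong (_• z₁) (ℤ.*-zeroʳ i)) (cong (_• z₂) (simplify i (quad i))))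
        (solve 1 (λ x → :0 :+ x ⊜ x) refl _)))
      where
      simplify : ∀ i q → i ℤ.* 1ℤ ℤ.+ q ℤ.* 0ℤ ≡ i
      simplify = solve-∀

    σ-e₂-moves : ∀ i → σ i e₂ - e₂ ≡ i • z₂
    σ-e₂-moves i = trans (cong (_- e₂) (σ-e₂ i)) (solve 2 (λ e z → (e :+ z) :- e ⊜ z) refl e₂ (i • z₂))

    -- σ fixes L pointwise because L lies in K, so a coset of L is invariant as soon as its
    -- representative a stays inside it.
    σ-coset : ∀ (L : Subgroup) i {a x} → (L ∋_) ⊆ (K ∋_) → L ∋ σ i a - a → L ∋ x - a → L ∋ σ i x - a
    σ-coset L i {a} {x} L⊆K ha hx = subst (L ∋_) (begin
        (x - a) + (σ i a - a)            ≡⟨ cong (_+ (σ i a - a)) (sym (σ-K i (L⊆K hx))) ⟩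
        σ i (x - a) + (σ i a - a)        ≡⟨ cong (_+ (σ i a - a)) (σ-sub i x a) ⟩
        (σ i x - σ i a) + (σ i a - a)    ≡⟨ solve 3 (λ s t a → (s :- t) :+ (t :- a) ⊜ s :- a) refl (σ i x) (σ i a) a ⟩
        σ i x - a                        ∎) (Subgroup.+-mem L hx ha)
      where open ≡-Reasoning

    ⟨z₂⟩⊆K : (⟨ z₂ ⟩ ∋_) ⊆ (K ∋_)
    ⟨z₂⟩⊆K = ⊕-least trivial K (λ { refl → Subgroup.0-mem K }) z₂∈K

    z₁-order : ∀ {i} → ⟨ z₂ ⟩ ∋ i • z₁ → p∣ i
    z₁-order = order-mod ⟨ z₂ ⟩ (subst (⟨ z₂ ⟩ ∋_) (sym pz₁≡0) (Subgroup.0-mem ⟨ z₂ ⟩)) z₁∉⟨z₂⟩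

    z₂-order : ∀ {i} → i • z₂ ≡ 0# → p∣ i
    z₂-order = order-mod trivial pz₂≡0 z₂≢0

    -- Modulo ⟨ z₂ ⟩ the image of e₁ is e₁ + i z₁, and z₁ has order p there. Hence σ has exactly p
    -- distinct powers, already told apart by e₁.
    σ-e₁-injective : ∀ {i j} → σ i e₁ ≡ σ j e₁ → i ≈ j
    σ-e₁-injective {i} {j} eq = congruent (z₁-order (subst (⟨ z₂ ⟩ ∋_)
      (begin
        (quad j ℤ.- quad i) • z₂                                          ≡⟨ •-sub (quad j) (quad i) z₂ ⟩
        quad j • z₂ - quad i • z₂                                         ≡⟨ solve 5 (λ e a b c d → d :- b ⊜ ((e :+ (c :+ d)) :- (e :+ (a :+ b))) :+ (a :- c)) refl e₁ (i • z₁) (quad i • z₂) (j • z₁) (quad j • z₂) ⟩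
        ((e₁ + (j • z₁ + quad j • z₂)) - (e₁ + (i • z₁ + quad i • z₂))) + (i • z₁ - j • z₁)
                                                                          ≡⟨ cong₂ (λ a b → (a - b) + (i • z₁ - j • z₁)) (sym (σ-e₁ j)) (sym (σ-e₁ i)) ⟩
        (σ j e₁ - σ i e₁) + (i • z₁ - j • z₁)                             ≡⟨ cong (λ w → (σ j e₁ - w) + (i • z₁ - j • z₁)) eq ⟩
        (σ j e₁ - σ j e₁) + (i • z₁ - j • z₁)                             ≡⟨ solve 2 (λ s a → (s :- s) :+ a ⊜ a) refl (σ j e₁) _ ⟩
        i • z₁ - j • z₁                                                   ≡⟨ sym (•-sub i j z₁) ⟩
        (i ℤ.- j) • z₁                                                    ∎)
      (multiples (quad j ℤ.- quad i) z₂)))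

-- From a rigid connection set to the full automorphism group and its regular subgroup.

module Conclusion (G : FinGroup) (comm : IsAbelian G)
                  (p : ℕ) (isPrime : Prime p) (odd : ¬ (2 ∣ p))
                  (F : Frames.Frame G comm p isPrime odd) where
  open Frames G comm p isPrime odd public
  open FrameProperties F public
  open Automorphism

  -- What either case has to deliver. `orbit` and `rigid` bound the stabiliser of 0 by the p powers
  -- of σ, `S-σ` shows that all of these occur, and the arc from 0 to e₁ without its reverse makes
  -- the digraph proper.
  record RigidConnectionSet : Set₁ where
    field
      S       : A → Set
      S?      : ∀ x → Dec (S x)
      0∉S     : ¬ S 0#
      e₁∈S    : S e₁
      -e₁∉S   : ¬ S (- e₁)
      S-σ     : ∀ i {x} → S x → S (σ i x)
      orbit   : ∀ (α : Automorphism S) → to α 0# ≡ 0# → ∃[ i ] to α e₁ ≡ σ i e₁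
      rigid   : ∀ (α : Automorphism S) → to α 0# ≡ 0# → to α e₁ ≡ e₁ → ∀ x → to α x ≡ x

  module Assemble (R : RigidConnectionSet) where
    open RigidConnectionSet R

    connection : Subset n
    connection = tabulate (λ x → does (S? x))

    ∈-connection : ∀ {x} → S x → x ∈ connection
    ∈-connection {x} x∈S = lookup⇒[]= x connection
      (trans (lookup∘tabulate (λ y → does (S? y)) x) (dec-true (S? x) x∈S))

    connection-∈ : ∀ {x} → x ∈ connection → S x
    connection-∈ {x} h with S? x | trans (sym (lookup∘tabulate (λ y → does (S? y)) x)) ([]=⇒lookup h)
    ... | yes x∈S | _ = x∈S
    ... | no _    | ()

    Γ : Digraph n
    Γ = CayArc G connection

    isAut : ∀ (α : Automorphism S) → IsAut Γ (to α)
    isAut α = (from α , to-from α , from-to α) , λ u v → mk⇔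
      (λ h → ∈-connection (to-arc α u v (connection-∈ h)))
      (λ h → ∈-connection (subst₂ (λ a b → S (b - a)) (from-to α u) (from-to α v)
        (from-arc α (to α u) (to α v) (connection-∈ h))))

    automorphism : ∀ {φ} → IsAut Γ φ → Σ[ α ∈ Automorphism S ] (∀ x → to α x ≡ φ x)
    automorphism {φ} ((ψ , φψ , ψφ) , arcs) = record
      { to = φ ; from = ψ ; to-from = φψ ; from-to = ψφ
      ; to-arc = λ x y h → connection-∈ (Equivalence.to (arcs x y) (∈-connection h))
      ; from-arc = λ x y h → connection-∈ (Equivalence.from (arcs (ψ x) (ψ y))
          (∈-connection (subst₂ (λ a b → S (b - a)) (sym (φψ x)) (sym (φψ y)) h))) } , λ _ → refl

    affine : ℤ → A → Automorphism S
    affine i g = record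
      { to = λ x → σ i x + g
      ; from = λ x → σ (ℤ.- i) (x - g)
      ; to-from = λ x → trans (cong (_+ g) (σ-inverseʳ i (x - g))) (solve 2 (λ x g → (x :- g) :+ g ⊜ x) refl x g)
      ; from-to = λ x → trans (cong (σ (ℤ.- i)) (solve 2 (λ s g → (s :+ g) :- g ⊜ s) refl (σ i x) g)) (σ-inverseˡ i x)
      ; to-arc = λ x y h → subst S
          (trans (σ-sub i y x) (solve 3 (λ s t g → t :- s ⊜ (t :+ g) :- (s :+ g)) refl (σ i x) (σ i y) g)) (S-σ i h)
      ; from-arc = λ x y h → subst S
          (trans (cong (σ (ℤ.- i)) (solve 3 (λ x y g → y :- x ⊜ (y :- g) :- (x :- g)) refl x y g)) (σ-sub (ℤ.- i) (y - g) (x - g)))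
          (S-σ (ℤ.- i) h) }

    infixr 9 _∙_

    _∙_ : Automorphism S → Automorphism S → Automorphism S
    α ∙ β = record
      { to = to α ∘ to β ; from = from β ∘ from α
      ; to-from = λ x → trans (cong (to α) (to-from β (from α x))) (to-from α x)
      ; from-to = λ x → trans (cong (from β) (from-to α (to β x))) (from-to β x)
      ; to-arc = λ x y h → to-arc α _ _ (to-arc β x y h)
      ; from-arc = λ x y h → from-arc β _ _ (from-arc α x y h) }

    -- Translating the image of 0 back to 0 and then undoing the power of σ seen on e₁ leaves an
    -- automorphism fixing 0 and e₁, which is the identity.
    classify : ∀ (α : Automorphism S) → ∃[ i ] ∃[ g ] (∀ x → σ i x + g ≡ to α x)
    classify α = i , t , λ x → begin
      σ i x + t                          ≡⟨ cong (λ w → σ i w + t) (sym (γ-id x)) ⟩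
      σ i (to γ x) + t                   ≡⟨ cong (λ w → σ i w + t) (+-identityʳ (σ (ℤ.- i) (to β x))) ⟩
      σ i (σ (ℤ.- i) (to β x)) + t       ≡⟨ cong (_+ t) (σ-inverseʳ i (to β x)) ⟩
      (σ 0ℤ (to α x) - t) + t            ≡⟨ cong (λ w → (w - t) + t) (σ-0 (to α x)) ⟩
      (to α x - t) + t                   ≡⟨ solve 2 (λ x g → (x :- g) :+ g ⊜ x) refl (to α x) t ⟩
      to α x                             ∎
      where
      open ≡-Reasoning
      t : A
      t = to α 0#
      β : Automorphism S
      β = affine 0ℤ (- t) ∙ α
      β-0 : to β 0# ≡ 0#
      β-0 = trans (cong (_- t) (σ-0 t)) (sub-self t)
      i : ℤ
      i = proj₁ (orbit β β-0)
      γ : Automorphism S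
      γ = affine (ℤ.- i) 0# ∙ β
      γ-0 : to γ 0# ≡ 0#
      γ-0 = trans (+-identityʳ _) (trans (cong (σ (ℤ.- i)) β-0) (σ-K (ℤ.- i) (Subgroup.0-mem K)))
      γ-e₁ : to γ e₁ ≡ e₁
      γ-e₁ = trans (+-identityʳ _) (trans (cong (σ (ℤ.- i)) (proj₂ (orbit β β-0))) (σ-inverseˡ i e₁))
      γ-id : ∀ x → to γ x ≡ x
      γ-id = rigid γ γ-0 γ-e₁

    affine-0 : ∀ i g → σ i 0# + g ≡ g
    affine-0 i g = trans (cong (_+ g) (σ-K i (Subgroup.0-mem K))) (solve 1 (λ g → :0 :+ g ⊜ g) refl g)

    affine-injective : ∀ {i j g h} → (∀ x → σ i x + g ≡ σ j x + h) → i ≈ j × g ≡ h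
    affine-injective {i} {j} {g} {h} eq = σ-e₁-injective (begin
      σ i e₁               ≡⟨ solve 2 (λ x g → x ⊜ (x :+ g) :- g) refl (σ i e₁) g ⟩
      (σ i e₁ + g) - g     ≡⟨ cong₂ _-_ (eq e₁) g≡h ⟩
      (σ j e₁ + h) - h     ≡⟨ solve 2 (λ x g → (x :+ g) :- g ⊜ x) refl (σ j e₁) h ⟩
      σ j e₁               ∎) , g≡h
      where
      open ≡-Reasoning
      g≡h : g ≡ h
      g≡h = trans (sym (affine-0 i g)) (trans (eq 0#) (affine-0 j h))

    rotation : Fin (p * n) → ℤ
    rotation k = pos (toℕ (proj₁ (remQuot {p} n k)))

    translation : Fin (p * n) → A
    translation k = proj₂ (remQuot {p} n k)

    element : Fin (p * n) → A → A
    element k x = σ (rotation k) x + translation k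

    element-injective : ∀ k l → element k ≗ element l → k ≡ l
    element-injective k l eq = begin
      k                                    ≡⟨ sym (combine-remQuot {p} n k) ⟩
      combine (proj₁ (remQuot {p} n k)) (translation k)
        ≡⟨ cong₂ combine (residue-unique (proj₁ (remQuot {p} n k)) (proj₁ (remQuot {p} n l)) (proj₁ same)) (proj₂ same) ⟩
      combine (proj₁ (remQuot {p} n l)) (translation l)
                                           ≡⟨ combine-remQuot {p} n l ⟩
      l                                    ∎
      where
      open ≡-Reasoning
      same : rotation k ≈ rotation l × translation k ≡ translation l
      same = affine-injective eq

    element-surjective : ∀ i g → ∃[ k ] (∀ x → element k x ≡ σ i x + g)
    element-surjective i g = combine (residue i) g , λ x →
      trans (cong (λ (r , h) → σ (pos (toℕ r)) x + h) (remQuot-combine (residue i) g))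
        (cong (_+ g) (σ-cong x (residue-≈ i)))

    autOrder : AutOrder Γ (p * n)
    autOrder = element , (λ k → isAut (affine (rotation k) (translation k))) , element-injective , enumerate
      where
      enumerate : ∀ φ → IsAut Γ φ → ∃[ k ] element k ≗ φ
      enumerate φ φ-aut =
        let (α , α≡φ) = automorphism φ-aut
            (i , g , affine≡α) = classify α
            (k , element≡affine) = element-surjective i g
        in k , λ x → trans (element≡affine x) (trans (affine≡α x) (α≡φ x))

    twisted : A → A → A
    twisted g x = σ (f₁ g) x + g

    -- f₁ is additive modulo p and unchanged by σ, so the exponent attached to `twisted g h` is the
    -- sum of the two exponents.
    twisted-∘ : ∀ g h x → twisted (twisted g h) x ≡ twisted g (twisted h x)
    twisted-∘ g h x = begin
      σ (f₁ (twisted g h)) x + (σ (f₁ g) h + g)          ≡⟨ cong (_+ twisted g h) (σ-cong x f₁-twisted) ⟩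
      σ (f₁ g ℤ.+ f₁ h) x + (σ (f₁ g) h + g)             ≡⟨ cong (_+ twisted g h) (sym (σ-σ (f₁ g) (f₁ h) x)) ⟩
      σ (f₁ g) (σ (f₁ h) x) + (σ (f₁ g) h + g)           ≡⟨ solve 3 (λ a b c → a :+ (b :+ c) ⊜ (a :+ b) :+ c) refl (σ (f₁ g) (σ (f₁ h) x)) (σ (f₁ g) h) g ⟩
      (σ (f₁ g) (σ (f₁ h) x) + σ (f₁ g) h) + g           ≡⟨ cong (_+ g) (sym (σ-+ (f₁ g) (σ (f₁ h) x) h)) ⟩
      twisted g (twisted h x)                            ∎
      where
      open ≡-Reasoning
      f₁-twisted : f₁ (twisted g h) ≈ f₁ g ℤ.+ f₁ h
      f₁-twisted = ≈-trans (proj₁ (f-+ (σ (f₁ g) h) g))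
        (subst (λ w → f₁ (σ (f₁ g) h) ℤ.+ f₁ g ≈ w) (ℤ.+-comm (f₁ h) (f₁ g)) (≈-+ (f₁-σ (f₁ g) h) (≈-refl {f₁ g})))

    twisted-injective : ∀ {g h} → twisted g ≗ twisted h → g ≡ h
    twisted-injective {g} {h} eq = proj₂ (affine-injective {f₁ g} {f₁ h} {g} {h} eq)

    -- Applying f₁ to the equation `twisted g u ≡ v` forces f₁ g to be f₁ v - f₁ u. The exponent of
    -- σ is then known, and g is determined by subtraction.
    transporter : ∀ u v → ∃[ g ] (twisted g u ≡ v × ∀ h → twisted h u ≡ v → h ≡ g)
    transporter u v = g
      , trans (cong (_+ g) (σ-cong u f₁-g)) (solve 2 (λ s v → s :+ (v :- s) ⊜ v) refl (σ d u) v)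
      , λ h eq → trans (solve 2 (λ s h → h ⊜ (s :+ h) :- s) refl (σ (f₁ h) u) h)
          (cong₂ _-_ eq (σ-cong u (f₁-unique h eq)))
      where
      d : ℤ
      d = f₁ v ℤ.- f₁ u
      g : A
      g = v - σ d u
      f₁-g : f₁ g ≈ d
      f₁-g = proj₁ (layer-sub (self-layer v) (layer-σ d (self-layer u)))
      cancel : ∀ a b → b ≡ (a ℤ.+ b) ℤ.- a
      cancel = solve-∀
      f₁-unique : ∀ h → twisted h u ≡ v → f₁ h ≈ d
      f₁-unique h refl = subst (_≈ d) (sym (cancel (f₁ u) (f₁ h)))
        (≈-+ (≈-sym (≈-trans (proj₁ (f-+ (σ (f₁ h) u) h)) (≈-+ (f₁-σ (f₁ h) u) ≈-refl))) ≈-refl)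

    regularSubgroup : AutSubgroup Γ n
    regularSubgroup = record
      { elt = twisted
      ; isAut = λ g → isAut (affine (f₁ g) g)
      ; distinct = λ g h → twisted-injective {g} {h}
      ; hasId = 0# , twisted-0
      ; closedMul = λ g h → twisted g h , twisted-∘ g h
      ; closedInv = λ g →
          let (h , hg≡0 , _) = transporter g 0# in h , λ x →
            trans (sym (twisted-∘ h g x)) (trans (cong (λ k → twisted k x) hg≡0) (twisted-0 x)) }
      where
      twisted-0 : ∀ x → twisted 0# x ≡ x
      twisted-0 x = trans (+-identityʳ _) (trans (σ-cong x (proj₁ (layer-K (Subgroup.0-mem K)))) (σ-0 x))

    nonabelian : IsNonabelian regularSubgroup
    nonabelian = e₁ , e₂ , λ commute → z₂≢0 (begin
      z₂                                              ≡⟨ solve 3 (λ a b z → z ⊜ ((b :+ z) :+ a) :- (a :+ b)) refl e₁ e₂ z₂ ⟩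
      ((e₂ + z₂) + e₁) - (e₁ + e₂)                    ≡⟨ cong₂ _-_ (sym e₁e₂) (sym e₂e₁) ⟩
      twisted e₁ (twisted e₂ 0#) - twisted e₂ (twisted e₁ 0#) ≡⟨ cong (_- twisted e₂ (twisted e₁ 0#)) (commute 0#) ⟩
      twisted e₂ (twisted e₁ 0#) - twisted e₂ (twisted e₁ 0#) ≡⟨ sub-self _ ⟩
      0#                                              ∎)
      where
      open ≡-Reasoning
      e₁e₂ : twisted e₁ (twisted e₂ 0#) ≡ (e₂ + z₂) + e₁
      e₁e₂ = begin
        twisted e₁ (twisted e₂ 0#)   ≡⟨ cong (twisted e₁) (affine-0 (f₁ e₂) e₂) ⟩
        σ (f₁ e₁) e₂ + e₁            ≡⟨ cong (_+ e₁) (σ-cong e₂ (proj₁ layer-e₁)) ⟩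
        σ 1ℤ e₂ + e₁                 ≡⟨ cong (_+ e₁) (trans (σ-e₂ 1ℤ) (cong (e₂ +_) (1-• z₂))) ⟩
        (e₂ + z₂) + e₁               ∎
      e₂e₁ : twisted e₂ (twisted e₁ 0#) ≡ e₁ + e₂
      e₂e₁ = begin
        twisted e₂ (twisted e₁ 0#)   ≡⟨ cong (twisted e₂) (affine-0 (f₁ e₁) e₁) ⟩
        σ (f₁ e₂) e₁ + e₂            ≡⟨ cong (_+ e₂) (trans (σ-cong e₁ (proj₁ layer-e₂)) (σ-0 e₁)) ⟩
        e₁ + e₂                      ∎

    conclusion : Σ (Subset n) λ S →
      0# ∉ S × IsProper (CayArc G S) × AutOrder (CayArc G S) (p * n) × HasNonabelianRegularSubgroup (CayArc G S)
    conclusion = connection , 0∉S ∘ connection-∈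
      , (0# , e₁ , ∈-connection (subst S (sym (sub-0 e₁)) e₁∈S)
        , λ h → -e₁∉S (subst S (solve 1 (λ e → :0 :- e ⊜ :- e) refl e₁) (connection-∈ h)))
      , autOrder
      , n , regularSubgroup , transporter , nonabelian

-- The case of z₁ in K: cosets of four lines in the plane spanned by z₁ and z₂.

module SplitCase (G : FinGroup) (comm : IsAbelian G)
                 (p : ℕ) (isPrime : Prime p) (odd : ¬ (2 ∣ p))
                 (F : Frames.Frame G comm p isPrime odd) (c≡0 : Frames.Frame.c F ≡ 0ℤ) where
  open Conclusion G comm p isPrime odd F
  open Automorphism

  vec : ℤ → ℤ → A
  vec a b = a • z₁ + b • z₂

  Line : ℤ → ℤ → Subgroup
  Line a b = ⟨ vec a b ⟩

  Z : Subgroup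
  Z = Line 1ℤ 0ℤ ⊕⟨ vec 0ℤ 1ℤ ⟩

  z₁∈K : K ∋ z₁
  z₁∈K = subst (K ∋_) (trans (cong (λ d → z₁ - d • e₂) c≡0) (sub-0 z₁)) z₁-mod-K

  vec∈K : ∀ a b → K ∋ vec a b
  vec∈K a b = Subgroup.+-mem K (Subgroup.•-mem K a z₁∈K) (Subgroup.•-mem K b z₂∈K)

  vec≡0 : ∀ {a b} → vec a b ≡ 0# → p∣ a × p∣ b
  vec≡0 {a} {b} eq = p∣a , z₂-order (trans (solve 2 (λ x y → y ⊜ (x :+ y) :- x) refl (a • z₁) (b • z₂))
      (trans (cong₂ _-_ eq (•-torsion pz₁≡0 p∣a)) (sub-0 0#)))
    where
    p∣a : p∣ a
    p∣a = z₁-order (subst (⟨ z₂ ⟩ ∋_)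
      (trans (•-neg b z₂) (trans (solve 2 (λ x y → :- y ⊜ x :- (x :+ y)) refl (a • z₁) (b • z₂))
        (trans (cong (λ w → a • z₁ - w) eq) (sub-0 _))))
      (multiples (ℤ.- b) z₂))

  vec-injective : ∀ {a b c d} → vec a b ≡ vec c d → a ≈ c × b ≈ d
  vec-injective {a} {b} {c} {d} eq =
    let (p∣₁ , p∣₂) = vec≡0 {a ℤ.- c} {b ℤ.- d} (begin
          vec (a ℤ.- c) (b ℤ.- d)                          ≡⟨ cong₂ _+_ (•-sub a c z₁) (•-sub b d z₂) ⟩
          (a • z₁ - c • z₁) + (b • z₂ - d • z₂)            ≡⟨ solve 4 (λ a b c d → (a :- c) :+ (b :- d) ⊜ (a :+ b) :- (c :+ d)) refl (a • z₁) (b • z₂) (c • z₁) (d • z₂) ⟩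
          vec a b - vec c d                                ≡⟨ cong (_- vec c d) eq ⟩
          vec c d - vec c d                                ≡⟨ sub-self _ ⟩
          0#                                               ∎)
    in congruent p∣₁ , congruent p∣₂
    where open ≡-Reasoning

  on-line : ∀ a b {x} → Line a b ∋ x → ∃[ i ] x ≡ vec (i ℤ.* a) (i ℤ.* b)
  on-line a b h = let (i , eq) = as-multiple h in i ,
    trans eq (trans (•-distrib i _ _) (cong₂ _+_ (sym (•-• i a z₁)) (sym (•-• i b z₂))))

  -- Eliminating j from i (a, b) = j (c, d) by Cramer's rule leaves i times the determinant, so p
  -- divides i.
  line-meet : ∀ a b c d → ¬ p∣ (a ℤ.* d ℤ.- b ℤ.* c) → ∀ {x} → Line a b ∋ x → Line c d ∋ x → x ≡ 0#
  line-meet a b c d p∤det h h' with on-line a b h | on-line c d h'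
  ... | i , refl | j , eq =
    let (ia≈jc , ib≈jd) = vec-injective {i ℤ.* a} {i ℤ.* b} {j ℤ.* c} {j ℤ.* d} eq
        p∣i = p∣-cancel {i} {a ℤ.* d ℤ.- b ℤ.* c} p∤det (≈0⇒p∣ (subst₂ _≈_ (determinant i a b c d) (degenerate j c d)
                (≈-+ (≈-* d ia≈jc) (≈-neg (≈-* c ib≈jd)))))
    in trans (cong₂ _+_ (•-torsion {i = i ℤ.* a} pz₁≡0 (∣m⇒∣m*n a p∣i)) (•-torsion {i = i ℤ.* b} pz₂≡0 (∣m⇒∣m*n b p∣i))) (+-identityʳ 0#)
    where
    determinant : ∀ i a b c d → d ℤ.* (i ℤ.* a) ℤ.- c ℤ.* (i ℤ.* b) ≡ i ℤ.* (a ℤ.* d ℤ.- b ℤ.* c)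
    determinant = solve-∀
    degenerate : ∀ j c d → d ℤ.* (j ℤ.* c) ℤ.- c ℤ.* (j ℤ.* d) ≡ 0ℤ
    degenerate = solve-∀

  line⊆ : ∀ a b (H : Subgroup) → H ∋ vec a b → (Line a b ∋_) ⊆ (H ∋_)
  line⊆ a b H = ⊕-least trivial H (λ { refl → Subgroup.0-mem H })

  line⊆K : ∀ a b → (Line a b ∋_) ⊆ (K ∋_)
  line⊆K a b = line⊆ a b K (vec∈K a b)

  Z⊆K : (Z ∋_) ⊆ (K ∋_)
  Z⊆K = ⊕-least (Line 1ℤ 0ℤ) K (line⊆K 1ℤ 0ℤ) (vec∈K 0ℤ 1ℤ)

  vec∈Z : ∀ a b → Z ∋ vec a b
  vec∈Z a b = subst (Z ∋_)
    (trans (cong₂ _+_ (trans (•-distrib a _ _) (cong₂ _+_ (cong (a •_) (1-• z₁)) (•-0# a)))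
        (trans (•-distrib b _ _) (cong₂ _+_ (•-0# b) (cong (b •_) (1-• z₂)))))
      (solve 2 (λ x y → (x :+ :0) :+ (:0 :+ y) ⊜ x :+ y) refl (a • z₁) (b • z₂)))
    (Subgroup.+-mem Z (Subgroup.•-mem Z a (⊕-base (Line 1ℤ 0ℤ) (⊕-gen trivial))) (Subgroup.•-mem Z b (⊕-gen (Line 1ℤ 0ℤ))))

  line⊆Z : ∀ a b → (Line a b ∋_) ⊆ (Z ∋_)
  line⊆Z a b = line⊆ a b Z (vec∈Z a b)

  ∉line₁₀ : ∀ a b → ¬ p∣ b → ¬ Line 1ℤ 0ℤ ∋ vec a b
  ∉line₁₀ a b p∤b h = let (i , eq) = on-line 1ℤ 0ℤ h in
    p∤b (≈0⇒p∣ (subst (b ≈_) (ℤ.*-zeroʳ i) (proj₂ (vec-injective {a} {b} {i ℤ.* 1ℤ} {i ℤ.* 0ℤ} eq))))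

  -- Starting the chain with the complement of ⟨ z₁ ⟩ in Z rather than with Z makes both Z and ⟨ z₁
  -- ⟩ recoverable; the line ⟨ z₁ ⟩ is what later singles out `Hor`.
  T : A → Set
  T x = Z ∋ x × ¬ Line 1ℤ 0ℤ ∋ x

  T-gen : (Z ∋_) ⊆ Gen T
  T-gen = gen-complement (Line 1ℤ 0ℤ) Z (⊕-base (Line 1ℤ 0ℤ)) (⊕-gen (Line 1ℤ 0ℤ))
    (∉line₁₀ 0ℤ 1ℤ p∤1) (Subgroup.mem? (Line 1ℤ 0ℤ)) id

  chain : Σ[ C ∈ Chain K Z T ] (K ∋_) ⊆ (Chain.H C ∋_)
  chain = full-chain (base-chain K Z Z⊆K
    (λ x → Subgroup.mem? Z x ×-dec ¬? (Subgroup.mem? (Line 1ℤ 0ℤ) x)) proj₁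
    (λ {x} (h , ¬h) → Subgroup.neg-mem Z h ,
      λ h' → ¬h (subst (Line 1ℤ 0ℤ ∋_) (neg-involutive x) (Subgroup.neg-mem (Line 1ℤ 0ℤ) h')))
    T-gen)

  module Connection (C : Chain K Z T) (K⊆H : (K ∋_) ⊆ (Chain.H C ∋_)) where
    open Chain C

    T₂⁺ : A → A → Set
    T₂⁺ b t = t ≡ b ⊎ T₂ t

    T₂⁺⊆K : ∀ {b} → Z ∋ b → T₂⁺ b ⊆ (K ∋_)
    T₂⁺⊆K b∈Z (inj₁ refl) = Z⊆K b∈Z
    T₂⁺⊆K b∈Z (inj₂ t)    = H⊆K (T₂⊆H t)

    T₂⁺-sep : ∀ {b s t} → Z ∋ b → T₂⁺ b s → T₂⁺ b t → Z ∋ s - t → s ≡ t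
    T₂⁺-sep b∈Z (inj₁ refl) (inj₁ refl) h = refl
    T₂⁺-sep {s = s} {t} b∈Z (inj₁ refl) (inj₂ t∈) h = contradiction
      (subst (Z ∋_) (solve 2 (λ s t → s :- (s :- t) ⊜ t) refl s t) (Subgroup.minus-mem Z b∈Z h)) (T₂∩B t∈)
    T₂⁺-sep {s = s} {t} b∈Z (inj₂ s∈) (inj₁ refl) h = contradiction
      (subst (Z ∋_) (solve 2 (λ s t → (s :- t) :+ t ⊜ s) refl s t) (Subgroup.+-mem Z h b∈Z)) (T₂∩B s∈)
    T₂⁺-sep b∈Z (inj₂ s∈) (inj₂ t∈) h = T₂-sep s∈ t∈ h

    -- A bundle of parallel cosets of L, one displaced by b and one by each chain generator. Through
    -- such bundles the elements of `T₂` become visible to automorphisms.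
    Fat : A → Subgroup → A → A → Set
    Fat a L b d = ∃[ t ] T₂⁺ b t × L ∋ d - (a + t)

    Core Hor Ver Diag Anti S : A → Set
    Core x = T₁ x × x ≢ 0#
    Hor    = coset (Line 1ℤ 0ℤ ∋_) e₁
    Ver    = coset (Line 0ℤ 1ℤ ∋_) e₂
    Diag   = Fat (e₁ + e₂) (Line 1ℤ 1ℤ) 0#
    -- The displacement z₁ is chosen because z₁ and z₂ differ by an element of this line: a single
    -- coset later yields translation by z₁ and by z₂.
    Anti   = Fat (e₁ - e₂) (Line 1ℤ -1ℤ) (vec 1ℤ 0ℤ)
    S x    = Core x ⊎ Hor x ⊎ Ver x ⊎ Diag x ⊎ Anti x

    pattern core h = inj₁ h
    pattern hor h  = inj₂ (inj₁ h)
    pattern ver h  = inj₂ (inj₂ (inj₁ h))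
    pattern diag h = inj₂ (inj₂ (inj₂ (inj₁ h)))
    pattern anti h = inj₂ (inj₂ (inj₂ (inj₂ h)))

    core-layer : Core ⊆ Layer 0ℤ 0ℤ
    core-layer (h , _) = layer-K (H⊆K (T₁⊆H h))

    hor-layer : Hor ⊆ Layer 1ℤ 0ℤ
    hor-layer h = layer-shift layer-e₁ (line⊆K 1ℤ 0ℤ h)

    ver-layer : Ver ⊆ Layer 0ℤ 1ℤ
    ver-layer h = layer-shift layer-e₂ (line⊆K 0ℤ 1ℤ h)

    diag-layer : Diag ⊆ Layer 1ℤ 1ℤ
    diag-layer (t , t∈ , h) = layer-shift
      (layer-+ (layer-+ layer-e₁ layer-e₂) (layer-K (T₂⁺⊆K (Subgroup.0-mem Z) t∈))) (line⊆K 1ℤ 1ℤ h)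

    anti-layer : Anti ⊆ Layer 1ℤ -1ℤ
    anti-layer (t , t∈ , h) = layer-shift
      (layer-+ (layer-sub layer-e₁ layer-e₂) (layer-K (T₂⁺⊆K (vec∈Z 1ℤ 0ℤ) t∈))) (line⊆K 1ℤ -1ℤ h)

    -- A union of cosets of K that is disjoint from its negative and contains S outside K; hence S
    -- meets - S only inside K.
    Positive : A → Set
    Positive x = (∃[ v ] Layer 1ℤ v x) ⊎ Layer 0ℤ 1ℤ x

    S-positive : ∀ {x} → S x → Core x ⊎ Positive x
    S-positive (core h) = inj₁ h
    S-positive (hor h)  = inj₂ (inj₁ (0ℤ , hor-layer h))
    S-positive (ver h)  = inj₂ (inj₂ (ver-layer h))
    S-positive (diag h) = inj₂ (inj₁ (1ℤ , diag-layer h))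
    S-positive (anti h) = inj₂ (inj₁ (-1ℤ , anti-layer h))

    positive-∉K : ∀ {x} → Positive x → ¬ Layer 0ℤ 0ℤ x
    positive-∉K (inj₁ (_ , h)) h' = clash₁ p∤1 h h'
    positive-∉K (inj₂ h)       h' = clash₂ p∤1 h h'

    positive-antisym : ∀ {x} → Positive x → ¬ Positive (- x)
    positive-antisym (inj₁ (_ , h)) (inj₁ (_ , h')) = clash₁ p∤-2 (layer-neg h) h'
    positive-antisym (inj₁ (_ , h)) (inj₂ h')       = clash₁ p∤-1 (layer-neg h) h'
    positive-antisym (inj₂ h)       (inj₁ (_ , h')) = clash₁ p∤-1 (layer-neg h) h'
    positive-antisym (inj₂ h)       (inj₂ h')       = clash₂ p∤-2 (layer-neg h) h'

    S∩-S : ∀ {x} → S x → S (- x) → Core x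
    S∩-S h h' with S-positive h | S-positive h'
    ... | inj₁ h | _       = h
    ... | inj₂ h | inj₁ h' = ⊥-elim (positive-∉K h (subst (Layer 0ℤ 0ℤ) (neg-involutive _) (layer-neg (core-layer h'))))
    ... | inj₂ h | inj₂ h' = ⊥-elim (positive-antisym h h')

    core-neg : ∀ {x} → Core x → Core (- x)
    core-neg {x} (h , x≢0) = T₁-neg h , λ eq → x≢0 (trans (sym (neg-involutive x)) (trans (cong -_ eq) neg-0))

    open Invariance S

    inv-T₁ : Inv T₁
    inv-T₁ = inv-insert-0 (inv-resp (λ (h , h') → S∩-S h h') (λ h → core h , core (core-neg h)) (inv-∩ inv-S (inv-neg inv-S)))

    inv-K : Inv (K ∋_)
    inv-K = inv-resp H⊆K K⊆H (inv-subgroup H T₁⊆H T₁-gen inv-T₁)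

    inv-Z×line₁₀ : Inv (Z ∋_) × Inv (Line 1ℤ 0ℤ ∋_)
    inv-Z×line₁₀ = inv-complement Z (Subgroup.mem? (Line 1ℤ 0ℤ)) (⊕-base (Line 1ℤ 0ℤ)) T-gen (rigid₁ S inv-T₁)

    inv-Z : Inv (Z ∋_)
    inv-Z = proj₁ inv-Z×line₁₀

    inv-line₁₀ : Inv (Line 1ℤ 0ℤ ∋_)
    inv-line₁₀ = proj₂ inv-Z×line₁₀

    -- Among the cosets of K other than K itself, e₁ + K is the only one that S meets in a
    -- single coset of Line 1 0.
    Mate : A → Set
    Mate d = K ∋ d × ¬ Line 1ℤ 0ℤ ∋ d

    mated : ∀ {d} a b → ¬ p∣ b → S (d - vec a b) → (S ⊹ Mate) d
    mated {d} a b p∤b h = d - vec a b , h , subst Mate (sym back) (vec∈K a b , ∉line₁₀ a b p∤b)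
      where
      back : d - (d - vec a b) ≡ vec a b
      back = solve 2 (λ d m → d :- (d :- m) ⊜ m) refl d (vec a b)

    slide : ∀ (L : Subgroup) {m d a} → L ∋ m → L ∋ d - a → L ∋ (d - m) - a
    slide L {m} {d} {a} hm h = subst (L ∋_)
      (solve 3 (λ m d a → (d :- a) :- m ⊜ (d :- m) :- a) refl m d a) (Subgroup.minus-mem L h hm)

    inv-hor : Inv Hor
    inv-hor = inv-resp to-hor from-hor
      (inv-∩ (inv-∩ inv-S (inv-¬ inv-K)) (inv-¬ (inv-⊹ inv-S (inv-∩ inv-K (inv-¬ inv-line₁₀)))))
      where
      to-hor : ∀ {d} → (S d × ¬ K ∋ d) × ¬ (S ⊹ Mate) d → Hor d
      to-hor ((core (h , _) , d∉K) , _) = contradiction (H⊆K (T₁⊆H h)) d∉K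
      to-hor ((hor h , _) , _) = h
      to-hor ((ver h , _) , ¬mated) = contradiction
        (mated 0ℤ 1ℤ p∤1 (ver (slide (Line 0ℤ 1ℤ) (⊕-gen trivial) h))) ¬mated
      to-hor ((diag (t , t∈ , h) , _) , ¬mated) = contradiction
        (mated 1ℤ 1ℤ p∤1 (diag (t , t∈ , slide (Line 1ℤ 1ℤ) (⊕-gen trivial) h))) ¬mated
      to-hor ((anti (t , t∈ , h) , _) , ¬mated) = contradiction
        (mated 1ℤ -1ℤ p∤-1 (anti (t , t∈ , slide (Line 1ℤ -1ℤ) (⊕-gen trivial) h))) ¬mated
      unmated : ∀ {d} → Hor d → ¬ (S ⊹ Mate) d
      unmated {d} h (a , a∈S , m∈K , m∉L) = cases a∈S
        where
        a-layer : Layer 1ℤ 0ℤ a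
        a-layer = subst (Layer 1ℤ 0ℤ) (solve 2 (λ d a → d :- (d :- a) ⊜ a) refl d a)
          (layer-sub (hor-layer h) (layer-K m∈K))
        cases : ¬ S a
        cases (core h') = clash₁ p∤1 a-layer (core-layer h')
        cases (hor h')  = m∉L (subst (Line 1ℤ 0ℤ ∋_)
          (solve 3 (λ d a e → (d :- e) :- (a :- e) ⊜ d :- a) refl d a e₁) (Subgroup.minus-mem (Line 1ℤ 0ℤ) h h'))
        cases (ver h')  = clash₁ p∤1 a-layer (ver-layer h')
        cases (diag h') = clash₂ p∤-1 a-layer (diag-layer h')
        cases (anti h') = clash₂ p∤1 a-layer (anti-layer h')
      from-hor : ∀ {d} → Hor d → (S d × ¬ K ∋ d) × ¬ (S ⊹ Mate) d
      from-hor h = (hor h , λ d∈K → clash₁ p∤1 (hor-layer h) (layer-K d∈K)) , unmated h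

    Rest : A → Set
    Rest d = (S d × ¬ K ∋ d) × ¬ Hor d

    inv-Rest : Inv Rest
    inv-Rest = inv-∩ (inv-∩ inv-S (inv-¬ inv-K)) (inv-¬ inv-hor)

    rest : ∀ {d} → Rest d → Ver d ⊎ Diag d ⊎ Anti d
    rest ((core (h , _) , d∉K) , _) = contradiction (H⊆K (T₁⊆H h)) d∉K
    rest ((hor h , _) , ¬h) = contradiction h ¬h
    rest ((inj₂ (inj₂ h) , _) , _) = h

    rest-intro : ∀ {d} → Ver d ⊎ Diag d ⊎ Anti d → Rest d
    rest-intro h = (inj₂ (inj₂ h) , λ d∈K → ∉K h (layer-K d∈K)) , λ h' → ∉hor h (hor-layer h')
      where
      ∉K : ∀ {d} → Ver d ⊎ Diag d ⊎ Anti d → ¬ Layer 0ℤ 0ℤ d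
      ∉K (inj₁ h)        = clash₂ p∤1 (ver-layer h)
      ∉K (inj₂ (inj₁ h)) = clash₁ p∤1 (diag-layer h)
      ∉K (inj₂ (inj₂ h)) = clash₁ p∤1 (anti-layer h)
      ∉hor : ∀ {d} → Ver d ⊎ Diag d ⊎ Anti d → ¬ Layer 1ℤ 0ℤ d
      ∉hor (inj₁ h)        = clash₁ p∤-1 (ver-layer h)
      ∉hor (inj₂ (inj₁ h)) = clash₂ p∤1 (diag-layer h)
      ∉hor (inj₂ (inj₂ h)) = clash₂ p∤-1 (anti-layer h)

    inv-layer : ∀ {P u v a} → P ⊆ Layer u v → P a → Inv P → Inv (Layer u v)
    inv-layer {P} {u} {v} {a} P⊆ a∈P invP = inv-resp
      (λ (b , b∈P , h) → layer-shift (P⊆ b∈P) h)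
      (λ h → a , a∈P , same-layer h (P⊆ a∈P))
      (inv-⊹ invP inv-K)

    hor-e₁ : Hor e₁
    hor-e₁ = subst (Line 1ℤ 0ℤ ∋_) (sym (sub-self e₁)) (Subgroup.0-mem (Line 1ℤ 0ℤ))

    ver-e₂ : Ver e₂
    ver-e₂ = subst (Line 0ℤ 1ℤ ∋_) (sym (sub-self e₂)) (Subgroup.0-mem (Line 0ℤ 1ℤ))

    diag-e₁+e₂ : Diag (e₁ + e₂)
    diag-e₁+e₂ = 0# , inj₁ refl , subst (Line 1ℤ 1ℤ ∋_)
      (solve 1 (λ e → :0 ⊜ e :- (e :+ :0)) refl (e₁ + e₂)) (Subgroup.0-mem (Line 1ℤ 1ℤ))

    inv-layer₁₀ : Inv (Layer 1ℤ 0ℤ)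
    inv-layer₁₀ = inv-layer hor-layer hor-e₁ inv-hor

    -- A step by e₁ leads from the coset of `Ver` to that of `Diag`, still within `Rest`. From
    -- `Diag` or `Anti` it leads to first coordinate 2, where `Rest` has no element.
    inv-ver : Inv Ver
    inv-ver = inv-resp
      (λ { {d} (r , a , a∈R , h) → case rest r of λ
             { (inj₁ v) → v
             ; (inj₂ (inj₁ v)) → ⊥-elim (beyond (rest a∈R) (predecessor d a (diag-layer v) (negated {d - a} h)))
             ; (inj₂ (inj₂ v)) → ⊥-elim (beyond (rest a∈R) (predecessor d a (anti-layer v) (negated {d - a} h))) } })
      (λ {d} h → rest-intro (inj₁ h) , e₁ + e₂ , rest-intro (inj₂ (inj₁ diag-e₁+e₂)) ,
        subst (Layer 1ℤ 0ℤ) (solve 3 (λ a b d → (a :+ b) :- d ⊜ :- (d :- (a :+ b))) refl e₁ e₂ d)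
          (layer-sub (layer-+ layer-e₁ layer-e₂) (ver-layer h)))
      (inv-∩ inv-Rest (inv-⊹ inv-Rest (inv-neg inv-layer₁₀)))
      where
      negated : ∀ {x} → Layer 1ℤ 0ℤ (- x) → Layer -1ℤ 0ℤ x
      negated h = subst (Layer -1ℤ 0ℤ) (neg-involutive _) (layer-neg h)
      predecessor : ∀ {v} d a → Layer 1ℤ v d → Layer -1ℤ 0ℤ (d - a) → ∃[ w ] Layer (pos 2) w a
      predecessor d a h h' = _ , subst (Layer _ _) (solve 2 (λ d a → d :- (d :- a) ⊜ a) refl d a) (layer-sub h h')
      beyond : ∀ {a} → Ver a ⊎ Diag a ⊎ Anti a → ¬ (∃[ w ] Layer (pos 2) w a)
      beyond (inj₁ h)        (_ , h') = clash₁ p∤2 h' (ver-layer h)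
      beyond (inj₂ (inj₁ h)) (_ , h') = clash₁ p∤1 h' (diag-layer h)
      beyond (inj₂ (inj₂ h)) (_ , h') = clash₁ p∤1 h' (anti-layer h)

    -- Of the three pieces of `Rest`, only `Diag` lies in the sum of the layers of `Hor` and `Ver`.
    inv-diag : Inv Diag
    inv-diag = inv-resp
      (λ { {d} (r , a , a∈ , h) → case rest r of λ
             { (inj₁ v) → ⊥-elim (clash₁ p∤-1 (ver-layer v) (total d a a∈ h))
             ; (inj₂ (inj₁ v)) → v
             ; (inj₂ (inj₂ v)) → ⊥-elim (clash₂ p∤-2 (anti-layer v) (total d a a∈ h)) } })
      (λ {d} h → rest-intro (inj₂ (inj₁ h)) , e₁ , layer-e₁ , layer-sub (diag-layer h) layer-e₁)
      (inv-∩ inv-Rest (inv-⊹ inv-layer₁₀ (inv-layer ver-layer ver-e₂ inv-ver)))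
      where
      total : ∀ d a → Layer 1ℤ 0ℤ a → Layer 0ℤ 1ℤ (d - a) → Layer 1ℤ 1ℤ d
      total d a h h' = subst (Layer 1ℤ 1ℤ) (solve 2 (λ d a → a :+ (d :- a) ⊜ d) refl d a) (layer-+ h h')

    inv-anti : Inv Anti
    inv-anti = inv-resp
      (λ ((r , ¬v) , ¬d) → case rest r of λ
         { (inj₁ v) → contradiction v ¬v ; (inj₂ (inj₁ d)) → contradiction d ¬d ; (inj₂ (inj₂ a)) → a })
      (λ h → (rest-intro (inj₂ (inj₂ h)) , λ v → clash₁ p∤1 (anti-layer h) (ver-layer v))
           , λ d → clash₂ p∤-2 (anti-layer h) (diag-layer d))
      (inv-∩ (inv-∩ inv-Rest (inv-¬ inv-ver)) (inv-¬ inv-diag))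

    inv-coset-+ : ∀ (C D E : Subgroup) {a b} → (C ∋_) ⊆ (E ∋_) → (D ∋_) ⊆ (E ∋_) →
      (∀ {x} → E ∋ x → ∃[ y ] C ∋ y × D ∋ x - y) →
      Inv (coset (C ∋_) a) → Inv (coset (D ∋_) b) → Inv (coset (E ∋_) (a + b))
    inv-coset-+ C D E {a} {b} C⊆E D⊆E split invC invD = inv-resp
      (λ {d} (x , hx , hd) → subst (E ∋_)
        (solve 4 (λ d x a b → (x :- a) :+ ((d :- x) :- b) ⊜ d :- (a :+ b)) refl d x a b)
        (Subgroup.+-mem E (C⊆E hx) (D⊆E hd)))
      (λ {d} h → let (y , hy , hxy) = split h in
        a + y , subst (C ∋_) (solve 2 (λ a y → y ⊜ (a :+ y) :- a) refl a y) hy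
        , subst (D ∋_) (solve 4 (λ d y a b → (d :- (a :+ b)) :- y ⊜ (d :- (a :+ y)) :- b) refl d y a b) hxy)
      (inv-⊹ invC invD)

    split-self : ∀ (C : Subgroup) {x} → C ∋ x → ∃[ y ] C ∋ y × C ∋ x - y
    split-self C {x} h = x , h , subst (C ∋_) (sym (sub-self x)) (Subgroup.0-mem C)

    split-Z : ∀ {x} → Z ∋ x → ∃[ y ] Line 1ℤ 0ℤ ∋ y × Line 0ℤ 1ℤ ∋ x - y
    split-Z {x} (j , h) = _ , h , subst (Line 0ℤ 1ℤ ∋_)
      (solve 2 (λ x w → w ⊜ x :- (x :- w)) refl x (j • vec 0ℤ 1ℤ)) (multiples j (vec 0ℤ 1ℤ))

    inv-Z+e₁+e₂ : Inv (coset (Z ∋_) (e₁ + e₂))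
    inv-Z+e₁+e₂ = inv-coset-+ (Line 1ℤ 0ℤ) (Line 0ℤ 1ℤ) Z (line⊆Z 1ℤ 0ℤ) (line⊆Z 0ℤ 1ℤ) split-Z inv-hor inv-ver

    inv-Z+e₁-e₂ : Inv (coset (Z ∋_) (e₁ - e₂))
    inv-Z+e₁-e₂ = inv-coset-+ (Line 1ℤ 0ℤ) (Line 0ℤ 1ℤ) Z (line⊆Z 1ℤ 0ℤ) (line⊆Z 0ℤ 1ℤ) split-Z
      inv-hor (inv-coset-neg (Line 0ℤ 1ℤ) inv-ver)

    -- The coset e₁ + e₂ + Z is invariant, being `Hor` plus `Ver`. Subtracting it from `Diag` leaves
    -- the chain generators up to Z, the form that `rigid₂` accepts once Z itself is removed.
    inv-T₂⁺Z : Inv (λ d → ∃[ t ] T₂⁺ 0# t × Z ∋ d - t)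
    inv-T₂⁺Z = inv-resp
      (λ {d} (a , (t , t∈ , h) , h') → t , t∈ , subst (Z ∋_)
        (solve 4 (λ d a e t → (a :- (e :+ t)) :+ ((d :- a) :- :- e) ⊜ d :- t) refl d a (e₁ + e₂) t)
        (Subgroup.+-mem Z (line⊆Z 1ℤ 1ℤ h) h'))
      (λ {d} (t , t∈ , h) → (e₁ + e₂) + t
        , (t , t∈ , subst (Line 1ℤ 1ℤ ∋_) (sym (sub-self _)) (Subgroup.0-mem (Line 1ℤ 1ℤ)))
        , subst (Z ∋_) (solve 3 (λ d e t → d :- t ⊜ (d :- (e :+ t)) :- :- e) refl d (e₁ + e₂) t) h)
      (inv-⊹ inv-diag (inv-coset-neg Z inv-Z+e₁+e₂))

    inv-T₂Z : Inv (λ d → ∃[ t ] T₂ t × Z ∋ d - t)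
    inv-T₂Z = inv-resp
      (λ { {d} ((t , inj₁ refl , h) , d∉Z) → contradiction (subst (Z ∋_) (sub-0 d) h) d∉Z
         ; ((t , inj₂ t∈ , h) , _) → t , t∈ , h })
      (λ {d} (t , t∈ , h) → (t , inj₂ t∈ , h) , λ d∈Z → T₂∩B t∈
        (subst (Z ∋_) (solve 2 (λ d t → d :- (d :- t) ⊜ t) refl d t) (Subgroup.minus-mem Z d∈Z h)))
      (inv-∩ inv-T₂⁺Z (inv-¬ inv-Z))

    inv-Z+ : ∀ {b t} → Z ∋ b → T₂⁺ b t → Inv (coset (Z ∋_) t)
    inv-Z+ b∈Z (inj₁ refl) = inv-coset-self Z b∈Z inv-Z
    inv-Z+ b∈Z (inj₂ t∈)   = rigid₂ S Z id inv-T₁ inv-T₂Z t∈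

    -- The displacements in a bundle are distinct modulo Z, so intersecting it with a + t + Z
    -- isolates the one coset of L belonging to t.
    inv-fat : ∀ (L : Subgroup) {a b t} → (L ∋_) ⊆ (Z ∋_) → Z ∋ b → Inv (coset (Z ∋_) a) → Inv (Fat a L b) →
      T₂⁺ b t → Inv (coset (L ∋_) (a + t))
    inv-fat L {a} {b} {t} L⊆Z b∈Z invZ invFat t∈ = inv-resp
      (λ {d} ((s , s∈ , h) , h') → subst (λ w → L ∋ d - (a + w))
        (T₂⁺-sep b∈Z s∈ t∈ (subst (Z ∋_)
          (solve 4 (λ d a s t → (d :- (a :+ t)) :- (d :- (a :+ s)) ⊜ s :- t) refl d a s t)
          (Subgroup.minus-mem Z h' (L⊆Z h)))) h)
      (λ h → (t , t∈ , h) , L⊆Z h)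
      (inv-∩ invFat (inv-coset-+ Z Z Z id id (split-self Z) invZ (inv-Z+ b∈Z t∈)))

    inv-diag-line : ∀ {t} → T₂⁺ 0# t → Inv (coset (Line 1ℤ 1ℤ ∋_) ((e₁ + e₂) + t))
    inv-diag-line = inv-fat (Line 1ℤ 1ℤ) (line⊆Z 1ℤ 1ℤ) (Subgroup.0-mem Z) inv-Z+e₁+e₂ inv-diag

    inv-anti-line : ∀ {t} → T₂⁺ (vec 1ℤ 0ℤ) t → Inv (coset (Line 1ℤ -1ℤ ∋_) ((e₁ - e₂) + t))
    inv-anti-line = inv-fat (Line 1ℤ -1ℤ) (line⊆Z 1ℤ -1ℤ) (vec∈Z 1ℤ 0ℤ) inv-Z+e₁-e₂ inv-anti

    inv-line₀₁ : Inv (Line 0ℤ 1ℤ ∋_)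
    inv-line₀₁ = inv-resp (λ {d} → subst (Line 0ℤ 1ℤ ∋_) (shift d)) (λ {d} → subst (Line 0ℤ 1ℤ ∋_) (sym (shift d)))
      (inv-coset-+ (Line 0ℤ 1ℤ) (Line 0ℤ 1ℤ) (Line 0ℤ 1ℤ) id id (split-self (Line 0ℤ 1ℤ))
        inv-ver (inv-coset-neg (Line 0ℤ 1ℤ) inv-ver))
      where
      shift : ∀ d → d - (e₂ - e₂) ≡ d
      shift d = solve 2 (λ d e → d :- (e :- e) ⊜ d) refl d e₂

    module _ (α : Automorphism S) (fix-0 : to α 0# ≡ 0#) (fix-e₁ : to α e₁ ≡ e₁) where
      Fixed : A → Set
      Fixed x = to α x ≡ x

      Square : A → Set
      Square x = Fixed x × Fixed (x + e₁) × Fixed (x + e₂) × Fixed (x + (e₁ + e₂))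

      -- The far corner x + e₁ + e₂ is reached along direction (1, 1) from x and along (0, 1) from x
      -- + e₁. The last corner is then pinned by x and the far corner.
      square₁ : ∀ {x} → Fixed x → Fixed (x + e₁) → Square x
      square₁ {x} h h₁ = h , h₁
        , pin α (Line 0ℤ 1ℤ) (Line 1ℤ 0ℤ) inv-ver (inv-coset-neg (Line 1ℤ 0ℤ) inv-hor) (line-meet 0ℤ 1ℤ 1ℤ 0ℤ p∤-1) h h₁₂
            refl (solve 3 (λ x a b → (x :+ (a :+ b)) :+ :- a ⊜ x :+ b) refl x e₁ e₂)
        , h₁₂
        where
        h₁₂ : Fixed (x + (e₁ + e₂))
        h₁₂ = pin α (Line 1ℤ 1ℤ) (Line 0ℤ 1ℤ) (inv-diag-line (inj₁ refl)) inv-ver (line-meet 1ℤ 1ℤ 0ℤ 1ℤ p∤1) h h₁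
          (cong (x +_) (+-identityʳ (e₁ + e₂))) (solve 3 (λ x a b → (x :+ a) :+ b ⊜ x :+ (a :+ b)) refl x e₁ e₂)

      square₂ : ∀ {x} → Fixed x → Fixed (x + e₂) → Square x
      square₂ {x} h h₂ = square₁ h
        (pin α (Line 1ℤ 0ℤ) (Line 0ℤ 1ℤ) inv-hor (inv-coset-neg (Line 0ℤ 1ℤ) inv-ver) (line-meet 1ℤ 0ℤ 0ℤ 1ℤ p∤1) h h₁₂
          refl (solve 3 (λ x a b → (x :+ (a :+ b)) :+ :- b ⊜ x :+ a) refl x e₁ e₂))
        where
        h₁₂ : Fixed (x + (e₁ + e₂))
        h₁₂ = pin α (Line 1ℤ 1ℤ) (Line 1ℤ 0ℤ) (inv-diag-line (inj₁ refl)) inv-hor (line-meet 1ℤ 1ℤ 1ℤ 0ℤ p∤-1) h h₂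
          (cong (x +_) (+-identityʳ (e₁ + e₂))) (solve 3 (λ x a b → (x :+ b) :+ a ⊜ x :+ (a :+ b)) refl x e₁ e₂)

      -- Neighbouring squares share a side, and by `square₁` and `square₂` a fixed side of either
      -- kind makes its whole square fixed.
      closed-e₁ : Closed Square e₁
      closed-e₁ {x} (_ , h₁ , _ , h₁₂) = square₂ h₁
        (subst Fixed (solve 3 (λ x a b → x :+ (a :+ b) ⊜ (x :+ a) :+ b) refl x e₁ e₂) h₁₂)

      closed-e₂ : Closed Square e₂
      closed-e₂ {x} (_ , _ , h₂ , h₁₂) = square₁ h₂
        (subst Fixed (solve 3 (λ x a b → x :+ (a :+ b) ⊜ (x :+ b) :+ a) refl x e₁ e₂) h₁₂)

      closed-if-fixed : ∀ {g} → (∀ {x} → Square x → Fixed (x + g)) → Closed Square g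
      closed-if-fixed {g} fixed {x} h = square₁ (fixed h)
        (subst Fixed (solve 3 (λ x a g → (x :+ a) :+ g ⊜ (x :+ g) :+ a) refl x e₁ g) (fixed (closed-e₁ h)))

      closed-cancel : ∀ {g} h → Closed Square h → Closed Square (h + g) → Closed Square g
      closed-cancel {g} h closed-h closed-hg = subst (Closed Square)
        (solve 2 (λ h g → (h :+ g) :+ (-1ℤ :• h) ⊜ g) refl h g) (closed-+ {Square} closed-hg (closed-• {Square} -1ℤ closed-h))

      -- x + e₁ + z₁ is seen from x + e₂ along the line of `Anti` and from x + e₁ along ⟨ z₁ ⟩. The
      -- translation by e₁ is cancelled afterwards.
      closed-vec₁₀ : Closed Square (vec 1ℤ 0ℤ)
      closed-vec₁₀ = closed-cancel e₁ closed-e₁ (closed-if-fixed (λ {x} (_ , h₁ , h₂ , _) →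
        pin α (Line 1ℤ -1ℤ) (Line 1ℤ 0ℤ) (inv-anti-line (inj₁ refl))
          (inv-coset-self (Line 1ℤ 0ℤ) (⊕-gen trivial) inv-line₁₀) (line-meet 1ℤ -1ℤ 1ℤ 0ℤ p∤1) h₂ h₁
          (solve 4 (λ x a b z → (x :+ b) :+ ((a :- b) :+ z) ⊜ x :+ (a :+ z)) refl x e₁ e₂ (vec 1ℤ 0ℤ))
          (solve 3 (λ x a z → (x :+ a) :+ z ⊜ x :+ (a :+ z)) refl x e₁ (vec 1ℤ 0ℤ))))

      closed-vec₀₁ : Closed Square (vec 0ℤ 1ℤ)
      closed-vec₀₁ = closed-cancel e₁ closed-e₁ (closed-if-fixed (λ {x} (_ , h₁ , h₂ , _) →
        pin α (Line 1ℤ -1ℤ) (Line 0ℤ 1ℤ) inv-anti-line₀₁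
          (inv-coset-self (Line 0ℤ 1ℤ) (⊕-gen trivial) inv-line₀₁) (line-meet 1ℤ -1ℤ 0ℤ 1ℤ p∤1) h₂ h₁
          (solve 4 (λ x a b z → (x :+ b) :+ ((a :- b) :+ z) ⊜ x :+ (a :+ z)) refl x e₁ e₂ (vec 0ℤ 1ℤ))
          (solve 3 (λ x a z → (x :+ a) :+ z ⊜ x :+ (a :+ z)) refl x e₁ (vec 0ℤ 1ℤ))))
        where
        toggle : ∀ d → (d - ((e₁ - e₂) + vec 1ℤ 0ℤ)) + vec 1ℤ -1ℤ ≡ d - ((e₁ - e₂) + vec 0ℤ 1ℤ)
        toggle d = solve 4 (λ d e z w →
          (d :- (e :+ (1ℤ :• z :+ 0ℤ :• w))) :+ (1ℤ :• z :+ -1ℤ :• w) ⊜ d :- (e :+ (0ℤ :• z :+ 1ℤ :• w))) refl d (e₁ - e₂) z₁ z₂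
        inv-anti-line₀₁ : Inv (coset (Line 1ℤ -1ℤ ∋_) ((e₁ - e₂) + vec 0ℤ 1ℤ))
        inv-anti-line₀₁ = inv-resp
          (λ {d} h → subst (Line 1ℤ -1ℤ ∋_) (toggle d) (Subgroup.+-mem (Line 1ℤ -1ℤ) h (⊕-gen trivial)))
          (λ {d} h → Subgroup.cancelʳ (Line 1ℤ -1ℤ) (⊕-gen trivial) (subst (Line 1ℤ -1ℤ ∋_) (sym (toggle d)) h))
          (inv-anti-line (inj₁ refl))

      -- x + e₁ + e₂ + t is seen from x through `Diag` and from x + 2 e₂ through `Anti`. The two
      -- directions have determinant -2, nonzero as p is odd.
      closed-T₂ : ∀ {t} → T₂ t → Closed Square t
      closed-T₂ {t} t∈ = closed-cancel (e₁ + e₂) (closed-+ {Square} closed-e₁ closed-e₂) (closed-if-fixed (λ {x} h →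
        pin α (Line 1ℤ 1ℤ) (Line 1ℤ -1ℤ) (inv-diag-line (inj₂ t∈)) (inv-anti-line (inj₂ t∈)) (line-meet 1ℤ 1ℤ 1ℤ -1ℤ p∤-2)
          (proj₁ h) (proj₁ (closed-e₂ (closed-e₂ h))) refl
          (solve 4 (λ x a b t → ((x :+ b) :+ b) :+ ((a :- b) :+ t) ⊜ x :+ ((a :+ b) :+ t)) refl x e₁ e₂ t)))

      closed-Z : (Z ∋_) ⊆ Closed Square
      closed-Z {z} (j , h) = let (i , eq) = as-multiple h in subst (Closed Square)
        (trans (cong (_+ j • vec 0ℤ 1ℤ) (sym eq)) (solve 2 (λ z w → (z :- w) :+ w ⊜ z) refl z (j • vec 0ℤ 1ℤ)))
        (closed-+ {Square} (closed-• {Square} i closed-vec₁₀) (closed-• {Square} j closed-vec₀₁))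

      closed-all : ∀ x → Closed Square x
      closed-all x = let (u , v , h) = coordinates x in subst (Closed Square)
        (solve 2 (λ x w → w :+ (x :- w) ⊜ x) refl x (combo u v))
        (closed-+ {Square} (closed-+ {Square} (closed-• {Square} u closed-e₁) (closed-• {Square} v closed-e₂))
          (closed-gen {Square} [ closed-Z , closed-T₂ ]′ (T₂-gen (K⊆H h))))

      all-fixed : ∀ x → Fixed x
      all-fixed x = subst Fixed (solve 1 (λ x → :0 :+ x ⊜ x) refl x)
        (proj₁ (closed-all x (square₁ fix-0 (subst Fixed (solve 1 (λ e → e ⊜ :0 :+ e) refl e₁) fix-e₁))))

    σ-e₁-line : ∀ i → σ i e₁ ≡ e₁ + i • z₁
    σ-e₁-line i = trans (σ-e₁ i) (cong (e₁ +_)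
      (trans (cong (λ d → i • z₁ + d • z₂) (cong (ℤ._* (half ℤ.* (i ℤ.* (i ℤ.- 1ℤ)))) c≡0)) (+-identityʳ _)))

    σ-orbit : ∀ (α : Automorphism S) → to α 0# ≡ 0# → ∃[ i ] to α e₁ ≡ σ i e₁
    σ-orbit α fix-0 = i , (begin
        to α e₁                                  ≡⟨ solve 2 (λ a e → a ⊜ e :+ ((a :- :0) :- e)) refl (to α e₁) e₁ ⟩
        e₁ + ((to α e₁ - 0#) - e₁)               ≡⟨ cong (λ w → e₁ + ((to α e₁ - w) - e₁)) (sym fix-0) ⟩
        e₁ + ((to α e₁ - to α 0#) - e₁)          ≡⟨ cong (e₁ +_) (proj₂ multiple) ⟩
        e₁ + i • vec 1ℤ 0ℤ                       ≡⟨ cong (λ w → e₁ + i • w) (solve 2 (λ a b → 1ℤ :• a :+ 0ℤ :• b ⊜ a) refl z₁ z₂) ⟩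
        e₁ + i • z₁                              ≡⟨ sym (σ-e₁-line i) ⟩
        σ i e₁                                   ∎)
      where
      open ≡-Reasoning
      multiple : ∃[ i ] (to α e₁ - to α 0#) - e₁ ≡ i • vec 1ℤ 0ℤ
      multiple = as-multiple (preserve inv-hor α 0# e₁ (subst Hor (sym (sub-0 e₁)) hor-e₁))
      i : ℤ
      i = proj₁ multiple

    σ-e₁-moves : ∀ i → σ i e₁ - e₁ ≡ i • z₁
    σ-e₁-moves i = trans (cong (_- e₁) (σ-e₁-line i)) (solve 2 (λ e z → (e :+ z) :- e ⊜ z) refl e₁ (i • z₁))

    -- Elements of e₁ + s e₂ + K move in the direction z₁ + s z₂. This dictates the lines used in
    -- `Diag` (s = 1) and `Anti` (s = -1).
    σ-fat : ∀ i s {t} → K ∋ t → σ i ((e₁ + s • e₂) + t) - ((e₁ + s • e₂) + t) ≡ i • vec 1ℤ s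
    σ-fat i s {t} t∈K = begin
        σ i ((e₁ + s • e₂) + t) - ((e₁ + s • e₂) + t)
          ≡⟨ cong (_- ((e₁ + s • e₂) + t)) (trans (σ-+ i _ t) (cong₂ _+_ (trans (σ-+ i e₁ (s • e₂)) (cong (σ i e₁ +_) (σ-• s))) (σ-K i t∈K))) ⟩
        ((σ i e₁ + s • σ i e₂) + t) - ((e₁ + s • e₂) + t)
          ≡⟨ solve 5 (λ a b c d t → ((a :+ b) :+ t) :- ((c :+ d) :+ t) ⊜ (a :- c) :+ (b :- d)) refl (σ i e₁) (s • σ i e₂) e₁ (s • e₂) t ⟩
        (σ i e₁ - e₁) + (s • σ i e₂ - s • e₂)
          ≡⟨ cong₂ _+_ (σ-e₁-moves i) (trans (sym (•-minus s _ _)) (cong (s •_) (σ-e₂-moves i))) ⟩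
        i • z₁ + s • (i • z₂)
          ≡⟨ cong₂ _+_ (cong (i •_) (sym (1-• z₁))) (trans (sym (•-• s i z₂)) (trans (cong (_• z₂) (ℤ.*-comm s i)) (•-• i s z₂))) ⟩
        i • (1ℤ • z₁) + i • (s • z₂)
          ≡⟨ sym (•-distrib i _ _) ⟩
        i • vec 1ℤ s  ∎
      where
      open ≡-Reasoning
      •-minus : ∀ s x y → s • (x - y) ≡ s • x - s • y
      •-minus s x y = trans (•-distrib s x (- y)) (cong (s • x +_)
        (neg-unique _ _ (trans (sym (•-distrib s y (- y))) (trans (cong (s •_) (sub-self y)) (•-0# s)))))
      σ-pow : ∀ k → σ i (pow G e₂ k) ≡ pow G (σ i e₂) k
      σ-pow zero    = σ-K i (Subgroup.0-mem K)
      σ-pow (suc k) = trans (σ-+ i e₂ (pow G e₂ k)) (cong (σ i e₂ +_) (σ-pow k))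
      σ-• : ∀ s → σ i (s • e₂) ≡ s • σ i e₂
      σ-• (pos k)  = σ-pow k
      σ-• -[1+ k ] = trans (σ-neg i (pow G e₂ (suc k))) (cong -_ (σ-pow (suc k)))

    σ-S : ∀ i {x} → S x → S (σ i x)
    σ-S i (core (h , x≢0)) = core (subst Core (sym (σ-K i (H⊆K (T₁⊆H h)))) (h , x≢0))
    σ-S i (hor h) = hor (σ-coset (Line 1ℤ 0ℤ) i (line⊆K 1ℤ 0ℤ)
      (subst (Line 1ℤ 0ℤ ∋_) (trans (cong (i •_) (solve 2 (λ a b → 1ℤ :• a :+ 0ℤ :• b ⊜ a) refl z₁ z₂)) (sym (σ-e₁-moves i)))
        (multiples i (vec 1ℤ 0ℤ))) h)
    σ-S i (ver h) = ver (σ-coset (Line 0ℤ 1ℤ) i (line⊆K 0ℤ 1ℤ)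
      (subst (Line 0ℤ 1ℤ ∋_) (trans (cong (i •_) (solve 2 (λ a b → 0ℤ :• a :+ 1ℤ :• b ⊜ b) refl z₁ z₂)) (sym (σ-e₂-moves i)))
        (multiples i (vec 0ℤ 1ℤ))) h)
    σ-S i (diag (t , t∈ , h)) = diag (t , t∈ , σ-coset (Line 1ℤ 1ℤ) i (line⊆K 1ℤ 1ℤ)
      (subst (λ w → Line 1ℤ 1ℤ ∋ σ i ((e₁ + w) + t) - ((e₁ + w) + t)) (1-• e₂)
        (subst (Line 1ℤ 1ℤ ∋_) (sym (σ-fat i 1ℤ (T₂⁺⊆K (Subgroup.0-mem Z) t∈))) (multiples i (vec 1ℤ 1ℤ)))) h)
    σ-S i (anti (t , t∈ , h)) = anti (t , t∈ , σ-coset (Line 1ℤ -1ℤ) i (line⊆K 1ℤ -1ℤ)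
      (subst (λ w → Line 1ℤ -1ℤ ∋ σ i ((e₁ + w) + t) - ((e₁ + w) + t)) (cong -_ (1-• e₂))
        (subst (Line 1ℤ -1ℤ ∋_) (sym (σ-fat i -1ℤ (T₂⁺⊆K (vec∈Z 1ℤ 0ℤ) t∈))) (multiples i (vec 1ℤ -1ℤ)))) h)

    S? : ∀ x → Dec (S x)
    S? x = (T₁? x ×-dec ¬? (x ≟ 0#)) ⊎-dec
           (Subgroup.mem? (Line 1ℤ 0ℤ) (x - e₁) ⊎-dec
           (Subgroup.mem? (Line 0ℤ 1ℤ) (x - e₂) ⊎-dec
           (any? (λ t → ((t ≟ 0#) ⊎-dec T₂? t) ×-dec Subgroup.mem? (Line 1ℤ 1ℤ) (x - ((e₁ + e₂) + t))) ⊎-dec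
            any? (λ t → ((t ≟ vec 1ℤ 0ℤ) ⊎-dec T₂? t) ×-dec Subgroup.mem? (Line 1ℤ -1ℤ) (x - ((e₁ - e₂) + t))))))

    connectionSet : RigidConnectionSet
    connectionSet = record
      { S = S
      ; S? = S?
      ; 0∉S = λ h → case S-positive h of λ
          { (inj₁ (_ , 0≢0)) → 0≢0 refl ; (inj₂ h') → positive-∉K h' (layer-K (Subgroup.0-mem K)) }
      ; e₁∈S = hor hor-e₁
      ; -e₁∉S = λ h → clash₁ p∤1 layer-e₁ (core-layer (S∩-S (hor hor-e₁) h))
      ; S-σ = σ-S
      ; orbit = σ-orbit
      ; rigid = all-fixed }

  rigidConnectionSet : RigidConnectionSet
  rigidConnectionSet = Connection.connectionSet (proj₁ chain) (proj₂ chain)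

-- The case of z₁ = e₂: the orbit of e₁ is a parabola.

module JordanCase (G : FinGroup) (comm : IsAbelian G)
                  (p : ℕ) (isPrime : Prime p) (odd : ¬ (2 ∣ p))
                  (F : Frames.Frame G comm p isPrime odd)
                  (c≡1 : Frames.Frame.c F ≡ 1ℤ) (z₁≡e₂ : Frames.Frame.z₁ F ≡ Frames.Frame.e₂ F) where
  open Conclusion G comm p isPrime odd F
  open Automorphism

  -- The parabola e₁ + j e₂ + (j (j - 1) / 2) z₂, with the division taken modulo p. It has exactly
  -- one point in each coset j e₂ + e₁ + K.
  y : ℤ → A
  y j = σ j e₁

  y-cong : ∀ {i j} → i ≈ j → y i ≡ y j
  y-cong = σ-cong e₁

  y-layer : ∀ j → Layer 1ℤ j (y j)
  y-layer j = layer-resp ≈-refl (≈-reflexive (trans (cong (λ d → 0ℤ ℤ.+ d ℤ.* (j ℤ.* 1ℤ)) c≡1) (simplify j))) (layer-σ j layer-e₁)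
    where
    simplify : ∀ j → 0ℤ ℤ.+ 1ℤ ℤ.* (j ℤ.* 1ℤ) ≡ j
    simplify = solve-∀

  y-index : ∀ i {u j} → Layer u j (y i) → i ≈ j
  y-index i (_ , h) = ≈-trans (≈-sym (proj₂ (y-layer i))) h

  y-mod-K : ∀ i j → K ∋ y i - y j → y i ≡ y j
  y-mod-K i j h = y-cong (y-index i (layer-shift (y-layer j) h))

  y-0 : y 0ℤ ≡ e₁
  y-0 = σ-0 e₁

  y-step : ∀ k → y (k ℤ.+ 1ℤ) ≡ y k + (e₂ + k • z₂)
  y-step k = begin
    y (k ℤ.+ 1ℤ)                 ≡⟨ sym (σ-σ k 1ℤ e₁) ⟩
    σ k (σ 1ℤ e₁)                ≡⟨ cong (σ k) σ₁-e₁ ⟩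
    σ k (e₁ + e₂)                ≡⟨ σ-+ k e₁ e₂ ⟩
    y k + σ k e₂                 ≡⟨ cong (y k +_) (σ-e₂ k) ⟩
    y k + (e₂ + k • z₂)          ∎
    where
    open ≡-Reasoning
    quad-1 : ∀ c h → c ℤ.* (h ℤ.* (1ℤ ℤ.* (1ℤ ℤ.- 1ℤ))) ≡ 0ℤ
    quad-1 = solve-∀
    σ₁-e₁ : σ 1ℤ e₁ ≡ e₁ + e₂
    σ₁-e₁ = trans (σ-e₁ 1ℤ) (cong (e₁ +_) (trans (cong₂ _+_ (trans (1-• z₁) z₁≡e₂) (cong (_• z₂) (quad-1 c half))) (+-identityʳ e₂)))

  y-1 : y 1ℤ ≡ y 0ℤ + e₂
  y-1 = trans (y-step 0ℤ) (cong (y 0ℤ +_) (+-identityʳ e₂))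

  y-2 : y (pos 2) ≡ y 0ℤ + (e₂ + (e₂ + z₂))
  y-2 = trans (y-step 1ℤ) (trans (cong₂ (λ a b → a + (e₂ + b)) y-1 (1-• z₂))
    (solve 3 (λ y e z → (y :+ e) :+ (e :+ z) ⊜ y :+ (e :+ (e :+ z))) refl (y 0ℤ) e₂ z₂))

  chain : Σ[ C ∈ Chain K ⟨ z₂ ⟩ (⟨ z₂ ⟩ ∋_) ] (K ∋_) ⊆ (Chain.H C ∋_)
  chain = full-chain (base-chain K ⟨ z₂ ⟩ ⟨z₂⟩⊆K (Subgroup.mem? ⟨ z₂ ⟩) id (Subgroup.neg-mem ⟨ z₂ ⟩) gen)

  module Connection (C : Chain K ⟨ z₂ ⟩ (⟨ z₂ ⟩ ∋_)) (K⊆H : (K ∋_) ⊆ (Chain.H C ∋_)) where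
    open Chain C

    T₂⁺ : A → Set
    T₂⁺ t = t ≡ 0# ⊎ T₂ t

    T₂⁺? : ∀ t → Dec (T₂⁺ t)
    T₂⁺? t = (t ≟ 0#) ⊎-dec T₂? t

    T₂⁺-sep : ∀ {s t} → T₂⁺ s → T₂⁺ t → ⟨ z₂ ⟩ ∋ s - t → s ≡ t
    T₂⁺-sep (inj₁ refl) (inj₁ refl) h = refl
    T₂⁺-sep {t = t} (inj₁ refl) (inj₂ t∈) h = contradiction
      (subst (⟨ z₂ ⟩ ∋_) (solve 1 (λ t → :- (:0 :- t) ⊜ t) refl t) (Subgroup.neg-mem ⟨ z₂ ⟩ h)) (T₂∩B t∈)
    T₂⁺-sep {s} (inj₂ s∈) (inj₁ refl) h = contradiction (subst (⟨ z₂ ⟩ ∋_) (sub-0 s) h) (T₂∩B s∈)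
    T₂⁺-sep (inj₂ s∈) (inj₂ t∈) h = T₂-sep s∈ t∈ h

    Core Ver Orb Ret S : A → Set
    Core x = T₁ x × x ≢ 0#
    Ver    = coset (⟨ z₂ ⟩ ∋_) e₂
    Orb x  = ∃[ j ] x ≡ y j
    -- This fills the cosets of K opposite to `Orb`, leaving out the points - y j + t with t in
    -- `T₂⁺`. Leaving out t = 0 keeps S antisymmetric; leaving out the other t records the chain
    -- generators.
    Ret x  = ∃[ j ] K ∋ x + y j × ¬ T₂⁺ (x + y j)
    S x    = Core x ⊎ Ver x ⊎ Orb x ⊎ Ret x

    pattern core h = inj₁ h
    pattern ver h  = inj₂ (inj₁ h)
    pattern orb h  = inj₂ (inj₂ (inj₁ h))
    pattern ret h  = inj₂ (inj₂ (inj₂ h))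

    core-layer : Core ⊆ Layer 0ℤ 0ℤ
    core-layer (h , _) = layer-K (H⊆K (T₁⊆H h))

    ver-layer : Ver ⊆ Layer 0ℤ 1ℤ
    ver-layer h = layer-shift layer-e₂ (⟨z₂⟩⊆K h)

    orb-layer : ∀ {x} → ((j , _) : Orb x) → Layer 1ℤ j x
    orb-layer (j , refl) = y-layer j

    ret-layer : ∀ {x} → ((j , _) : Ret x) → Layer -1ℤ (ℤ.- j) x
    ret-layer {x} (j , h , _) = layer-shift (layer-neg (y-layer j))
      (subst (K ∋_) (solve 2 (λ x y → x :+ y ⊜ x :- :- y) refl x (y j)) h)

    orb-ret : ∀ {x} → Orb x → ¬ Ret (- x)
    orb-ret (j , refl) (i , h , ∉T₂⁺) = ∉T₂⁺ (inj₁ (trans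
      (cong (- y j +_) (y-mod-K i j (subst (K ∋_) (solve 2 (λ a b → :- a :+ b ⊜ b :- a) refl (y j) (y i)) h)))
      (solve 1 (λ a → :- a :+ a ⊜ :0) refl (y j))))

    S∩-S : ∀ {x} → S x → S (- x) → Core x
    S∩-S (core h) _ = h
    S∩-S (ver h) (core h') = ⊥-elim (clash₂ p∤-1 (layer-neg (ver-layer h)) (core-layer h'))
    S∩-S (ver h) (ver h')  = ⊥-elim (clash₂ p∤-2 (layer-neg (ver-layer h)) (ver-layer h'))
    S∩-S (ver h) (orb h')  = ⊥-elim (clash₁ p∤-1 (layer-neg (ver-layer h)) (orb-layer h'))
    S∩-S (ver h) (ret h')  = ⊥-elim (clash₁ p∤1 (layer-neg (ver-layer h)) (ret-layer h'))
    S∩-S (orb h) (core h') = ⊥-elim (clash₁ p∤-1 (layer-neg (orb-layer h)) (core-layer h'))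
    S∩-S (orb h) (ver h')  = ⊥-elim (clash₁ p∤-1 (layer-neg (orb-layer h)) (ver-layer h'))
    S∩-S (orb h) (orb h')  = ⊥-elim (clash₁ p∤-2 (layer-neg (orb-layer h)) (orb-layer h'))
    S∩-S (orb h) (ret h')  = ⊥-elim (orb-ret h h')
    S∩-S (ret h) (core h') = ⊥-elim (clash₁ p∤1 (layer-neg (ret-layer h)) (core-layer h'))
    S∩-S (ret h) (ver h')  = ⊥-elim (clash₁ p∤1 (layer-neg (ret-layer h)) (ver-layer h'))
    S∩-S {x} (ret h) (orb h') = ⊥-elim (orb-ret h' (subst Ret (sym (neg-involutive x)) h))
    S∩-S (ret h) (ret h')  = ⊥-elim (clash₁ p∤2 (layer-neg (ret-layer h)) (ret-layer h'))

    core-neg : ∀ {x} → Core x → Core (- x)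
    core-neg {x} (h , x≢0) = T₁-neg h , λ eq → x≢0 (trans (sym (neg-involutive x)) (trans (cong -_ eq) neg-0))

    open Invariance S

    inv-T₁ : Inv T₁
    inv-T₁ = inv-insert-0 (inv-resp (λ (h , h') → S∩-S h h') (λ h → core h , core (core-neg h)) (inv-∩ inv-S (inv-neg inv-S)))

    inv-K : Inv (K ∋_)
    inv-K = inv-resp H⊆K K⊆H (inv-subgroup H T₁⊆H T₁-gen inv-T₁)

    inv-⟨z₂⟩ : Inv (⟨ z₂ ⟩ ∋_)
    inv-⟨z₂⟩ = rigid₁ S inv-T₁

    Mate : A → Set
    Mate d = ⟨ z₂ ⟩ ∋ d × d ≢ 0#

    mated : ∀ {d} i → ¬ p∣ i → S (d - i • z₂) → (S ⊹ Mate) d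
    mated {d} i p∤i h = d - i • z₂ , h , subst Mate (sym back) (multiples i z₂ , p∤i ∘ z₂-order)
      where
      back : d - (d - i • z₂) ≡ i • z₂
      back = solve 2 (λ d m → d :- (d :- m) ⊜ m) refl d (i • z₂)

    ret-slide : ∀ {d} j i → K ∋ d + y j → K ∋ (d - i • z₂) + y j
    ret-slide {d} j i h = subst (K ∋_) (solve 3 (λ d y z → (d :+ y) :- z ⊜ (d :- z) :+ y) refl d (y j) (i • z₂))
      (Subgroup.minus-mem K h (Subgroup.•-mem K i z₂∈K))

    -- A coset of ⟨ z₂ ⟩ contains at most one element of T₂⁺, and p > 2.
    ret-mated : ∀ {d} → Ret d → (S ⊹ Mate) d
    ret-mated {d} (j , h , ∉T₂⁺) with T₂⁺? ((d - 1ℤ • z₂) + y j)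
    ... | no ∉₁ = mated 1ℤ p∤1 (ret (j , ret-slide j 1ℤ h , ∉₁))
    ... | yes ∈₁ = mated (pos 2) p∤2 (ret (j , ret-slide j (pos 2) h , λ ∈₂ → z₂≢0 (begin
        z₂                                                        ≡⟨ difference ⟩
        ((d - 1ℤ • z₂) + y j) - ((d - pos 2 • z₂) + y j)          ≡⟨ cong (_- ((d - pos 2 • z₂) + y j)) (T₂⁺-sep ∈₁ ∈₂ (subst (⟨ z₂ ⟩ ∋_) difference (⊕-gen trivial))) ⟩
        ((d - pos 2 • z₂) + y j) - ((d - pos 2 • z₂) + y j)       ≡⟨ sub-self _ ⟩
        0#                                                        ∎)))
      where
      open ≡-Reasoning
      difference : z₂ ≡ ((d - 1ℤ • z₂) + y j) - ((d - pos 2 • z₂) + y j)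
      difference = solve 3 (λ d y z → z ⊜ ((d :- 1ℤ :• z) :+ y) :- ((d :- pos 2 :• z) :+ y)) refl d (y j) z₂

    -- Outside K, exactly the points of `Orb` are alone in S within their coset of ⟨ z₂ ⟩: `Ver` is
    -- a full coset, and `Ret` misses at most one point of each coset that it meets.
    inv-orb : Inv Orb
    inv-orb = inv-resp to-orb (λ h → (orb h , λ d∈K → clash₁ p∤1 (orb-layer h) (layer-K d∈K)) , unmated h)
      (inv-∩ (inv-∩ inv-S (inv-¬ inv-K)) (inv-¬ (inv-⊹ inv-S (inv-∩ inv-⟨z₂⟩ (inv-¬ inv-0)))))
      where
      to-orb : ∀ {d} → (S d × ¬ K ∋ d) × ¬ (S ⊹ Mate) d → Orb d
      to-orb ((core (h , _) , d∉K) , _) = contradiction (H⊆K (T₁⊆H h)) d∉K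
      to-orb {d} ((ver h , _) , ¬mated) = contradiction (mated 1ℤ p∤1 (ver (subst (⟨ z₂ ⟩ ∋_)
        (solve 3 (λ d e z → (d :- e) :- z ⊜ (d :- z) :- e) refl d e₂ (1ℤ • z₂))
        (Subgroup.minus-mem ⟨ z₂ ⟩ h (multiples 1ℤ z₂))))) ¬mated
      to-orb ((orb h , _) , _) = h
      to-orb ((ret h , _) , ¬mated) = contradiction (ret-mated h) ¬mated
      unmated : ∀ {d} → Orb d → ¬ (S ⊹ Mate) d
      unmated {d} (j , d≡yj) (a , a∈S , m∈ , m≢0) = cases a∈S
        where
        a-layer : Layer 1ℤ j a
        a-layer = layer-resp ≈-refl (≈-reflexive (ℤ.+-identityʳ j))
          (subst (Layer (1ℤ ℤ.- 0ℤ) (j ℤ.- 0ℤ)) (solve 2 (λ d a → d :- (d :- a) ⊜ a) refl d a)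
            (layer-sub (orb-layer (j , d≡yj)) (layer-K (⟨z₂⟩⊆K m∈))))
        cases : ¬ S a
        cases (core h) = clash₁ p∤1 a-layer (core-layer h)
        cases (ver h)  = clash₁ p∤1 a-layer (ver-layer h)
        cases (orb (i , refl)) = m≢0 (trans (cong (_- y i) (trans d≡yj (y-cong (≈-sym (y-index i a-layer))))) (sub-self (y i)))
        cases (ret h)  = clash₁ p∤2 a-layer (ret-layer h)

    orb-y : ∀ j → Orb (y j)
    orb-y j = j , refl

    inv-ret : Inv Ret
    inv-ret = inv-resp
      (λ { {d} (d∈S , a , -a∈Orb , h) → cases d∈S (layer-shift
             (subst (Layer -1ℤ _) (neg-involutive a) (layer-neg (orb-layer -a∈Orb))) h) })
      (λ { {d} (j , h , ∉T₂⁺) → ret (j , h , ∉T₂⁺) , - y j , (j , neg-involutive (y j))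
             , subst (K ∋_) (solve 2 (λ d y → d :+ y ⊜ d :- :- y) refl d (y j)) h })
      (inv-∩ inv-S (inv-⊹ (inv-neg inv-orb) inv-K))
      where
      cases : ∀ {d v} → S d → Layer -1ℤ v d → Ret d
      cases (core h) l = ⊥-elim (clash₁ p∤-1 l (core-layer h))
      cases (ver h)  l = ⊥-elim (clash₁ p∤-1 l (ver-layer h))
      cases (orb h)  l = ⊥-elim (clash₁ p∤-2 l (orb-layer h))
      cases (ret h)  l = h

    inv-ver : Inv Ver
    inv-ver = inv-resp
      (λ { (((core (h , _) , d∉K) , _) , _) → contradiction (H⊆K (T₁⊆H h)) d∉K
         ; (((ver h , _) , _) , _) → h
         ; (((orb h , _) , ¬orb) , _) → contradiction h ¬orb
         ; (((ret h , _) , _) , ¬ret) → contradiction h ¬ret })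
      (λ h → ((ver h , λ d∈K → clash₂ p∤1 (ver-layer h) (layer-K d∈K))
             , λ o → clash₁ p∤-1 (ver-layer h) (orb-layer o))
             , λ r → clash₁ p∤1 (ver-layer h) (ret-layer r))
      (inv-∩ (inv-∩ (inv-∩ inv-S (inv-¬ inv-K)) (inv-¬ inv-orb)) (inv-¬ inv-ret))

    -- The sum of y i and - y j + k lies in K only for y i = y j, when it is k.
    inv-K∖T₂⁺ : Inv (λ d → K ∋ d × ¬ T₂⁺ d)
    inv-K∖T₂⁺ = inv-resp
      (λ { {d} ((a , (j , refl) , (i , h , ∉T₂⁺)) , d∈K) → d∈K , subst (λ w → ¬ T₂⁺ w)
             (trans (cong (d - y j +_) (y-mod-K i j (subst (K ∋_)
               (solve 3 (λ d a b → ((d :- a) :+ b) :- d ⊜ b :- a) refl d (y j) (y i)) (Subgroup.minus-mem K h d∈K))))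
               (solve 2 (λ d a → (d :- a) :+ a ⊜ d) refl d (y j)))
             ∉T₂⁺ })
      (λ {d} (d∈K , d∉T₂⁺) → (y 0ℤ , orb-y 0ℤ , 0ℤ
         , subst (λ w → K ∋ w × ¬ T₂⁺ w) (solve 2 (λ d a → d ⊜ (d :- a) :+ a) refl d (y 0ℤ)) (d∈K , d∉T₂⁺)) , d∈K)
      (inv-∩ (inv-⊹ inv-orb inv-ret) inv-K)

    inv-T₂ : Inv (λ d → ∃[ t ] T₂ t × trivial ∋ d - t)
    inv-T₂ = inv-resp
      (λ { {d} ((d∈K , ¬∖) , d≢0) → case T₂⁺? d of λ
             { (yes (inj₁ d≡0)) → contradiction d≡0 d≢0
             ; (yes (inj₂ d∈))  → d , d∈ , sub-self d
             ; (no d∉)          → contradiction (d∈K , d∉) ¬∖ } })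
      (λ { {d} (t , t∈ , d-t≡0) → subst (λ w → (K ∋ w × ¬ (K ∋ w × ¬ T₂⁺ w)) × w ≢ 0#) (sym (sub≡0 d-t≡0))
             ((H⊆K (T₂⊆H t∈) , λ (_ , t∉) → t∉ (inj₂ t∈)) , λ { refl → T₂∩B t∈ (Subgroup.0-mem ⟨ z₂ ⟩) }) })
      (inv-∩ (inv-∩ inv-K (inv-¬ inv-K∖T₂⁺)) (inv-¬ inv-0))

    -- `Ret` omits single points, so `rigid₂` applies with W trivial. As a consequence, every
    -- automorphism commutes with translation by t.
    inv-singleton : ∀ {t} → T₂ t → Inv (coset (trivial ∋_) t)
    inv-singleton = rigid₂ S trivial (λ { refl → Subgroup.0-mem ⟨ z₂ ⟩ }) inv-T₁ inv-T₂

    module _ (α : Automorphism S) (fix-0 : to α 0# ≡ 0#) (fix-e₁ : to α e₁ ≡ e₁) where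
      Fixed : A → Set
      Fixed x = to α x ≡ x

      Pair : A → Set
      Pair x = Fixed x × Fixed (x + y 0ℤ)

      diff : ∀ x d → (x + d) - x ≡ d
      diff = solve 2 (λ x d → (x :+ d) :- x ⊜ d) refl

      orb-image : ∀ {x} k → Fixed x → ∃[ i ] to α (x + y k) ≡ x + y i
      orb-image {x} k fix =
        let (i , eq) = preserve inv-orb α x (x + y k) (subst Orb (sym (diff x (y k))) (orb-y k))
        in i , (begin
          to α (x + y k)                     ≡⟨ solve 2 (λ a x → a ⊜ x :+ (a :- x)) refl (to α (x + y k)) x ⟩
          x + (to α (x + y k) - x)           ≡⟨ cong (λ w → x + (to α (x + y k) - w)) (sym fix) ⟩
          x + (to α (x + y k) - to α x)      ≡⟨ cong (x +_) eq ⟩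
          x + y i                            ∎)
        where open ≡-Reasoning

      ver-step : ∀ x k → Ver (to α (x + y (k ℤ.+ 1ℤ)) - to α (x + y k))
      ver-step x k = preserve inv-ver α (x + y k) (x + y (k ℤ.+ 1ℤ)) (subst (⟨ z₂ ⟩ ∋_)
        (trans (solve 4 (λ x a e z → z ⊜ ((x :+ (a :+ (e :+ z))) :- (x :+ a)) :- e) refl x (y k) e₂ (k • z₂))
          (cong (λ w → ((x + w) - (x + y k)) - e₂) (sym (y-step k))))
        (multiples k z₂))

      -- The image is some x + y i because `Orb` is invariant, and it differs from the fixed point x
      -- + y k by an element of `Ver`. Second coordinates then give i = k + 1 modulo p.
      ascend : ∀ {x} k → Fixed x → Fixed (x + y k) → Fixed (x + y (k ℤ.+ 1ℤ))
      ascend {x} k fix fixₖ = let (i , eq) = orb-image (k ℤ.+ 1ℤ) fix in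
        trans eq (cong (x +_) (y-cong (y-index i (subst (Layer (1ℤ ℤ.+ 0ℤ) (k ℤ.+ 1ℤ))
          (solve 3 (λ x a b → a :+ ((x :+ b) :- (x :+ a)) ⊜ b) refl x (y k) (y i))
          (layer-+ (y-layer k) (ver-layer (subst₂ (λ u v → Ver (u - v)) eq fixₖ (ver-step x k))))))))

      descend : ∀ {x} k → Fixed x → Fixed (x + y (k ℤ.+ 1ℤ)) → Fixed (x + y k)
      descend {x} k fix fixₖ₊₁ = let (i , eq) = orb-image k fix in
        trans eq (cong (x +_) (y-cong (y-index i (layer-resp ≈-refl (≈-reflexive (cancel k))
          (subst (Layer (1ℤ ℤ.- 0ℤ) ((k ℤ.+ 1ℤ) ℤ.- 1ℤ))
            (solve 3 (λ x a b → b :- ((x :+ b) :- (x :+ a)) ⊜ a) refl x (y i) (y (k ℤ.+ 1ℤ)))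
            (layer-sub (y-layer (k ℤ.+ 1ℤ)) (ver-layer (subst₂ (λ u v → Ver (u - v)) fixₖ₊₁ eq (ver-step x k)))))))))
        where
        cancel : ∀ k → (k ℤ.+ 1ℤ) ℤ.- 1ℤ ≡ k
        cancel = solve-∀

      -- y 0 + y i = y 1 + y k forces k = 0: this is where the quadratic term of y enters.
      closed-y₀ : Closed Pair (y 0ℤ)
      closed-y₀ {x} (fix , fix₀) = fix₀ , descend 0ℤ fix₀ (begin
          to α ((x + y 0ℤ) + y 1ℤ)    ≡⟨ cong (to α) reorder ⟩
          to α ((x + y 1ℤ) + y 0ℤ)    ≡⟨ proj₂ image₁ ⟩
          (x + y 1ℤ) + y k            ≡⟨ cong ((x + y 1ℤ) +_) (y-cong k≈0) ⟩
          (x + y 1ℤ) + y 0ℤ           ≡⟨ sym reorder ⟩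
          (x + y 0ℤ) + y 1ℤ           ∎)
        where
        open ≡-Reasoning
        reorder : (x + y 0ℤ) + y 1ℤ ≡ (x + y 1ℤ) + y 0ℤ
        reorder = solve 3 (λ x a b → (x :+ a) :+ b ⊜ (x :+ b) :+ a) refl x (y 0ℤ) (y 1ℤ)
        image₀ : ∃[ i ] to α ((x + y 0ℤ) + y 1ℤ) ≡ (x + y 0ℤ) + y i
        image₀ = orb-image 1ℤ fix₀
        image₁ : ∃[ k ] to α ((x + y 1ℤ) + y 0ℤ) ≡ (x + y 1ℤ) + y k
        image₁ = orb-image 0ℤ (ascend 0ℤ fix fix₀)
        i k : ℤ
        i = proj₁ image₀
        k = proj₁ image₁
        sums : y i ≡ e₂ + y k
        sums = begin
          y i                                       ≡⟨ solve 3 (λ x a b → b ⊜ ((x :+ a) :+ b) :- (x :+ a)) refl x (y 0ℤ) (y i) ⟩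
          ((x + y 0ℤ) + y i) - (x + y 0ℤ)           ≡⟨ cong (_- (x + y 0ℤ)) (trans (sym (proj₂ image₀)) (trans (cong (to α) reorder) (proj₂ image₁))) ⟩
          ((x + y 1ℤ) + y k) - (x + y 0ℤ)           ≡⟨ cong (λ w → ((x + w) + y k) - (x + y 0ℤ)) y-1 ⟩
          ((x + (y 0ℤ + e₂)) + y k) - (x + y 0ℤ)    ≡⟨ solve 4 (λ x a e b → ((x :+ (a :+ e)) :+ b) :- (x :+ a) ⊜ e :+ b) refl x (y 0ℤ) e₂ (y k) ⟩
          e₂ + y k                                  ∎
        successor : y i ≡ y (k ℤ.+ 1ℤ)
        successor = y-cong (y-index i (subst (Layer (1ℤ ℤ.+ 0ℤ) (k ℤ.+ 1ℤ))
          (trans (solve 2 (λ a b → b :+ a ⊜ a :+ b) refl e₂ (y k)) (sym sums)) (layer-+ (y-layer k) layer-e₂)))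
        k≈0 : k ≈ 0ℤ
        k≈0 = p∣⇒≈0 (z₂-order (begin
          k • z₂                                 ≡⟨ solve 3 (λ a e z → z ⊜ (a :+ (e :+ z)) :- (e :+ a)) refl (y k) e₂ (k • z₂) ⟩
          (y k + (e₂ + k • z₂)) - (e₂ + y k)     ≡⟨ cong₂ _-_ (trans (sym (y-step k)) (sym successor)) (sym sums) ⟩
          y i - y i                              ≡⟨ sub-self (y i) ⟩
          0#                                     ∎))

      -- Both w and its image precede the fixed point w + y 0 by an element of `Orb`. Such
      -- predecessors lie in distinct cosets of K, while w and its image share one.
      confined : ∀ {w} → ⟨ z₂ ⟩ ∋ to α w - w → Fixed (w + y 0ℤ) → Fixed w
      confined {w} near fix₀ =
        let (i , eq) = preserve inv-orb α w (w + y 0ℤ) (subst Orb (sym (diff w (y 0ℤ))) (orb-y 0ℤ))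
            difference = begin
              y 0ℤ - y i                                ≡⟨ cong (λ u → y 0ℤ - u) (sym eq) ⟩
              y 0ℤ - (to α (w + y 0ℤ) - to α w)         ≡⟨ cong (λ u → y 0ℤ - (u - to α w)) fix₀ ⟩
              y 0ℤ - ((w + y 0ℤ) - to α w)              ≡⟨ solve 3 (λ a w b → a :- ((w :+ a) :- b) ⊜ b :- w) refl (y 0ℤ) w (to α w) ⟩
              to α w - w                                ∎
        in sub≡0 (trans (sym difference) (trans (cong (_- y i) (y-mod-K 0ℤ i (subst (K ∋_) (sym difference) (⟨z₂⟩⊆K near)))) (sub-self (y i))))
        where open ≡-Reasoning

      near-ver : ∀ {x d} → Ver d → Fixed x → ⟨ z₂ ⟩ ∋ to α (x + d) - (x + d)
      near-ver {x} {d} h fix = subst (⟨ z₂ ⟩ ∋_)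
        (trans (cong (λ w → ((to α (x + d) - w) - e₂) - (d - e₂)) fix)
          (solve 4 (λ a x d e → ((a :- x) :- e) :- (d :- e) ⊜ a :- (x :+ d)) refl (to α (x + d)) x d e₂))
        (Subgroup.minus-mem ⟨ z₂ ⟩ (preserve inv-ver α x (x + d) (subst Ver (sym (diff x d)) h)) h)

      -- x + e₂ + y 0 is x + y 1, fixed by `ascend`; `confined` then fixes x + e₂ below it.
      closed-e₂ : Closed Pair e₂
      closed-e₂ {x} (fix , fix₀) = confined (near-ver ver-e₂ fix) fix₁ , fix₁
        where
        ver-e₂ : Ver e₂
        ver-e₂ = subst (⟨ z₂ ⟩ ∋_) (sym (sub-self e₂)) (Subgroup.0-mem ⟨ z₂ ⟩)
        fix₁ : Fixed ((x + e₂) + y 0ℤ)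
        fix₁ = subst Fixed (trans (cong (x +_) y-1) (solve 3 (λ x a e → x :+ (a :+ e) ⊜ (x :+ e) :+ a) refl x (y 0ℤ) e₂))
          (ascend 0ℤ fix fix₀)

      -- z₂ is the second difference of the parabola: y 2 = y 0 + 2 e₂ + z₂ gives translation by 2
      -- e₂ + z₂, from which 2 e₂ is cancelled.
      closed-z₂ : Closed Pair z₂
      closed-z₂ = subst (Closed Pair) (solve 2 (λ e z → (e :+ (e :+ z)) :+ (-[1+ 1 ] :• e) ⊜ z) refl e₂ z₂)
        (closed-+ {Pair} closed-2e₂+z₂ (closed-• {Pair} -[1+ 1 ] closed-e₂))
        where
        closed-2e₂+z₂ : Closed Pair (e₂ + (e₂ + z₂))
        closed-2e₂+z₂ {x} h@(fix , fix₀) =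
          subst Fixed (solve 3 (λ x e d → (x :+ e) :+ d ⊜ x :+ (e :+ d)) refl x e₂ (e₂ + z₂))
            (confined (near-ver ver-e₂+z₂ (proj₁ (closed-e₂ h)))
              (subst Fixed (solve 4 (λ x e d a → (x :+ (e :+ d)) :+ a ⊜ ((x :+ e) :+ d) :+ a) refl x e₂ (e₂ + z₂) (y 0ℤ)) fix₂))
          , fix₂
          where
          ver-e₂+z₂ : Ver (e₂ + z₂)
          ver-e₂+z₂ = subst (⟨ z₂ ⟩ ∋_) (solve 2 (λ e z → z ⊜ (e :+ z) :- e) refl e₂ z₂) (⊕-gen trivial)
          fix₂ : Fixed ((x + (e₂ + (e₂ + z₂))) + y 0ℤ)
          fix₂ = subst Fixed (trans (cong (x +_) y-2) (solve 3 (λ x a d → x :+ (a :+ d) ⊜ (x :+ d) :+ a) refl x (y 0ℤ) (e₂ + (e₂ + z₂))))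
            (ascend 1ℤ fix (ascend 0ℤ fix fix₀))

      fixed-T₂ : ∀ {t x} → T₂ t → Fixed x → Fixed (x + t)
      fixed-T₂ {t} {x} t∈ fix = sub≡0 (trans
        (solve 3 (λ a x t → a :- (x :+ t) ⊜ (a :- x) :- t) refl (to α (x + t)) x t)
        (trans (cong (λ w → (to α (x + t) - w) - t) (sym fix))
          (preserve (inv-singleton t∈) α x (x + t) (solve 2 (λ x t → ((x :+ t) :- x) :- t ⊜ :0) refl x t))))

      closed-T₂ : ∀ {t} → T₂ t → Closed Pair t
      closed-T₂ {t} t∈ {x} (fix , fix₀) = fixed-T₂ t∈ fix ,
        subst Fixed (solve 3 (λ x a t → (x :+ a) :+ t ⊜ (x :+ t) :+ a) refl x (y 0ℤ) t) (fixed-T₂ t∈ fix₀)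

      closed-⟨z₂⟩ : (⟨ z₂ ⟩ ∋_) ⊆ Closed Pair
      closed-⟨z₂⟩ h = let (i , eq) = as-multiple h in subst (Closed Pair) (sym eq) (closed-• {Pair} i closed-z₂)

      closed-all : ∀ x → Closed Pair x
      closed-all x = let (u , v , h) = coordinates x in subst (Closed Pair)
        (solve 2 (λ x w → w :+ (x :- w) ⊜ x) refl x (combo u v))
        (closed-+ {Pair} (closed-+ {Pair} (closed-• {Pair} u (subst (Closed Pair) y-0 closed-y₀)) (closed-• {Pair} v closed-e₂))
          (closed-gen {Pair} [ closed-⟨z₂⟩ , closed-T₂ ]′ (T₂-gen (K⊆H h))))

      all-fixed : ∀ x → Fixed x
      all-fixed x = subst Fixed (solve 1 (λ x → :0 :+ x ⊜ x) refl x)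
        (proj₁ (closed-all x (fix-0 , subst Fixed (trans (sym y-0) (solve 1 (λ e → e ⊜ :0 :+ e) refl (y 0ℤ))) fix-e₁)))

    σ-orbit : ∀ (α : Automorphism S) → to α 0# ≡ 0# → ∃[ i ] to α e₁ ≡ σ i e₁
    σ-orbit α fix-0 = let (i , eq) = preserve inv-orb α 0# e₁ (subst Orb (sym (sub-0 e₁)) (0ℤ , sym y-0)) in
      i , trans (sym (sub-0 (to α e₁))) (trans (cong (λ w → to α e₁ - w) (sym fix-0)) eq)

    σ-S : ∀ i {x} → S x → S (σ i x)
    σ-S i (core (h , x≢0)) = core (subst Core (sym (σ-K i (H⊆K (T₁⊆H h)))) (h , x≢0))
    σ-S i (ver h) = ver (σ-coset ⟨ z₂ ⟩ i ⟨z₂⟩⊆K (subst (⟨ z₂ ⟩ ∋_) (sym (σ-e₂-moves i)) (multiples i z₂)) h)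
    σ-S i (orb (j , refl)) = orb (i ℤ.+ j , σ-σ i j e₁)
    σ-S i {x} (ret (j , h , ∉T₂⁺)) = ret (i ℤ.+ j , subst (λ w → K ∋ w × ¬ T₂⁺ w) (begin
        x + y j                    ≡⟨ sym (σ-K i h) ⟩
        σ i (x + y j)              ≡⟨ σ-+ i x (y j) ⟩
        σ i x + σ i (y j)          ≡⟨ cong (σ i x +_) (σ-σ i j e₁) ⟩
        σ i x + y (i ℤ.+ j)        ∎) (h , ∉T₂⁺))
      where open ≡-Reasoning

    any-residue? : ∀ {P : A → Set} → (∀ x → Dec (P x)) → Dec (∃[ j ] P (y j))
    any-residue? {P} P? = map′ (λ (r , h) → pos (toℕ r) , h)
      (λ (j , h) → residue j , subst P (y-cong (≈-sym (residue-≈ j))) h)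
      (any? {p} (λ r → P? (y (pos (toℕ r)))))

    S? : ∀ x → Dec (S x)
    S? x = (T₁? x ×-dec ¬? (x ≟ 0#)) ⊎-dec
           (Subgroup.mem? ⟨ z₂ ⟩ (x - e₂) ⊎-dec
           (any-residue? (λ w → x ≟ w) ⊎-dec
            any-residue? (λ w → Subgroup.mem? K (x + w) ×-dec ¬? (T₂⁺? (x + w)))))

    0∉S : ¬ S 0#
    0∉S (core (_ , 0≢0)) = 0≢0 refl
    0∉S (ver h) = clash₂ p∤-1 (layer-K (Subgroup.0-mem K)) (ver-layer h)
    0∉S (orb h) = clash₁ p∤-1 (layer-K (Subgroup.0-mem K)) (orb-layer h)
    0∉S (ret h) = clash₁ p∤1 (layer-K (Subgroup.0-mem K)) (ret-layer h)

    connectionSet : RigidConnectionSet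
    connectionSet = record
      { S = S
      ; S? = S?
      ; 0∉S = 0∉S
      ; e₁∈S = orb (0ℤ , sym y-0)
      ; -e₁∉S = λ h → clash₁ p∤1 layer-e₁ (core-layer (S∩-S (orb (0ℤ , sym y-0)) h))
      ; S-σ = σ-S
      ; orbit = σ-orbit
      ; rigid = all-fixed }

  rigidConnectionSet : RigidConnectionSet
  rigidConnectionSet = Connection.connectionSet (proj₁ chain) (proj₂ chain)

-- Choice of K, e₁, e₂, z₁ and z₂.

module Existence (G : FinGroup) (comm : IsAbelian G)
                 (p : ℕ) (isPrime : Prime p) (odd : ¬ (2 ∣ p)) where
  open Frames G comm p isPrime odd

  find-outside : ∀ (H : Subgroup) → ¬ (∀ x → H ∋ x) → ∃[ x ] ¬ H ∋ x
  find-outside H ¬all with any? (λ x → ¬? (Subgroup.mem? H x))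
  ... | yes outside = outside
  ... | no ¬outside = contradiction
    (λ x → decidable-stable (Subgroup.mem? H x) (λ x∉H → ¬outside (x , x∉H))) ¬all

  p•-power : ∀ k x → pos (p ^ suc k) • x ≡ pos (p ^ k) • p• x
  p•-power k x = trans (cong (λ j → pos j • x) (ℕ.*-comm p (p ^ k)))
    (trans (cong (_• x) (ℤ.pos-* (p ^ k) p)) (•-• (pos (p ^ k)) (pos p) x))

  •-comm : ∀ i j x → i • (j • x) ≡ j • (i • x)
  •-comm i j x = trans (sym (•-• i j x)) (trans (cong (_• x) (ℤ.*-comm i j)) (•-• j i x))

  p•-∣ : ∀ (H : Subgroup) {x i} → H ∋ p• x → p∣ i → H ∋ i • x
  p•-∣ H {x} h (divides q refl) = subst (H ∋_) (sym (•-• q (pos p) x)) (Subgroup.•-mem H q h)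

  cyclic : ∀ g → (∀ x → ⟨ g ⟩ ∋ x) → IsCyclic G
  cyclic g spans = g , λ x →
    let (i , x≡ig) = as-multiple (spans x)
        (r , ig≡rg) = multiple-residue i g
    in toℕ r , sym (trans x≡ig ig≡rg)

  -- Lowering k while p^k still kills G stops at the exponent of G, and a is then an element of
  -- maximal order.
  exponent : ∀ k → (∀ x → pos (p ^ k) • x ≡ 0#) →
    (∀ x → x ≡ 0#) ⊎ ∃[ m ] ∃[ a ] (∀ x → pos (p ^ suc m) • x ≡ 0#) × pos (p ^ m) • a ≢ 0#
  exponent zero    kills = inj₁ (λ x → trans (sym (1-• x)) (kills x))
  exponent (suc k) kills with any? (λ x → ¬? (pos (p ^ k) • x ≟ 0#))
  ... | yes (a , pᵏa≢0) = inj₂ (k , a , kills , pᵏa≢0)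
  ... | no ¬∃ = exponent k (λ x → decidable-stable (pos (p ^ k) • x ≟ 0#) (λ ≢0 → ¬∃ (x , ≢0)))

  -- b is the last of x, p x, p² x, ... before the sequence first enters H.
  last-outside : ∀ (H : Subgroup) k {x} → ¬ H ∋ x → H ∋ pos (p ^ k) • x → ∃[ b ] ¬ H ∋ b × H ∋ p• b
  last-outside H zero    {x} x∉H h = contradiction (subst (H ∋_) (1-• x) h) x∉H
  last-outside H (suc k) {x} x∉H h with Subgroup.mem? H (p• x)
  ... | yes px∈H = x , x∉H , px∈H
  ... | no px∉H  = last-outside H k px∉H (subst (H ∋_) (p•-power k x) h)

  -- Since a has maximal order, p b = j a forces p ∣ j, and b - (j / p) a has order p.
  independent-torsion : ¬ IsCyclic G → ∀ m a → (∀ x → pos (p ^ suc m) • x ≡ 0#) → pos (p ^ m) • a ≢ 0# →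
    ∃[ z ] p• z ≡ 0# × ¬ ⟨ pos (p ^ m) • a ⟩ ∋ z
  independent-torsion ¬cyclic m a kills pᵐa≢0 =
    z , (begin
      p• (b - q • a)              ≡⟨ •-distrib (pos p) b _ ⟩
      p• b + p• (- (q • a))       ≡⟨ cong₂ _+_ pb≡ja (cong p• (sym (•-neg q a))) ⟩
      j • a + p• ((ℤ.- q) • a)    ≡⟨ cong₂ _+_ (cong (_• a) j≡qp) (trans (sym (•-• (pos p) (ℤ.- q) a)) (cong (_• a) (flip (pos p) q))) ⟩
      (q ℤ.* pos p) • a + (ℤ.- (q ℤ.* pos p)) • a  ≡⟨ cong ((q ℤ.* pos p) • a +_) (•-neg (q ℤ.* pos p) a) ⟩
      (q ℤ.* pos p) • a - (q ℤ.* pos p) • a        ≡⟨ sub-self _ ⟩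
      0#                          ∎)
    , λ z∈ → b∉⟨a⟩ (subst (⟨ a ⟩ ∋_) (solve 2 (λ b a → (b :- a) :+ a ⊜ b) refl b (q • a))
        (Subgroup.+-mem ⟨ a ⟩
          (⊕-least trivial ⟨ a ⟩ (λ { refl → Subgroup.0-mem ⟨ a ⟩ }) (multiples (pos (p ^ m)) a) z∈)
          (multiples q a)))
    where
    open ≡-Reasoning
    flip : ∀ p q → p ℤ.* (ℤ.- q) ≡ ℤ.- (q ℤ.* p)
    flip = solve-∀
    outside : ∃[ x ] ¬ ⟨ a ⟩ ∋ x
    outside = find-outside ⟨ a ⟩ (¬cyclic ∘ cyclic a)
    descent : ∃[ b ] ¬ ⟨ a ⟩ ∋ b × ⟨ a ⟩ ∋ p• b
    descent = last-outside ⟨ a ⟩ (suc m) (proj₂ outside)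
      (subst (⟨ a ⟩ ∋_) (sym (kills (proj₁ outside))) (Subgroup.0-mem ⟨ a ⟩))
    b : A
    b = proj₁ descent
    b∉⟨a⟩ : ¬ ⟨ a ⟩ ∋ b
    b∉⟨a⟩ = proj₁ (proj₂ descent)
    j : ℤ
    j = proj₁ (as-multiple (proj₂ (proj₂ descent)))
    pb≡ja : p• b ≡ j • a
    pb≡ja = proj₂ (as-multiple (proj₂ (proj₂ descent)))
    p∣j : p∣ j
    p∣j = order-mod trivial (trans (•-comm (pos p) (pos (p ^ m)) a) (trans (sym (p•-power m a)) (kills a))) pᵐa≢0
      (begin
        j • (pos (p ^ m) • a)     ≡⟨ •-comm j (pos (p ^ m)) a ⟩
        pos (p ^ m) • (j • a)     ≡⟨ cong (pos (p ^ m) •_) (sym pb≡ja) ⟩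
        pos (p ^ m) • p• b        ≡⟨ sym (p•-power m b) ⟩
        pos (p ^ suc m) • b       ≡⟨ kills b ⟩
        0#                        ∎)
    q : ℤ
    q = _∣ℤ_.quotient p∣j
    j≡qp : j ≡ q ℤ.* pos p
    j≡qp = _∣ℤ_.equality p∣j
    z : A
    z = b - q • a

  -- Substituting G = p G + ⟨ g ⟩ into itself gives G = p^k G + ⟨ g ⟩ for every k, and p^k G
  -- vanishes eventually.
  frattini : ¬ IsCyclic G → ∀ k → (∀ x → pos (p ^ k) • x ≡ 0#) →
    ∀ g → ¬ (∀ x → image (pos p) ⊕⟨ g ⟩ ∋ x)
  frattini ¬cyclic k kills g spans = ¬cyclic (cyclic g (λ x → collapse (descend k x)))
    where
    collapse : ∀ {x} → image (pos (p ^ k)) ⊕⟨ g ⟩ ∋ x → ⟨ g ⟩ ∋ x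
    collapse (i , w , eq) = i , trans eq (kills w)
    descend : ∀ k x → image (pos (p ^ k)) ⊕⟨ g ⟩ ∋ x
    descend zero    x = 0ℤ , x , trans (sub-0 x) (sym (1-• x))
    descend (suc k) x =
      let (i , w , x-ig≡pᵏw) = descend k x
          (j , v , w-jg≡pv)  = spans w
          pᵏ = pos (p ^ k)
      in i ℤ.+ pᵏ ℤ.* j , v , (begin
        x - (i ℤ.+ pᵏ ℤ.* j) • g                ≡⟨ cong (λ w → x - w) (trans (•-+ i (pᵏ ℤ.* j) g) (cong (i • g +_) (•-• pᵏ j g))) ⟩
        x - (i • g + pᵏ • (j • g))              ≡⟨ solve 3 (λ x a b → x :- (a :+ b) ⊜ (x :- a) :- b) refl x (i • g) (pᵏ • (j • g)) ⟩
        (x - i • g) - pᵏ • (j • g)              ≡⟨ cong (_- pᵏ • (j • g)) x-ig≡pᵏw ⟩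
        pᵏ • w - pᵏ • (j • g)                   ≡⟨ cong (_- pᵏ • (j • g)) (cong (pᵏ •_) (trans (solve 2 (λ w g → w ⊜ (w :- g) :+ g) refl w (j • g)) (cong (_+ j • g) w-jg≡pv))) ⟩
        pᵏ • (p• v + j • g) - pᵏ • (j • g)      ≡⟨ cong (_- pᵏ • (j • g)) (•-distrib pᵏ (p• v) (j • g)) ⟩
        (pᵏ • p• v + pᵏ • (j • g)) - pᵏ • (j • g) ≡⟨ solve 2 (λ a b → (a :+ b) :- b ⊜ a) refl (pᵏ • p• v) (pᵏ • (j • g)) ⟩
        pᵏ • p• v                               ≡⟨ sym (p•-power k v) ⟩
        pos (p ^ suc k) • v                     ∎)
      where open ≡-Reasoning

  two-generators-small : (∀ x → p• x ≡ 0#) → ∀ g h → (∀ x → ∃[ i ] ∃[ j ] x ≡ i • g + j • h) → n ≤ p * p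
  two-generators-small kills g h spans = injective⇒≤ {f = code} (λ {x} {x'} eq →
    trans (sym (decode-code x)) (trans (cong (decode ∘ remQuot {p} p) eq) (decode-code x')))
    where
    decode : Fin p × Fin p → A
    decode (r , s) = pos (toℕ r) • g + pos (toℕ s) • h
    code : A → Fin (p * p)
    code x = let (i , j , _) = spans x in combine (residue i) (residue j)
    decode-code : ∀ x → decode (remQuot {p} p (code x)) ≡ x
    decode-code x = let (i , j , eq) = spans x in
      trans (cong decode (remQuot-combine (residue i) (residue j)))
        (trans (cong₂ _+_ (•-cong (kills g) (residue-≈ i)) (•-cong (kills h) (residue-≈ j))) (sym eq))

  p³≰p² : ¬ (p ^ 3 ≤ p * p)
  p³≰p² le = ℕ.<⇒≱ (ℕ.^-monoʳ-< p (ℕ.<-trans (s≤s (s≤s z≤n)) 2<p) {2} {3} ℕ.≤-refl)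
    (ℕ.≤-trans le (ℕ.≤-reflexive (cong (p *_) (sym (ℕ.*-identityʳ p)))))

  -- The least subgroup that K has to contain: p G makes the quotient elementary abelian, and p^m a
  -- is going to be z₂.
  base : ℕ → A → Subgroup
  base m a = image (pos p) ⊕⟨ pos (p ^ m) • a ⟩

  -- For m = 0 the group has exponent p, and a and g together span at most p² elements: here the
  -- order bound enters. For larger m the element p^m a is already in p G, and `frattini` applies.
  beyond-base : ¬ IsCyclic G → p ^ 3 ≤ n → ∀ m a → (∀ x → pos (p ^ suc m) • x ≡ 0#) →
    ∀ g → ∃[ x ] ¬ base m a ⊕⟨ g ⟩ ∋ x
  beyond-base ¬cyclic p³≤n zero a kills g = find-outside (base zero a ⊕⟨ g ⟩) (λ spans →
    p³≰p² (ℕ.≤-trans p³≤n (two-generators-small p-torsion (pos (p ^ 0) • a) g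
      (λ x → let (j , i , w , eq) = spans x in i , j ,
        trans (solve 3 (λ x a b → x ⊜ ((x :- b) :- a) :+ (a :+ b)) refl x (i • pos (p ^ 0) • a) (j • g))
          (trans (cong (_+ (i • pos (p ^ 0) • a + j • g)) (trans eq (p-torsion w)))
            (solve 1 (λ x → :0 :+ x ⊜ x) refl _))))))
    where
    p-torsion : ∀ x → p• x ≡ 0#
    p-torsion x = trans (cong (λ k → pos k • x) (sym (ℕ.*-identityʳ p))) (kills x)
  beyond-base ¬cyclic p³≤n (suc m) a kills g = find-outside (base (suc m) a ⊕⟨ g ⟩) (λ spans →
    frattini ¬cyclic (suc (suc m)) kills g (λ x →
      ⊕-least (base (suc m) a) (image (pos p) ⊕⟨ g ⟩) (⊕-base (image (pos p)) ∘ absorb) (⊕-gen (image (pos p))) (spans x)))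
    where
    absorb : (base (suc m) a ∋_) ⊆ (image (pos p) ∋_)
    absorb = ⊕-least (image (pos p)) (image (pos p)) id
      (pos (p ^ m) • a , trans (p•-power m a) (•-comm (pos (p ^ m)) (pos p) a))

  ⊕-mono : ∀ (H L : Subgroup) {g} → (H ∋_) ⊆ (L ∋_) → (H ⊕⟨ g ⟩ ∋_) ⊆ (L ⊕⟨ g ⟩ ∋_)
  ⊕-mono H L {g} H⊆L = ⊕-least H (L ⊕⟨ g ⟩) (⊕-base L ∘ H⊆L) (⊕-gen L)

  record Complement (H₀ : Subgroup) (a b : A) : Set₁ where
    field
      K           : Subgroup
      H₀⊆K        : (H₀ ∋_) ⊆ (K ∋_)
      spans       : ∀ x → ∃[ u ] ∃[ v ] K ∋ x - (u • a + v • b)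
      independent : ∀ u v → K ∋ u • a + v • b → p∣ u × p∣ v

  -- K is a maximal subgroup containing H₀ modulo which a and b stay independent.
  complement : ∀ (H₀ : Subgroup) a b → (∀ x → H₀ ∋ p• x) → ¬ H₀ ∋ a → ¬ H₀ ⊕⟨ a ⟩ ∋ b → Complement H₀ a b
  complement H₀ a b p•∈H₀ a∉H₀ b∉H₀a = record
    { K = K ; H₀⊆K = H₀⊆K
    ; spans = λ x → let (v , u , h) = All.lookup covers (∈-allFin x) in u , v ,
        subst (K ∋_) (solve 3 (λ x u v → (x :- v) :- u ⊜ x :- (u :+ v)) refl x (u • a) (v • b)) h
    ; independent = λ u v h →
        let p∣v = order-mod (K ⊕⟨ a ⟩) (⊕-base K (H₀⊆K (p•∈H₀ b))) b∉Ka
              (Subgroup.cancelʳ (K ⊕⟨ a ⟩) (Subgroup.•-mem (K ⊕⟨ a ⟩) u (⊕-gen K))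
                (⊕-base K (subst (K ∋_) (solve 2 (λ u v → u :+ v ⊜ v :+ u) refl (u • a) (v • b)) h)))
        in order-mod K (H₀⊆K (p•∈H₀ a)) a∉K (Subgroup.cancelʳ K (p•-∣ K (H₀⊆K (p•∈H₀ b)) p∣v) h) , p∣v }
    where
    Stage : List A → Set₁
    Stage xs = Σ[ K ∈ Subgroup ] (H₀ ∋_) ⊆ (K ∋_) × ¬ K ∋ a × ¬ K ⊕⟨ a ⟩ ∋ b × All (K ⊕⟨ a ⟩ ⊕⟨ b ⟩ ∋_) xs
    grow : ∀ xs → Stage xs
    grow [] = H₀ , id , a∉H₀ , b∉H₀a , []
    grow (x ∷ xs) with grow xs
    ... | K , H₀⊆K , a∉K , b∉Ka , covers
        with Subgroup.mem? (K ⊕⟨ x ⟩) a | Subgroup.mem? (K ⊕⟨ x ⟩ ⊕⟨ a ⟩) b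
    ...   | no a∉Kx | no b∉Kxa = K ⊕⟨ x ⟩ , ⊕-base K ∘ H₀⊆K , a∉Kx , b∉Kxa ,
              ⊕-base (K ⊕⟨ x ⟩ ⊕⟨ a ⟩) (⊕-base (K ⊕⟨ x ⟩) (⊕-gen K))
              ∷ All.map (⊕-mono (K ⊕⟨ a ⟩) (K ⊕⟨ x ⟩ ⊕⟨ a ⟩) (⊕-mono K (K ⊕⟨ x ⟩) (⊕-base K))) covers
    -- If K + ⟨ x ⟩ captures a, the coefficient j of x is prime to p, for otherwise a would lie in
    -- K. The relation can therefore be solved for x. The same happens below with b.
    ...   | yes (j , h) | _ = K , H₀⊆K , a∉K , b∉Ka , x∈ ∷ covers
            where
            p∤j : ¬ p∣ j
            p∤j p∣j = a∉K (subst (K ∋_) (solve 2 (λ a x → (a :- x) :+ x ⊜ a) refl a (j • x))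
              (Subgroup.+-mem K h (p•-∣ K (H₀⊆K (p•∈H₀ x)) p∣j)))
            x∈ : K ⊕⟨ a ⟩ ⊕⟨ b ⟩ ∋ x
            x∈ = ⊕-base (K ⊕⟨ a ⟩) (invert (K ⊕⟨ a ⟩) (⊕-base K (H₀⊆K (p•∈H₀ x))) p∤j
              (subst (K ⊕⟨ a ⟩ ∋_) (solve 2 (λ a x → a :- (a :- x) ⊜ x) refl a (j • x))
                (Subgroup.minus-mem (K ⊕⟨ a ⟩) (⊕-gen K) (⊕-base K h))))
    ...   | no _ | yes (i , j , h) = K , H₀⊆K , a∉K , b∉Ka , x∈ ∷ covers
            where
            p∤j : ¬ p∣ j
            p∤j p∣j = b∉Ka (i , subst (K ∋_) (solve 2 (λ b x → (b :- x) :+ x ⊜ b) refl (b - i • a) (j • x))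
              (Subgroup.+-mem K h (p•-∣ K (H₀⊆K (p•∈H₀ x)) p∣j)))
            Kab = K ⊕⟨ a ⟩ ⊕⟨ b ⟩
            K⊆Kab : (K ∋_) ⊆ (Kab ∋_)
            K⊆Kab = ⊕-base (K ⊕⟨ a ⟩) ∘ ⊕-base K
            x∈ : Kab ∋ x
            x∈ = invert Kab (K⊆Kab (H₀⊆K (p•∈H₀ x))) p∤j
              (subst (Kab ∋_) (solve 3 (λ b a x → (b :- a) :- ((b :- a) :- x) ⊜ x) refl b (i • a) (j • x))
                (Subgroup.minus-mem Kab
                  (Subgroup.minus-mem Kab (⊕-gen (K ⊕⟨ a ⟩)) (Subgroup.•-mem Kab i (⊕-base (K ⊕⟨ a ⟩) (⊕-gen K))))
                  (K⊆Kab h)))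
    final : Stage (allFin n)
    final = grow (allFin n)
    K = proj₁ final
    H₀⊆K : (H₀ ∋_) ⊆ (K ∋_)
    H₀⊆K = proj₁ (proj₂ final)
    a∉K = proj₁ (proj₂ (proj₂ final))
    b∉Ka = proj₁ (proj₂ (proj₂ (proj₂ final)))
    covers = proj₂ (proj₂ (proj₂ (proj₂ final)))

  AdmissibleFrame : Set₁
  AdmissibleFrame = Σ[ F ∈ Frame ] (Frame.c F ≡ 0ℤ ⊎ (Frame.c F ≡ 1ℤ × Frame.z₁ F ≡ Frame.e₂ F))

  -- If z₁ lies in H₀, it lies in K whatever basis is chosen. If not, it survives modulo H₀ and can
  -- itself be a basis vector. Hence c = 0 and c = 1 suffice.
  frame : ∀ k → n ≡ p ^ k → p ^ 3 ≤ n → ¬ IsCyclic G → AdmissibleFrame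
  frame k n≡pᵏ p³≤n ¬cyclic with exponent k (λ x → subst (λ j → pos j • x ≡ 0#) n≡pᵏ (order-• x))
  ... | inj₁ all-0 = contradiction (0# , λ x → 0 , sym (all-0 x)) ¬cyclic
  ... | inj₂ (m , a , kills , pᵐa≢0) = choose (Subgroup.mem? H₀ z₁)
    where
    z₂ z₁ : A
    z₂ = pos (p ^ m) • a
    z₁ = proj₁ (independent-torsion ¬cyclic m a kills pᵐa≢0)
    pz₁≡0 : p• z₁ ≡ 0#
    pz₁≡0 = proj₁ (proj₂ (independent-torsion ¬cyclic m a kills pᵐa≢0))
    z₁∉⟨z₂⟩ : ¬ ⟨ z₂ ⟩ ∋ z₁
    z₁∉⟨z₂⟩ = proj₂ (proj₂ (independent-torsion ¬cyclic m a kills pᵐa≢0))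
    pz₂≡0 : p• z₂ ≡ 0#
    pz₂≡0 = trans (•-comm (pos p) (pos (p ^ m)) a) (trans (sym (p•-power m a)) (kills a))
    H₀ : Subgroup
    H₀ = base m a
    p•∈H₀ : ∀ x → H₀ ∋ p• x
    p•∈H₀ x = ⊕-base (image (pos p)) (x , refl)
    beyond : ∀ g → ∃[ x ] ¬ H₀ ⊕⟨ g ⟩ ∋ x
    beyond = beyond-base ¬cyclic p³≤n m a kills

    choose : Dec (H₀ ∋ z₁) → AdmissibleFrame
    choose (yes z₁∈H₀) = record
      { K = K ; e₁ = e₁ ; e₂ = e₂ ; z₁ = z₁ ; z₂ = z₂ ; c = 0ℤ
      ; p•∈K = λ x → H₀⊆K (p•∈H₀ x) ; pz₁≡0 = pz₁≡0 ; pz₂≡0 = pz₂≡0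
      ; z₂∈K = H₀⊆K (⊕-gen (image (pos p))) ; z₂≢0 = pᵐa≢0 ; z₁∉⟨z₂⟩ = z₁∉⟨z₂⟩
      ; z₁-mod-K = subst (K ∋_) (sym (sub-0 z₁)) (H₀⊆K z₁∈H₀)
      ; coordinates = spans ; independent = independent } , inj₁ refl
      where
      e₁ e₂ : A
      e₁ = proj₁ (beyond 0#)
      e₂ = proj₁ (beyond e₁)
      open Complement (complement H₀ e₁ e₂ p•∈H₀ (proj₂ (beyond 0#) ∘ ⊕-base H₀) (proj₂ (beyond e₁)))
    choose (no z₁∉H₀) = record
      { K = K ; e₁ = e₁ ; e₂ = z₁ ; z₁ = z₁ ; z₂ = z₂ ; c = 1ℤ
      ; p•∈K = λ x → H₀⊆K (p•∈H₀ x) ; pz₁≡0 = pz₁≡0 ; pz₂≡0 = pz₂≡0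
      ; z₂∈K = H₀⊆K (⊕-gen (image (pos p))) ; z₂≢0 = pᵐa≢0 ; z₁∉⟨z₂⟩ = z₁∉⟨z₂⟩
      ; z₁-mod-K = subst (K ∋_) (sym (trans (cong (λ w → z₁ - w) (1-• z₁)) (sub-self z₁))) (Subgroup.0-mem K)
      -- e₁ is chosen outside H₀ + ⟨ z₁ ⟩, so `complement` takes z₁ as its first vector; the frame
      -- lists it second, and the coordinates are swapped.
      ; coordinates = λ x → let (u , v , h) = spans x in v , u , subst (λ w → K ∋ x - w) (swap (u • z₁) (v • e₁)) h
      ; independent = λ u v h → let (p∣v , p∣u) = independent v u (subst (K ∋_) (swap (u • e₁) (v • z₁)) h) in p∣u , p∣v }
      , inj₂ (refl , refl)
      where
      e₁ : A
      e₁ = proj₁ (beyond z₁)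
      swap : ∀ u v → u + v ≡ v + u
      swap = solve 2 (λ u v → u :+ v ⊜ v :+ u) refl
      open Complement (complement H₀ z₁ e₁ p•∈H₀ z₁∉H₀ (proj₂ (beyond z₁)))

theorem1p1 : (p : ℕ) → Prime p → ¬ (2 ∣ p) →
    (G : FinGroup) → IsAbelian G →
    (∃[ k ] (FinGroup.order G ≡ p ^ k)) →
    p ^ 3 ≤ FinGroup.order G →
    ¬ IsCyclic G →
    Σ (Subset (FinGroup.order G)) λ S →
    FinGroup.e G ∉ S ×
    IsProper (CayArc G S) ×
    AutOrder (CayArc G S) (p * FinGroup.order G) ×
    HasNonabelianRegularSubgroup (CayArc G S)
theorem1p1 p isPrime odd G comm (k , n≡pᵏ) p³≤n ¬cyclic
  with Existence.frame G comm p isPrime odd k n≡pᵏ p³≤n ¬cyclic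
... | F , inj₁ c≡0 = Conclusion.Assemble.conclusion G comm p isPrime odd F
        (SplitCase.rigidConnectionSet G comm p isPrime odd F c≡0)
... | F , inj₂ (c≡1 , z₁≡e₂) = Conclusion.Assemble.conclusion G comm p isPrime odd F
        (JordanCase.rigidConnectionSet G comm p isPrime odd F c≡1 z₁≡e₂)
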